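{- For all integers $d,u,v>0$ such that $u+v=d$, $$\mathrm{rank}(\mathit{Cat}_{h_d}(u,v))\le\binom{\lceil3d/2\rceil}{\lfloor d/2\rfloor}<2.6^d.$$
   Context: $\mathcal{S}_j^m$ denotes the space of homogeneous degree-$j$ polynomials in $m$ variables over $\mathbb{C}$. $h_d\in\mathcal{S}_d^{2d-1}$ is the determinant of the symbolic $d\times d$ Hankel matrix whose $(i,j)$ entry is the variable $x_{i+j}$ (variables $x_2,\ldots,x_{2d}$). For $g\in\mathcal{S}_d^m$ and $u+v=d$, the catalecticant is the linear map $\mathit{Cat}_g(u,v):\mathcal{S}_u^m\to\mathcal{S}_v^m$, $f\mapsto f(\partial\mathbf{x})g$, where $f(\partial\mathbf{x})$ is the differential operator obtained by substituting for each variable in $f$ the partial derivative with respect to that variable. -}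

module Defs where

open import Algebra.Bundles using (CommutativeRing; RawRing)
import Algebra.Definitions.RawMonoid as RawMonoidDefinitions
import Algebra.Definitions.RawSemiring as RawSemiringDefinitions
open import Algebra.Module.Bundles using (LeftModule)
open import Algebra.Module.Morphism.Structures using (module LeftModuleMorphisms)
import Algebra.Properties.AbelianGroup as AbelianGroupProperties
import Algebra.Properties.CommutativeSemigroup as CommutativeSemigroupProperties
import Algebra.Properties.Ring as RingProperties
import Algebra.Solver.Ring.NaturalCoefficients.Default as NaturalCoefficientsSolver
open import Data.Bool.Base using (if_then_else_)
open import Data.Fin.Base using (Fin; zero; suc; toℕ; fromℕ<; punchIn)
open import Data.Fin.Properties using (toℕ≤pred[n])
open import Data.List.Base as List using (List; []; _∷_; allFin; concatMap)
open import Data.List.Relation.Unary.All using (All; []; _∷_)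
import Data.List.Relation.Unary.All as All
import Data.List.Relation.Unary.All.Properties as Allₚ
open import Data.Nat.Base as ℕ using (ℕ; zero; suc; _∸_; s≤s)
open import Data.Nat.GeneralisedArithmetic using (fold)
import Data.Nat.Properties as ℕₚ
open import Data.Product.Base using (∃; _×_; _,_)
open import Data.Rational.Base as ℚ using (ℚ; 0ℚ; 1ℚ; ½)
import Data.Rational.Properties as ℚₚ
import Data.Rational.Solver as ℚSolver
open import Data.Vec.Base as Vec using (Vec; []; _∷_; updateAt; lookup)
import Data.Vec.Functional as Vector
import Data.Vec.Properties as Vecₚ
open import Function.Base using (_∘_)
open import Level using (0ℓ; _⊔_)
open import Relation.Binary.PropositionalEquality as ≡ using (_≡_; _≢_)
import Relation.Binary.Reasoning.Setoid as SetoidReasoning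
open import Relation.Nullary using (yes; no; does; contradiction)

-- Reals are Cauchy sequences of rationals, with no prescribed rate of
-- convergence.  Writing x ∼ y for "x m - y n becomes arbitrarily small
-- as m and n grow independently", x is Cauchy precisely when x ∼ x, and
-- two Cauchy sequences have the same limit precisely when x ∼ y.

Small : (ℕ → ℕ → ℚ) → Set
Small s = ∀ ε → 0ℚ ℚ.< ε →
  ∃ λ N → ∀ m n → N ℕ.≤ m → N ℕ.≤ n → ℚ.∣ s m n ∣ ℚ.< ε

infix 4 _∼_

_∼_ : (ℕ → ℚ) → (ℕ → ℚ) → Set
x ∼ y = Small (λ m n → x m ℚ.- y n)

record ℝ : Set where
  constructor mkℝ
  field
    seq    : ℕ → ℚ
    cauchy : seq ∼ seq

open ℝ public

infix 4 _≈ℝ_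

record _≈ℝ_ (x y : ℝ) : Set where
  constructor mk≈ℝ
  field
    close : seq x ∼ seq y

open _≈ℝ_ public

Bounded : (ℕ → ℕ → ℚ) → Set
Bounded s = ∃ λ B → 0ℚ ℚ.< B ×
  ∃ λ N → ∀ m n → N ℕ.≤ m → N ℕ.≤ n → ℚ.∣ s m n ∣ ℚ.≤ B

abstract

  half-pos : ∀ {ε} → 0ℚ ℚ.< ε → 0ℚ ℚ.< ½ ℚ.* ε
  half-pos {ε} 0<ε =
    ≡.subst (ℚ._< ½ ℚ.* ε) (ℚₚ.*-zeroʳ ½) (ℚₚ.*-monoʳ-<-pos ½ 0<ε)

  halves : ∀ ε → ½ ℚ.* ε ℚ.+ ½ ℚ.* ε ≡ ε
  halves = solve 1 (λ e → con ½ :* e :+ con ½ :* e := e) ≡.refl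
    where open ℚSolver.+-*-Solver

  small-cong : ∀ {s t} → (∀ m n → s m n ≡ t m n) → Small s → Small t
  small-cong s≗t S ε 0<ε with S ε 0<ε
  ... | N , p = N , λ m n N≤m N≤n →
    ≡.subst (λ q → ℚ.∣ q ∣ ℚ.< ε) (s≗t m n) (p m n N≤m N≤n)

  small-+ : ∀ {s t} → Small s → Small t → Small (λ m n → s m n ℚ.+ t m n)
  small-+ {s} {t} S T ε 0<ε
    with S (½ ℚ.* ε) (half-pos 0<ε) | T (½ ℚ.* ε) (half-pos 0<ε)
  ... | N , p | N′ , p′ = N ℕ.⊔ N′ , λ m n N≤m N≤n → begin-strict
    ℚ.∣ s m n ℚ.+ t m n ∣          ≤⟨ ℚₚ.∣p+q∣≤∣p∣+∣q∣ (s m n) (t m n) ⟩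
    ℚ.∣ s m n ∣ ℚ.+ ℚ.∣ t m n ∣    <⟨ ℚₚ.+-mono-<
      (p m n (ℕₚ.m⊔n≤o⇒m≤o N N′ N≤m) (ℕₚ.m⊔n≤o⇒m≤o N N′ N≤n))
      (p′ m n (ℕₚ.m⊔n≤o⇒n≤o N N′ N≤m) (ℕₚ.m⊔n≤o⇒n≤o N N′ N≤n)) ⟩
    ½ ℚ.* ε ℚ.+ ½ ℚ.* ε            ≡⟨ halves ε ⟩
    ε                              ∎
    where open ℚₚ.≤-Reasoning

  small-neg : ∀ {s} → Small s → Small (λ m n → ℚ.- s m n)
  small-neg {s} S ε 0<ε with S ε 0<ε
  ... | N , p = N , λ m n N≤m N≤n →
    ≡.subst (ℚ._< ε) (≡.sym (ℚₚ.∣-p∣≡∣p∣ (s m n))) (p m n N≤m N≤n)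

  small-swap : ∀ {s} → Small s → Small (λ m n → s n m)
  small-swap S ε 0<ε with S ε 0<ε
  ... | N , p = N , λ m n N≤m N≤n → p n m N≤n N≤m

  small-diag : ∀ {s} → Small s → Small (λ m _ → s m m)
  small-diag S ε 0<ε with S ε 0<ε
  ... | N , p = N , λ m n N≤m N≤n → p m m N≤m N≤m

  small-* : ∀ {s t} → Bounded s → Small t → Small (λ m n → s m n ℚ.* t m n)
  small-* {s} {t} (B , 0<B , M , b) T ε 0<ε = go
    where
    instance
      B-pos : ℚ.Positive B
      B-pos = ℚ.positive 0<B
      B-nonZero : ℚ.NonZero B
      B-nonZero = ℚₚ.pos⇒nonZero B
      1/B-pos : ℚ.Positive (ℚ.1/ B)
      1/B-pos = ℚₚ.1/pos⇒pos B
      B-nonNeg : ℚ.NonNegative B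
      B-nonNeg = ℚₚ.pos⇒nonNeg B

    δ : ℚ
    δ = ℚ.1/ B ℚ.* ε

    0<δ : 0ℚ ℚ.< δ
    0<δ = ≡.subst (ℚ._< δ) (ℚₚ.*-zeroʳ (ℚ.1/ B)) (ℚₚ.*-monoʳ-<-pos (ℚ.1/ B) 0<ε)

    Bδ≡ε : B ℚ.* δ ≡ ε
    Bδ≡ε = ≡.trans (≡.sym (ℚₚ.*-assoc B (ℚ.1/ B) ε))
      (≡.trans (≡.cong (ℚ._* ε) (ℚₚ.*-inverseʳ B)) (ℚₚ.*-identityˡ ε))

    open ℚₚ.≤-Reasoning

    go : ∃ λ N → ∀ m n → N ℕ.≤ m → N ℕ.≤ n → ℚ.∣ s m n ℚ.* t m n ∣ ℚ.< ε
    go with T δ 0<δ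
    ... | N , p = M ℕ.⊔ N , λ m n N≤m N≤n → begin-strict
      ℚ.∣ s m n ℚ.* t m n ∣        ≡⟨ ℚₚ.∣p*q∣≡∣p∣*∣q∣ (s m n) (t m n) ⟩
      ℚ.∣ s m n ∣ ℚ.* ℚ.∣ t m n ∣  ≤⟨ ℚₚ.*-monoʳ-≤-nonNeg ℚ.∣ t m n ∣
        {{ℚₚ.∣-∣-nonNeg (t m n)}}
        (b m n (ℕₚ.m⊔n≤o⇒m≤o M N N≤m) (ℕₚ.m⊔n≤o⇒m≤o M N N≤n)) ⟩
      B ℚ.* ℚ.∣ t m n ∣            <⟨ ℚₚ.*-monoʳ-<-pos B
        (p m n (ℕₚ.m⊔n≤o⇒n≤o M N N≤m) (ℕₚ.m⊔n≤o⇒n≤o M N N≤n)) ⟩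
      B ℚ.* δ                      ≡⟨ Bδ≡ε ⟩
      ε                            ∎

  0<1 : 0ℚ ℚ.< 1ℚ
  0<1 = ℚₚ.positive⁻¹ 1ℚ

  cauchy⇒bounded : ∀ x → x ∼ x → Bounded (λ m _ → x m)
  cauchy⇒bounded x X with X 1ℚ 0<1
  ... | N , p = 1ℚ ℚ.+ ℚ.∣ x N ∣
    , ≡.subst (ℚ._< 1ℚ ℚ.+ ℚ.∣ x N ∣) (ℚₚ.+-identityˡ 0ℚ)
        (ℚₚ.+-mono-<-≤ 0<1 (ℚₚ.0≤∣p∣ (x N)))
    , N , λ m _ N≤m _ → begin
      ℚ.∣ x m ∣                          ≡⟨ ≡.cong ℚ.∣_∣ (split (x m) (x N)) ⟩
      ℚ.∣ (x m ℚ.- x N) ℚ.+ x N ∣        ≤⟨ ℚₚ.∣p+q∣≤∣p∣+∣q∣ (x m ℚ.- x N) (x N) ⟩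
      ℚ.∣ x m ℚ.- x N ∣ ℚ.+ ℚ.∣ x N ∣    ≤⟨ ℚₚ.+-monoˡ-≤ ℚ.∣ x N ∣
                                              (ℚₚ.<⇒≤ (p m N N≤m ℕₚ.≤-refl)) ⟩
      1ℚ ℚ.+ ℚ.∣ x N ∣                   ∎
    where
    open ℚₚ.≤-Reasoning
    split : ∀ a b → a ≡ (a ℚ.- b) ℚ.+ b
    split = solve 2 (λ a b → a := (a :- b) :+ b) ≡.refl
      where open ℚSolver.+-*-Solver

  bounded-swap : ∀ {s} → Bounded s → Bounded (λ m n → s n m)
  bounded-swap (B , 0<B , N , b) = B , 0<B , N , λ m n N≤m N≤n → b n m N≤n N≤m

  ∼-sym : ∀ x y → x ∼ y → y ∼ x
  ∼-sym x y p = small-cong (λ m n → lemma (x n) (y m)) (small-neg (small-swap p))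
    where
    lemma : ∀ a b → ℚ.- (a ℚ.- b) ≡ b ℚ.- a
    lemma = solve 2 (λ a b → :- (a :- b) := b :- a) ≡.refl
      where open ℚSolver.+-*-Solver

  ∼-trans : ∀ x y z → x ∼ y → y ∼ z → x ∼ z
  ∼-trans x y z p q =
    small-cong (λ m n → lemma (x m) (y m) (z n)) (small-+ (small-diag p) q)
    where
    lemma : ∀ a b c → (a ℚ.- b) ℚ.+ (b ℚ.- c) ≡ a ℚ.- c
    lemma = solve 3 (λ a b c → (a :- b) :+ (b :- c) := a :- c) ≡.refl
      where open ℚSolver.+-*-Solver

  ∼-+ : ∀ x x′ y y′ → x ∼ x′ → y ∼ y′ →
        (λ n → x n ℚ.+ y n) ∼ (λ n → x′ n ℚ.+ y′ n)
  ∼-+ x x′ y y′ p q =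
    small-cong (λ m n → lemma (x m) (x′ n) (y m) (y′ n)) (small-+ p q)
    where
    lemma : ∀ a a′ b b′ → (a ℚ.- a′) ℚ.+ (b ℚ.- b′) ≡ (a ℚ.+ b) ℚ.- (a′ ℚ.+ b′)
    lemma = solve 4 (λ a a′ b b′ →
      (a :- a′) :+ (b :- b′) := (a :+ b) :- (a′ :+ b′)) ≡.refl
      where open ℚSolver.+-*-Solver

  ∼-neg : ∀ x x′ → x ∼ x′ → (λ n → ℚ.- x n) ∼ (λ n → ℚ.- x′ n)
  ∼-neg x x′ p =
    small-cong (λ m n → lemma (x m) (x′ n)) (small-neg p)
    where
    lemma : ∀ a b → ℚ.- (a ℚ.- b) ≡ ℚ.- a ℚ.- ℚ.- b
    lemma = solve 2 (λ a b → :- (a :- b) := :- a :- :- b) ≡.refl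
      where open ℚSolver.+-*-Solver

  ∼-* : ∀ x x′ y y′ → x ∼ x → y′ ∼ y′ → x ∼ x′ → y ∼ y′ →
        (λ n → x n ℚ.* y n) ∼ (λ n → x′ n ℚ.* y′ n)
  ∼-* x x′ y y′ X Y′ p q =
    small-cong (λ m n → lemma (x m) (x′ n) (y m) (y′ n))
      (small-+ (small-* (cauchy⇒bounded x X) q)
               (small-* (bounded-swap (cauchy⇒bounded y′ Y′)) p))
    where
    lemma : ∀ a a′ b b′ →
      a ℚ.* (b ℚ.- b′) ℚ.+ b′ ℚ.* (a ℚ.- a′) ≡ a ℚ.* b ℚ.- a′ ℚ.* b′
    lemma = solve 4 (λ a a′ b b′ →
      a :* (b :- b′) :+ b′ :* (a :- a′) := a :* b :- a′ :* b′) ≡.refl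
      where open ℚSolver.+-*-Solver

  ∼-const : ∀ q → (λ _ → q) ∼ (λ _ → q)
  ∼-const q ε 0<ε = 0 , λ _ _ _ _ →
    ≡.subst (λ r → ℚ.∣ r ∣ ℚ.< ε) (≡.sym (ℚₚ.+-inverseʳ q)) 0<ε

infixl 6 _+ℝ_
infixl 7 _*ℝ_
infix  8 -ℝ_

_+ℝ_ : ℝ → ℝ → ℝ
x +ℝ y = mkℝ (λ n → seq x n ℚ.+ seq y n) (∼-+ (seq x) (seq x) (seq y) (seq y) (cauchy x) (cauchy y))

_*ℝ_ : ℝ → ℝ → ℝ
x *ℝ y = mkℝ (λ n → seq x n ℚ.* seq y n)
             (∼-* (seq x) (seq x) (seq y) (seq y) (cauchy x) (cauchy y) (cauchy x) (cauchy y))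

-ℝ_ : ℝ → ℝ
-ℝ x = mkℝ (λ n → ℚ.- seq x n) (∼-neg (seq x) (seq x) (cauchy x))

ι : ℚ → ℝ
ι q = mkℝ (λ _ → q) (∼-const q)

pointwise : ∀ {x y} → (∀ n → seq x n ≡ seq y n) → x ≈ℝ y
pointwise {x} p = mk≈ℝ
  (small-cong (λ m n → ≡.cong (λ q → seq x m ℚ.- q) (p n)) (cauchy x))

≈ℝ-refl : ∀ {x} → x ≈ℝ x
≈ℝ-refl {x} = mk≈ℝ (cauchy x)

≈ℝ-sym : ∀ {x y} → x ≈ℝ y → y ≈ℝ x
≈ℝ-sym {x} {y} p = mk≈ℝ (∼-sym (seq x) (seq y) (close p))

≈ℝ-trans : ∀ {x y z} → x ≈ℝ y → y ≈ℝ z → x ≈ℝ z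
≈ℝ-trans {x} {y} {z} p q =
  mk≈ℝ (∼-trans (seq x) (seq y) (seq z) (close p) (close q))

+ℝ-cong : ∀ {x x′ y y′} → x ≈ℝ x′ → y ≈ℝ y′ → x +ℝ y ≈ℝ x′ +ℝ y′
+ℝ-cong {x} {x′} {y} {y′} p q =
  mk≈ℝ (∼-+ (seq x) (seq x′) (seq y) (seq y′) (close p) (close q))

-ℝ-cong : ∀ {x x′} → x ≈ℝ x′ → -ℝ x ≈ℝ -ℝ x′
-ℝ-cong {x} {x′} p = mk≈ℝ (∼-neg (seq x) (seq x′) (close p))

*ℝ-cong : ∀ {x x′ y y′} → x ≈ℝ x′ → y ≈ℝ y′ → x *ℝ y ≈ℝ x′ *ℝ y′
*ℝ-cong {x} {x′} {y} {y′} p q = mk≈ℝ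
  (∼-* (seq x) (seq x′) (seq y) (seq y′) (cauchy x) (cauchy y′) (close p) (close q))

+ℝ-assoc : ∀ x y z → (x +ℝ y) +ℝ z ≈ℝ x +ℝ (y +ℝ z)
+ℝ-assoc x y z = pointwise λ n → ℚₚ.+-assoc (seq x n) (seq y n) (seq z n)

+ℝ-comm : ∀ x y → x +ℝ y ≈ℝ y +ℝ x
+ℝ-comm x y = pointwise λ n → ℚₚ.+-comm (seq x n) (seq y n)

+ℝ-identityˡ : ∀ x → ι 0ℚ +ℝ x ≈ℝ x
+ℝ-identityˡ x = pointwise λ n → ℚₚ.+-identityˡ (seq x n)

+ℝ-identityʳ : ∀ x → x +ℝ ι 0ℚ ≈ℝ x
+ℝ-identityʳ x = pointwise λ n → ℚₚ.+-identityʳ (seq x n)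

-ℝ-inverseˡ : ∀ x → -ℝ x +ℝ x ≈ℝ ι 0ℚ
-ℝ-inverseˡ x = pointwise λ n → ℚₚ.+-inverseˡ (seq x n)

-ℝ-inverseʳ : ∀ x → x +ℝ -ℝ x ≈ℝ ι 0ℚ
-ℝ-inverseʳ x = pointwise λ n → ℚₚ.+-inverseʳ (seq x n)

*ℝ-assoc : ∀ x y z → (x *ℝ y) *ℝ z ≈ℝ x *ℝ (y *ℝ z)
*ℝ-assoc x y z = pointwise λ n → ℚₚ.*-assoc (seq x n) (seq y n) (seq z n)

*ℝ-comm : ∀ x y → x *ℝ y ≈ℝ y *ℝ x
*ℝ-comm x y = pointwise λ n → ℚₚ.*-comm (seq x n) (seq y n)

*ℝ-identityˡ : ∀ x → ι 1ℚ *ℝ x ≈ℝ x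
*ℝ-identityˡ x = pointwise λ n → ℚₚ.*-identityˡ (seq x n)

*ℝ-identityʳ : ∀ x → x *ℝ ι 1ℚ ≈ℝ x
*ℝ-identityʳ x = pointwise λ n → ℚₚ.*-identityʳ (seq x n)

*ℝ-distribˡ : ∀ x y z → x *ℝ (y +ℝ z) ≈ℝ x *ℝ y +ℝ x *ℝ z
*ℝ-distribˡ x y z = pointwise λ n → ℚₚ.*-distribˡ-+ (seq x n) (seq y n) (seq z n)

*ℝ-distribʳ : ∀ x y z → (y +ℝ z) *ℝ x ≈ℝ y *ℝ x +ℝ z *ℝ x
*ℝ-distribʳ x y z = pointwise λ n → ℚₚ.*-distribʳ-+ (seq x n) (seq y n) (seq z n)

ℝ-commutativeRing : CommutativeRing 0ℓ 0ℓ
ℝ-commutativeRing = record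
  { Carrier = ℝ
  ; _≈_     = _≈ℝ_
  ; _+_     = _+ℝ_
  ; _*_     = _*ℝ_
  ; -_      = -ℝ_
  ; 0#      = ι 0ℚ
  ; 1#      = ι 1ℚ
  ; isCommutativeRing = record
    { isRing = record
      { +-isAbelianGroup = record
        { isGroup = record
          { isMonoid = record
            { isSemigroup = record
              { isMagma = record
                { isEquivalence = record
                  { refl = ≈ℝ-refl ; sym = ≈ℝ-sym ; trans = ≈ℝ-trans }
                ; ∙-cong = +ℝ-cong
                }
              ; assoc = +ℝ-assoc
              }
            ; identity = +ℝ-identityˡ , +ℝ-identityʳ
            }
          ; inverse = -ℝ-inverseˡ , -ℝ-inverseʳ
          ; ⁻¹-cong = -ℝ-cong
          }
        ; comm = +ℝ-comm
        }
      ; *-cong     = *ℝ-cong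
      ; *-assoc    = *ℝ-assoc
      ; *-identity = *ℝ-identityˡ , *ℝ-identityʳ
      ; distrib    = *ℝ-distribˡ , *ℝ-distribʳ
      }
    ; *-comm = *ℝ-comm
    }
  }

-- Adjoining a square root of -1 to a commutative ring.
module Complexification {c ℓ} (R : CommutativeRing c ℓ) where

  open CommutativeRing R
  open NaturalCoefficientsSolver commutativeSemiring using (solve; _:=_; _:+_; _:*_)
  open RingProperties ring using (-1*x≈-x; -0#≈0#)
  open SetoidReasoning setoid

  infix 6 _+i_

  record Complex : Set c where
    constructor _+i_
    field
      re im : Carrier

  open Complex public

  infix 4 _≈ᶜ_

  record _≈ᶜ_ (z w : Complex) : Set ℓ where
    constructor mk≈ᶜ
    field
      re≈ : re z ≈ re w
      im≈ : im z ≈ im w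

  open _≈ᶜ_ public

  infixl 6 _+ᶜ_
  infixl 7 _*ᶜ_

  _+ᶜ_ _*ᶜ_ : Complex → Complex → Complex
  (a +i b) +ᶜ (c +i d) = (a + c) +i (b + d)
  (a +i b) *ᶜ (c +i d) = (a * c - b * d) +i (a * d + b * c)

  -ᶜ_ : Complex → Complex
  -ᶜ (a +i b) = (- a) +i (- b)

  private
    neg : ∀ x → - x ≈ - 1# * x
    neg x = sym (-1*x≈-x x)

    assoc-re : ∀ a b c d e f →
      (a * c - b * d) * e - (a * d + b * c) * f ≈
      a * (c * e - d * f) - b * (c * f + d * e)
    assoc-re a b c d e f = begin
      (a * c - b * d) * e - (a * d + b * c) * f
        ≈⟨ +-cong (*-congʳ (+-congˡ (neg _))) (neg _) ⟩
      (a * c + - 1# * (b * d)) * e + - 1# * ((a * d + b * c) * f)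
        ≈⟨ solve 7 (λ n a b c d e f →
             (a :* c :+ n :* (b :* d)) :* e :+ n :* ((a :* d :+ b :* c) :* f) :=
             a :* (c :* e :+ n :* (d :* f)) :+ n :* (b :* (c :* f :+ d :* e)))
           refl (- 1#) a b c d e f ⟩
      a * (c * e + - 1# * (d * f)) + - 1# * (b * (c * f + d * e))
        ≈⟨ +-cong (*-congˡ (+-congˡ (neg _))) (neg _) ⟨
      a * (c * e - d * f) - b * (c * f + d * e) ∎

    assoc-im : ∀ a b c d e f →
      (a * c - b * d) * f + (a * d + b * c) * e ≈
      a * (c * f + d * e) + b * (c * e - d * f)
    assoc-im a b c d e f = begin
      (a * c - b * d) * f + (a * d + b * c) * e
        ≈⟨ +-congʳ (*-congʳ (+-congˡ (neg _))) ⟩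
      (a * c + - 1# * (b * d)) * f + (a * d + b * c) * e
        ≈⟨ solve 7 (λ n a b c d e f →
             (a :* c :+ n :* (b :* d)) :* f :+ (a :* d :+ b :* c) :* e :=
             a :* (c :* f :+ d :* e) :+ b :* (c :* e :+ n :* (d :* f)))
           refl (- 1#) a b c d e f ⟩
      a * (c * f + d * e) + b * (c * e + - 1# * (d * f))
        ≈⟨ +-congˡ (*-congˡ (+-congˡ (neg _))) ⟨
      a * (c * f + d * e) + b * (c * e - d * f) ∎

    distrib-re : ∀ a b c d e f →
      (c + e) * a - (d + f) * b ≈ (c * a - d * b) + (e * a - f * b)
    distrib-re a b c d e f = begin
      (c + e) * a - (d + f) * b
        ≈⟨ +-congˡ (neg _) ⟩
      (c + e) * a + - 1# * ((d + f) * b)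
        ≈⟨ solve 7 (λ n a b c d e f →
             (c :+ e) :* a :+ n :* ((d :+ f) :* b) :=
             (c :* a :+ n :* (d :* b)) :+ (e :* a :+ n :* (f :* b)))
           refl (- 1#) a b c d e f ⟩
      (c * a + - 1# * (d * b)) + (e * a + - 1# * (f * b))
        ≈⟨ +-cong (+-congˡ (neg _)) (+-congˡ (neg _)) ⟨
      (c * a - d * b) + (e * a - f * b) ∎

    distrib-im : ∀ a b c d e f →
      (c + e) * b + (d + f) * a ≈ (c * b + d * a) + (e * b + f * a)
    distrib-im = solve 6 (λ a b c d e f →
      (c :+ e) :* b :+ (d :+ f) :* a :=
      (c :* b :+ d :* a) :+ (e :* b :+ f :* a)) refl

    x-0y≈x : ∀ x y → 1# * x - 0# * y ≈ x
    x-0y≈x x y = begin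
      1# * x - 0# * y  ≈⟨ +-cong (*-identityˡ x) (trans (-‿cong (zeroˡ y)) -0#≈0#) ⟩
      x + 0#           ≈⟨ +-identityʳ x ⟩
      x                ∎

    x+0y≈x : ∀ x y → 1# * x + 0# * y ≈ x
    x+0y≈x x y = begin
      1# * x + 0# * y  ≈⟨ +-cong (*-identityˡ x) (zeroˡ y) ⟩
      x + 0#           ≈⟨ +-identityʳ x ⟩
      x                ∎

    ≈ᶜ-trans : ∀ {x y z} → x ≈ᶜ y → y ≈ᶜ z → x ≈ᶜ z
    ≈ᶜ-trans p q = mk≈ᶜ (trans (re≈ p) (re≈ q)) (trans (im≈ p) (im≈ q))

    +ᶜ-cong : ∀ {x x′ y y′} → x ≈ᶜ x′ → y ≈ᶜ y′ → x +ᶜ y ≈ᶜ x′ +ᶜ y′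
    +ᶜ-cong p q = mk≈ᶜ (+-cong (re≈ p) (re≈ q)) (+-cong (im≈ p) (im≈ q))

    *ᶜ-comm : ∀ z w → z *ᶜ w ≈ᶜ w *ᶜ z
    *ᶜ-comm (a +i b) (c +i d) = mk≈ᶜ
      (+-cong (*-comm a c) (-‿cong (*-comm b d)))
      (trans (+-cong (*-comm a d) (*-comm b c)) (+-comm (d * a) (c * b)))

    *ᶜ-identityˡ : ∀ z → (1# +i 0#) *ᶜ z ≈ᶜ z
    *ᶜ-identityˡ (a +i b) = mk≈ᶜ (x-0y≈x a b) (x+0y≈x b a)

    *ᶜ-distribʳ : ∀ x y z → (y +ᶜ z) *ᶜ x ≈ᶜ y *ᶜ x +ᶜ z *ᶜ x
    *ᶜ-distribʳ (a +i b) (c +i d) (e +i f) =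
      mk≈ᶜ (distrib-re a b c d e f) (distrib-im a b c d e f)

  commutativeRing : CommutativeRing c ℓ
  commutativeRing = record
    { Carrier = Complex
    ; _≈_     = _≈ᶜ_
    ; _+_     = _+ᶜ_
    ; _*_     = _*ᶜ_
    ; -_      = -ᶜ_
    ; 0#      = 0# +i 0#
    ; 1#      = 1# +i 0#
    ; isCommutativeRing = record
      { isRing = record
        { +-isAbelianGroup = record
          { isGroup = record
            { isMonoid = record
              { isSemigroup = record
                { isMagma = record
                  { isEquivalence = record
                    { refl  = mk≈ᶜ refl refl
                    ; sym   = λ p → mk≈ᶜ (sym (re≈ p)) (sym (im≈ p))
                    ; trans = ≈ᶜ-trans
                    }
                  ; ∙-cong = +ᶜ-cong
                  }
                ; assoc = λ x y z → mk≈ᶜ (+-assoc (re x) (re y) (re z))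
                                         (+-assoc (im x) (im y) (im z))
                }
              ; identity = (λ z → mk≈ᶜ (+-identityˡ (re z)) (+-identityˡ (im z)))
                         , (λ z → mk≈ᶜ (+-identityʳ (re z)) (+-identityʳ (im z)))
              }
            ; inverse = (λ z → mk≈ᶜ (-‿inverseˡ (re z)) (-‿inverseˡ (im z)))
                      , (λ z → mk≈ᶜ (-‿inverseʳ (re z)) (-‿inverseʳ (im z)))
            ; ⁻¹-cong = λ p → mk≈ᶜ (-‿cong (re≈ p)) (-‿cong (im≈ p))
            }
          ; comm = λ z w → mk≈ᶜ (+-comm (re z) (re w)) (+-comm (im z) (im w))
          }
        ; *-cong     = λ p q → mk≈ᶜ
            (+-cong (*-cong (re≈ p) (re≈ q)) (-‿cong (*-cong (im≈ p) (im≈ q))))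
            (+-cong (*-cong (re≈ p) (im≈ q)) (*-cong (im≈ p) (re≈ q)))
        ; *-assoc    = λ x y z → mk≈ᶜ
            (assoc-re (re x) (im x) (re y) (im y) (re z) (im z))
            (assoc-im (re x) (im x) (re y) (im y) (re z) (im z))
        ; *-identity = *ᶜ-identityˡ
                     , λ z → ≈ᶜ-trans (*ᶜ-comm z (1# +i 0#)) (*ᶜ-identityˡ z)
        ; distrib    = (λ x y z → ≈ᶜ-trans (*ᶜ-comm x (y +ᶜ z))
                         (≈ᶜ-trans (*ᶜ-distribʳ x y z)
                           (+ᶜ-cong (*ᶜ-comm y x) (*ᶜ-comm z x))))
                     , *ᶜ-distribʳ
        }
      ; *-comm = *ᶜ-comm
      }
    }

ℂ-commutativeRing : CommutativeRing 0ℓ 0ℓ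
ℂ-commutativeRing = Complexification.commutativeRing ℝ-commutativeRing

module Determinant {c ℓ} (R : RawRing c ℓ) where

  open RawRing R
  open RawMonoidDefinitions +-rawMonoid using (sum)

  sign : ℕ → Carrier → Carrier
  sign zero    x = x
  sign (suc k) x = - sign k x

  det : ∀ {n} → (Fin n → Fin n → Carrier) → Carrier
  det {zero}  A = 1#
  det {suc n} A = sum λ j →
    sign (toℕ j) (A zero j * det λ i k → A (suc i) (punchIn j k))

module LinearAlgebra {c ℓ} (K : CommutativeRing c ℓ) where

  open CommutativeRing K

  module _ {m ℓm} (M : LeftModule ring m ℓm) where

    open LeftModule M
    open RawMonoidDefinitions (LeftModule.+ᴹ-rawMonoid M) using (sum)

    linearCombination : ∀ {n} → (Fin n → Carrier) → (Fin n → Carrierᴹ) → Carrierᴹ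
    linearCombination a x = sum λ i → a i *ₗ x i

    LinearlyIndependent : ∀ {n} → (Fin n → Carrierᴹ) → Set (c ⊔ ℓ ⊔ ℓm)
    LinearlyIndependent x =
      ∀ a → linearCombination a x ≈ᴹ 0ᴹ → ∀ i → a i ≈ 0#

  module _ {m ℓm n ℓn} (M : LeftModule ring m ℓm) (N : LeftModule ring n ℓn) where

    private
      module M = LeftModule M
      module N = LeftModule N

    IsLinear : (M.Carrierᴹ → N.Carrierᴹ) → Set (c ⊔ m ⊔ ℓm ⊔ ℓn)
    IsLinear = LeftModuleMorphisms.IsLeftModuleHomomorphism M.rawLeftModule N.rawLeftModule

    -- Meant for linear f over a field: the rank is the dimension of the
    -- image, so f has rank r when its image has a basis f x₁ , … , f xᵣ.
    -- A relation rather than a function, since over ℂ the rank of an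
    -- arbitrary linear map is not computable.
    record HasRank (f : M.Carrierᴹ → N.Carrierᴹ) (r : ℕ) : Set (c ⊔ ℓ ⊔ m ⊔ ℓn) where
      field
        x           : Fin r → M.Carrierᴹ
        independent : LinearlyIndependent N (f ∘ x)
        spanning    : ∀ y → ∃ λ a → f y N.≈ᴹ linearCombination N a (f ∘ x)

module Polynomials {c ℓ} (K : CommutativeRing c ℓ) where

  open CommutativeRing K hiding (zero)
  open RawMonoidDefinitions +-rawMonoid using (sum) renaming (_×_ to _·_)
  open AbelianGroupProperties +-abelianGroup using (ε⁻¹≈ε; ⁻¹-∙-comm)
  open RingProperties ring using (-‿distribˡ-*)
  open CommutativeSemigroupProperties +-commutativeSemigroup using (interchange)
  open CommutativeSemigroupProperties ℕₚ.+-commutativeSemigroup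
    using () renaming (interchange to ℕ-interchange)

  -- A family of coefficients, indexed by exponent vectors.  No finiteness
  -- is imposed, so this is the formal power series ring; the homogeneous
  -- elements singled out below have finite support automatically, so they
  -- are exactly the homogeneous polynomials.
  Series : ℕ → Set c
  Series m = Vec ℕ m → Carrier

  infix 4 _≋_

  _≋_ : ∀ {m} → Series m → Series m → Set ℓ
  f ≋ g = ∀ α → f α ≈ g α

  infixl 7 _⊛_

  -- The Cauchy product, one variable at a time.
  _⊛_ : ∀ {m} → Series m → Series m → Series m
  (f ⊛ g) []      = f [] * g []
  (f ⊛ g) (n ∷ α) = sum {suc n} λ k →
    ((λ β → f (toℕ k ∷ β)) ⊛ (λ β → g (n ∸ toℕ k ∷ β))) α

  monomial : ∀ {m} → Vec ℕ m → Series m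
  monomial β α = if does (Vecₚ.≡-dec ℕₚ._≟_ α β) then 1# else 0#

  series-rawRing : ℕ → RawRing c ℓ
  series-rawRing m = record
    { Carrier = Series m
    ; _≈_     = _≋_
    ; _+_     = λ f g α → f α + g α
    ; _*_     = _⊛_
    ; -_      = λ f α → - f α
    ; 0#      = λ _ → 0#
    ; 1#      = monomial (Vec.replicate m 0)
    }

  var : ∀ {m} → Fin m → Series m
  var {m} i = monomial (updateAt (Vec.replicate m 0) i suc)

  ∂ : ∀ {m} → Fin m → Series m → Series m
  ∂ i f α = suc (lookup α i) · f (updateAt α i suc)

  ∂^ : ∀ {m} → Vec ℕ m → Series m → Series m
  ∂^ α g = Vector.foldr (λ i h → fold h (∂ i) (lookup α i)) g (λ i → i)

  Homogeneous : ∀ {m} → ℕ → Series m → Set ℓ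
  Homogeneous j f = ∀ α → Vec.sum α ≢ j → f α ≈ 0#

  record 𝒮-Carrier (m j : ℕ) : Set (c ⊔ ℓ) where
    constructor mk𝒮
    field
      coeff       : Series m
      homogeneous : Homogeneous j coeff

  open 𝒮-Carrier public

  +≈0 : ∀ {x y} → x ≈ 0# → y ≈ 0# → x + y ≈ 0#
  +≈0 p q = trans (+-cong p q) (+-identityˡ 0#)

  neg≈0 : ∀ {x} → x ≈ 0# → - x ≈ 0#
  neg≈0 p = trans (-‿cong p) ε⁻¹≈ε

  ·≈0 : ∀ n {x} → x ≈ 0# → n · x ≈ 0#
  ·≈0 zero    p = refl
  ·≈0 (suc n) p = +≈0 p (·≈0 n p)

  sum≈0 : ∀ {n} (t : Fin n → Carrier) → (∀ i → t i ≈ 0#) → sum t ≈ 0#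
  sum≈0 {zero}  t p = refl
  sum≈0 {suc n} t p = +≈0 (p zero) (sum≈0 (t ∘ suc) (p ∘ suc))

  𝒮 : ℕ → ℕ → LeftModule ring (c ⊔ ℓ) ℓ
  𝒮 m j = record
    { Carrierᴹ = 𝒮-Carrier m j
    ; _≈ᴹ_     = λ f g → coeff f ≋ coeff g
    ; _+ᴹ_     = λ f g → mk𝒮 (λ α → coeff f α + coeff g α)
                   (λ α p → +≈0 (homogeneous f α p) (homogeneous g α p))
    ; _*ₗ_     = λ a f → mk𝒮 (λ α → a * coeff f α)
                   (λ α p → trans (*-congˡ (homogeneous f α p)) (zeroʳ a))
    ; 0ᴹ       = mk𝒮 (λ _ → 0#) (λ _ _ → refl)
    ; -ᴹ_      = λ f → mk𝒮 (λ α → - coeff f α) (λ α p → neg≈0 (homogeneous f α p))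
    ; isLeftModule = record
      { isLeftSemimodule = record
        { +ᴹ-isCommutativeMonoid = record
          { isMonoid = record
            { isSemigroup = record
              { isMagma = record
                { isEquivalence = record
                  { refl  = λ _ → refl
                  ; sym   = λ p α → sym (p α)
                  ; trans = λ p q α → trans (p α) (q α)
                  }
                ; ∙-cong = λ p q α → +-cong (p α) (q α)
                }
              ; assoc = λ f g h α → +-assoc (coeff f α) (coeff g α) (coeff h α)
              }
            ; identity = (λ f α → +-identityˡ (coeff f α))
                       , (λ f α → +-identityʳ (coeff f α))
            }
          ; comm = λ f g α → +-comm (coeff f α) (coeff g α)
          }
        ; isPreleftSemimodule = record
          { *ₗ-cong      = λ p q α → *-cong p (q α)
          ; *ₗ-zeroˡ     = λ f α → zeroˡ (coeff f α)
          ; *ₗ-distribʳ  = λ f a b α → distribʳ (coeff f α) a b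
          ; *ₗ-identityˡ = λ f α → *-identityˡ (coeff f α)
          ; *ₗ-assoc     = λ a b f α → *-assoc a b (coeff f α)
          ; *ₗ-zeroʳ     = λ a α → zeroʳ a
          ; *ₗ-distribˡ  = λ a f g α → distribˡ a (coeff f α) (coeff g α)
          }
        }
      ; -ᴹ‿cong    = λ p α → -‿cong (p α)
      ; -ᴹ‿inverse = (λ f α → -‿inverseˡ (coeff f α))
                   , (λ f α → -‿inverseʳ (coeff f α))
      }
    }

  exponents : ∀ m → ℕ → List (Vec ℕ m)
  exponents zero    zero    = [] ∷ []
  exponents zero    (suc _) = []
  exponents (suc m) j       =
    concatMap (λ k → List.map (toℕ k ∷_) (exponents m (j ∸ toℕ k))) (allFin (suc j))

  infixr 8 _⟨∂⟩_

  -- f(∂x) g, the sum over the monomials of f running over those of degree u.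
  _⟨∂⟩_ : ∀ {m u} → 𝒮-Carrier m u → Series m → Series m
  _⟨∂⟩_ {m} {u} f g β =
    List.foldr (λ α acc → coeff f α * ∂^ α g β + acc) 0# (exponents m u)

  sum-updateAt : ∀ {m} (α : Vec ℕ m) i → Vec.sum (updateAt α i suc) ≡ suc (Vec.sum α)
  sum-updateAt (n ∷ α) zero    = ≡.refl
  sum-updateAt (n ∷ α) (suc i) =
    ≡.trans (≡.cong (n ℕ.+_) (sum-updateAt α i)) (ℕₚ.+-suc n (Vec.sum α))

  sum-replicate-0 : ∀ m → Vec.sum (Vec.replicate m 0) ≡ 0
  sum-replicate-0 zero    = ≡.refl
  sum-replicate-0 (suc m) = sum-replicate-0 m

  exponents-sum : ∀ m j → All (λ α → Vec.sum α ≡ j) (exponents m j)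
  exponents-sum zero    zero    = ≡.refl ∷ []
  exponents-sum zero    (suc j) = []
  exponents-sum (suc m) j       =
    Allₚ.concat⁺ (Allₚ.map⁺ (All.universal (λ k → Allₚ.map⁺ (All.map
      (λ p → ≡.trans (≡.cong (toℕ k ℕ.+_) p) (ℕₚ.m+[n∸m]≡n (toℕ≤pred[n] k)))
      (exponents-sum m (j ∸ toℕ k)))) (allFin (suc j))))

  ∂-homogeneous : ∀ {m j} i {f : Series m} →
                  Homogeneous (suc j) f → Homogeneous j (∂ i f)
  ∂-homogeneous i hom α p = ·≈0 (suc (lookup α i))
    (hom (updateAt α i suc) (λ q →
      p (ℕₚ.suc-injective (≡.trans (≡.sym (sum-updateAt α i)) q))))

  fold-homogeneous : ∀ {m j} i {f : Series m} k →
                     Homogeneous (k ℕ.+ j) f → Homogeneous j (fold f (∂ i) k)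
  fold-homogeneous         i zero    hom = hom
  fold-homogeneous {j = j} i {f} (suc k) hom =
    ∂-homogeneous i (fold-homogeneous i k
      (≡.subst (λ n → Homogeneous n f) (≡.sym (ℕₚ.+-suc k j)) hom))

  total : ∀ {n} → (Fin n → ℕ) → ℕ
  total = Vector.foldr ℕ._+_ 0

  total-lookup : ∀ {m} (α : Vec ℕ m) → total (lookup α) ≡ Vec.sum α
  total-lookup []      = ≡.refl
  total-lookup (n ∷ α) = ≡.cong (n ℕ.+_) (total-lookup α)

  foldr-homogeneous : ∀ {m n j} (a : Fin m → ℕ) (is : Fin n → Fin m) {g : Series m} →
    Homogeneous (total (a ∘ is) ℕ.+ j) g →
    Homogeneous j (Vector.foldr (λ i h → fold h (∂ i) (a i)) g is)
  foldr-homogeneous {n = zero}          a is hom = hom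
  foldr-homogeneous {n = suc n} {j = j} a is {g} hom =
    fold-homogeneous (is zero) (a (is zero))
      (foldr-homogeneous a (is ∘ suc)
        (≡.subst (λ k → Homogeneous k g) shuffle hom))
    where
    rest : ℕ
    rest = total (a ∘ is ∘ suc)
    shuffle : (a (is zero) ℕ.+ rest) ℕ.+ j ≡ rest ℕ.+ (a (is zero) ℕ.+ j)
    shuffle = ≡.trans (≡.cong (ℕ._+ j) (ℕₚ.+-comm (a (is zero)) rest))
                      (ℕₚ.+-assoc rest (a (is zero)) j)

  ∂^-homogeneous : ∀ {m v} α {g : Series m} →
                   Homogeneous (Vec.sum α ℕ.+ v) g → Homogeneous v (∂^ α g)
  ∂^-homogeneous {v = v} α {g} hom = foldr-homogeneous (lookup α) (λ i → i)
    (≡.subst (λ n → Homogeneous (n ℕ.+ v) g) (≡.sym (total-lookup α)) hom)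

  ⟨∂⟩-homogeneous : ∀ {m u v d} → u ℕ.+ v ≡ d → (f : 𝒮-Carrier m u) (g : 𝒮-Carrier m d) →
                    Homogeneous v (f ⟨∂⟩ coeff g)
  ⟨∂⟩-homogeneous {m} {u} {v} ≡.refl f g β p = go (exponents-sum m u)
    where
    go : ∀ {αs} → All (λ α → Vec.sum α ≡ u) αs →
         List.foldr (λ α acc → coeff f α * ∂^ α (coeff g) β + acc) 0# αs ≈ 0#
    go []                   = refl
    go (_∷_ {α} ≡.refl ps) = +≈0
      (trans (*-congˡ (∂^-homogeneous α (homogeneous g) β p)) (zeroʳ (coeff f α)))
      (go ps)

  Cat : ∀ {m u v d} → u ℕ.+ v ≡ d → 𝒮-Carrier m d → 𝒮-Carrier m u → 𝒮-Carrier m v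
  Cat u+v≡d g f = mk𝒮 (f ⟨∂⟩ coeff g) (⟨∂⟩-homogeneous u+v≡d f g)

  Cat-isLinear : ∀ {m u v d} (u+v≡d : u ℕ.+ v ≡ d) (g : 𝒮-Carrier m d) →
                 LinearAlgebra.IsLinear K (𝒮 m u) (𝒮 m v) (Cat u+v≡d g)
  Cat-isLinear {m} {u} u+v≡d g = record
    { +ᴹ-isGroupHomomorphism = record
      { isMonoidHomomorphism = record
        { isMagmaHomomorphism = record
          { isRelHomomorphism = record
            { cong = λ p β → cong-go p β (exponents m u) }
          ; homo = λ f f′ β → +-go (coeff f) (coeff f′) β (exponents m u)
          }
        ; ε-homo = λ β → zero-go β (exponents m u)
        }
      ; ⁻¹-homo = λ f β → neg-go (coeff f) β (exponents m u)
      }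
    ; *ₗ-homo = λ a f β → *-go a (coeff f) β (exponents m u)
    }
    where
    apply : Series m → Vec ℕ m → List (Vec ℕ m) → Carrier
    apply f β = List.foldr (λ α acc → f α * ∂^ α (coeff g) β + acc) 0#

    cong-go : ∀ {f f′} → f ≋ f′ → ∀ β αs → apply f β αs ≈ apply f′ β αs
    cong-go p β []       = refl
    cong-go p β (α ∷ αs) = +-cong (*-congʳ (p α)) (cong-go p β αs)

    +-go : ∀ f f′ β αs → apply (λ α → f α + f′ α) β αs ≈ apply f β αs + apply f′ β αs
    +-go f f′ β []       = sym (+-identityˡ 0#)
    +-go f f′ β (α ∷ αs) = trans (+-cong (distribʳ _ (f α) (f′ α)) (+-go f f′ β αs))
      (interchange _ _ _ _)

    zero-go : ∀ β αs → apply (λ _ → 0#) β αs ≈ 0#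
    zero-go β []       = refl
    zero-go β (α ∷ αs) = +≈0 (zeroˡ _) (zero-go β αs)

    neg-go : ∀ f β αs → apply (λ α → - f α) β αs ≈ - apply f β αs
    neg-go f β []       = sym ε⁻¹≈ε
    neg-go f β (α ∷ αs) = trans
      (+-cong (sym (-‿distribˡ-* (f α) _)) (neg-go f β αs)) (⁻¹-∙-comm _ _)

    *-go : ∀ a f β αs → apply (λ α → a * f α) β αs ≈ a * apply f β αs
    *-go a f β []       = sym (zeroʳ a)
    *-go a f β (α ∷ αs) = trans
      (+-cong (*-assoc a (f α) _) (*-go a f β αs)) (sym (distribˡ a _ _))

  index< : ∀ {d} (i j : Fin d) → toℕ i ℕ.+ toℕ j ℕ.< 2 ℕ.* d ∸ 1
  index< {suc n} i j = ≡.subst (toℕ i ℕ.+ toℕ j ℕ.<_) (eq n)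
    (s≤s (ℕₚ.+-mono-≤ (toℕ≤pred[n] i) (toℕ≤pred[n] j)))
    where
    eq : ∀ n → suc (n ℕ.+ n) ≡ n ℕ.+ suc (n ℕ.+ 0)
    eq n = ≡.sym (≡.trans (≡.cong (λ k → n ℕ.+ suc k) (ℕₚ.+-identityʳ n)) (ℕₚ.+-suc n n))

  -- The variables x₂ , … , x₂d are numbered from 0, and so are rows and
  -- columns: with i = i′ + 1 and j = j′ + 1, the variable x_{i+j} has
  -- number (i + j) - 2 = i′ + j′.
  hankel : ∀ d → Fin d → Fin d → Series (2 ℕ.* d ∸ 1)
  hankel d i j = var (fromℕ< (index< i j))

  open module SeriesDeterminant {m} = Determinant (series-rawRing m) using (sign; det) public

  monomial-homogeneous : ∀ {m} (β : Vec ℕ m) → Homogeneous (Vec.sum β) (monomial β)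
  monomial-homogeneous β α p with Vecₚ.≡-dec ℕₚ._≟_ α β
  ... | yes α≡β = contradiction (≡.cong Vec.sum α≡β) p
  ... | no  _   = refl

  var-homogeneous : ∀ {m} (i : Fin m) → Homogeneous 1 (var i)
  var-homogeneous {m} i = ≡.subst (λ n → Homogeneous n (var i))
    (≡.trans (sum-updateAt (Vec.replicate m 0) i) (≡.cong suc (sum-replicate-0 m)))
    (monomial-homogeneous (updateAt (Vec.replicate m 0) i suc))

  ⊛≈0 : ∀ {m} (f g : Series m) α →
    (∀ β γ → Vec.sum β ℕ.+ Vec.sum γ ≡ Vec.sum α → f β * g γ ≈ 0#) → (f ⊛ g) α ≈ 0#
  ⊛≈0 f g []      p = p [] [] ≡.refl
  ⊛≈0 f g (n ∷ α) p = sum≈0 {suc n} _ λ k → ⊛≈0 _ _ α λ β γ q →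
    p (toℕ k ∷ β) (n ∸ toℕ k ∷ γ)
      (≡.trans (ℕ-interchange (toℕ k) (Vec.sum β) (n ∸ toℕ k) (Vec.sum γ))
        (≡.cong₂ ℕ._+_ (ℕₚ.m+[n∸m]≡n (toℕ≤pred[n] k)) q))

  ⊛-homogeneous : ∀ {m a b} {f g : Series m} →
    Homogeneous a f → Homogeneous b g → Homogeneous (a ℕ.+ b) (f ⊛ g)
  ⊛-homogeneous {a = a} {b} {f} {g} F G α p = ⊛≈0 f g α factor
    where
    factor : ∀ β γ → Vec.sum β ℕ.+ Vec.sum γ ≡ Vec.sum α → f β * g γ ≈ 0#
    factor β γ q with Vec.sum β ℕₚ.≟ a
    ... | no β≢a = trans (*-congʳ (F β β≢a)) (zeroˡ (g γ))
    ... | yes β≡a = trans (*-congˡ (G γ λ γ≡b →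
            p (≡.trans (≡.sym q) (≡.cong₂ ℕ._+_ β≡a γ≡b)))) (zeroʳ (f β))

  sign-homogeneous : ∀ {m j} k {f : Series m} →
    Homogeneous j f → Homogeneous j (sign k f)
  sign-homogeneous zero    F = F
  sign-homogeneous (suc k) F α p = neg≈0 (sign-homogeneous k F α p)

  sum-homogeneous : ∀ {m j n} (t : Fin n → Series m) → (∀ i → Homogeneous j (t i)) →
    Homogeneous j (RawMonoidDefinitions.sum (RawRing.+-rawMonoid (series-rawRing m)) t)
  sum-homogeneous {n = zero}  t T α p = refl
  sum-homogeneous {n = suc n} t T α p =
    +≈0 (T zero α p) (sum-homogeneous (t ∘ suc) (T ∘ suc) α p)

  det-homogeneous : ∀ {m n} (A : Fin n → Fin n → Series m) →
    (∀ i j → Homogeneous 1 (A i j)) → Homogeneous n (det A)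
  det-homogeneous {m} {zero}  A H = ≡.subst (λ n → Homogeneous n (det A))
    (sum-replicate-0 m) (monomial-homogeneous (Vec.replicate m 0))
  det-homogeneous {m} {suc n} A H = sum-homogeneous _ λ j →
    sign-homogeneous (toℕ j) (⊛-homogeneous (H zero j)
      (det-homogeneous (λ i k → A (suc i) (punchIn j k)) (λ i k → H (suc i) (punchIn j k))))

  h : ∀ d → 𝒮-Carrier (2 ℕ.* d ∸ 1) d
  h d = mk𝒮 (det (hankel d))
    (det-homogeneous (hankel d) (λ i j → var-homogeneous (fromℕ< (index< i j))))

open LinearAlgebra ℂ-commutativeRing public
open Polynomials ℂ-commutativeRing public

infixr 8 _^ℚ_

_^ℚ_ : ℚ → ℕ → ℚ
_^ℚ_ = RawSemiringDefinitions._^_ ℚ.+-*-rawSemiring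

{-# OPTIONS --safe #-}

-- The form h_d is determined by its full polarization, that is by its
-- iterated partial derivatives of order d.  Contracted with the moment
-- vectors (x^k)_k of points x_1, …, x_d, the polarization of the Hankel
-- determinant is the square of the Vandermonde product of the points; the
-- moment vectors of 2d-1 distinct points span, so it is recovered from these
-- values by Lagrange interpolation.  For two groups x, y of u and v points,
--
--   V(y, x)² = V(y)² V(x)² ∏_j p(y_j),   p = ∏_i (X - x_i)²,
--
-- and the product over j is a form of degree v in the 2u + 1 coefficients of
-- p.  Hence the catalecticant factors through a space whose dimension is the
-- number C(2u + v, v) of monomials of that degree.  Exchanging u and v where
-- necessary one may take v ≤ u, and then C(2u + v, v) is at most its value
-- for the most balanced u, v with the same sum, the bound of the theorem.
--
-- All of this takes place over ℚ, where elimination yields a basis of the row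
-- space which remains independent over ℂ.
module Submission where

open import Defs using (module Determinant; module LinearAlgebra; module Polynomials)
open import Algebra.Bundles using (CommutativeRing; RawRing)
import Algebra.Definitions.RawMonoid as RawMonoidDefinitions
open import Algebra.Morphism.Structures using (IsRingHomomorphism)
import Algebra.Properties.CommutativeMonoid.Mult as CommutativeMult
import Algebra.Properties.CommutativeMonoid.Sum as CommutativeMonoidSum
import Algebra.Properties.CommutativeSemigroup as CommutativeSemigroupProperties
import Algebra.Properties.Monoid.Mult as Mult
import Algebra.Properties.Ring as RingProperties
import Algebra.Properties.Semiring.Exp as SemiringExp
import Algebra.Properties.Semiring.Mult as SemiringMult
import Algebra.Properties.Semiring.Sum as SemiringSum
import Algebra.Solver.Ring.NaturalCoefficients.Default as NaturalCoefficientsSolver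
open import Data.Bool.Base using (true; false; if_then_else_)
open import Data.Fin.Base using (Fin; zero; suc; toℕ; fromℕ<; inject₁; punchIn; punchOut)
import Data.Fin.Properties as Finₚ
import Data.Integer.Base as ℤ
import Data.Integer.Properties as ℤₚ
open import Data.List.Base as List using (List; []; _∷_; concatMap)
open import Data.List.Membership.Propositional using (_∈_)
open import Data.List.Membership.Propositional.Properties
  using (∈-allFin; ∈-concat⁺′; ∈-lookup; ∈-map⁺)
import Data.List.Relation.Unary.All as All
open import Data.List.Relation.Unary.Any as Any using (here)
open import Data.List.Relation.Unary.Any.Properties using (lookup-index)
open import Data.Nat.Base as ℕ using (ℕ; zero; suc; pred; _!; _∸_; ⌊_/2⌋; ⌈_/2⌉; z≤n; s≤s)
open import Data.Nat.Combinatorics using (_C_)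
open import Data.Nat.GeneralisedArithmetic using (fold)
import Data.Nat.Properties as ℕₚ
open import Data.Product.Base using (∃; ∃-syntax; _×_; _,_; proj₁; proj₂)
import Data.Rational.Base as ℚ
import Data.Rational.Properties as ℚₚ
import Data.Rational.Unnormalised.Base as ℚᵘ
import Data.Rational.Unnormalised.Properties as ℚᵘₚ
open import Data.Sum.Base using (_⊎_; inj₁; inj₂)
open import Data.Vec.Base as Vec using (Vec; []; _∷_; lookup; _++_; removeAt; updateAt)
import Data.Vec.Functional as Vector
import Data.Vec.Properties as Vecₚ
open import Function.Base using (_∘_)
open import Level using (_⊔_)
open import Relation.Binary.Definitions using (tri<; tri≈; tri>)
open import Relation.Binary.PropositionalEquality as ≡ using (_≡_; _≢_)
import Relation.Binary.Reasoning.Setoid as SetoidReasoning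
open import Relation.Nullary using (yes; no; does; contradiction)
open import Relation.Nullary.Decidable using (dec-true; dec-false)

-- Why a squared Vandermonde product: put the combination t_1 m(x_1) + ... + t_d m(x_d) of moment
-- vectors into the Hankel matrix. The result is V diag(t) V^T with V the Vandermonde matrix of the
-- points, so its determinant is t_1 ... t_d (det V)², and the polarization is the coefficient of
-- t_1 ... t_d. The code reaches the same identity by matching Laplace expansions: one for the
-- repeated derivative of the determinant, one for the product of two alternants.
--
-- The obstacle is the notion of rank. `HasRank` asks for an explicit basis of the image, so a
-- factorization through a small space is not enough, and over ℂ, where equality cannot be decided,
-- no pivot can be searched for. As h_d has integer coefficients, its matrix lives over ℚ, where a
-- pivot can be found; the inner dimension of the factorization is carried along the elimination and
-- limits the number of pivots.

-- Binomial coefficients: the most balanced case and the growth rate.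

module Binomials where

  open import Data.Nat.Base using (_+_; _*_; _^_; _≤_; _<_; s≤s; z≤n)
  open import Data.Nat.Combinatorics using (nCk+nC[k+1]≡[n+1]C[k+1]; nCn≡1)
  open import Data.Nat.Solver using (module +-*-Solver)
  open import Relation.Binary.PropositionalEquality using (refl; sym; trans; cong; cong₂; subst; subst₂)

  -- Monomials of degree v in s variables, split by divisibility by the first variable.
  #monomials : ℕ → ℕ → ℕ
  #monomials s       zero    = 1
  #monomials zero    (suc v) = 0
  #monomials (suc s) (suc v) = #monomials s (suc v) + #monomials (suc s) v

  #monomials≡C : ∀ s v → #monomials (suc s) v ≡ (s + v) C v
  #monomials≡C s       zero    = refl
  #monomials≡C zero    (suc v) = trans (#monomials≡C zero v) (trans (nCn≡1 v) (sym (nCn≡1 (suc v))))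
  #monomials≡C (suc s) (suc v) = trans
    (cong₂ _+_ (#monomials≡C s (suc v)) (#monomials≡C (suc s) v))
    (trans (ℕₚ.+-comm ((s + suc v) C suc v) _)
    (trans (cong (λ n → (suc s + v) C v + n C suc v) (ℕₚ.+-suc s v))
    (trans (nCk+nC[k+1]≡[n+1]C[k+1] (suc s + v) v)
           (cong (λ n → suc n C suc v) (sym (ℕₚ.+-suc s v))))))

  monomials-count : ∀ u v → (2 * u + v) C v ≡ #monomials (suc (u + u)) v
  monomials-count u v = trans (cong (λ n → (u + n + v) C v) (ℕₚ.+-identityʳ u)) (sym (#monomials≡C (u + u) v))

  -- Pascal's rule splits the left side into `suc k` times one induction hypothesis plus `suc m`
  -- times another. Free of division, it lets the ratio identities below follow by cancelling
  -- `k ! * m !`.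
  choose-factorials : ∀ k m → k ! * m ! * ((k + m) C k) ≡ (k + m) !
  choose-factorials zero    m = trans (ℕₚ.*-identityʳ _) (ℕₚ.+-identityʳ (m !))
  choose-factorials (suc k) zero = trans (cong (λ n → suc k ! * 1 * (suc n C suc k)) (ℕₚ.+-identityʳ k))
    (trans (cong (suc k ! * 1 *_) (nCn≡1 (suc k)))
    (trans (ℕₚ.*-identityʳ _) (trans (ℕₚ.*-identityʳ _) (cong (λ n → suc n !) (sym (ℕₚ.+-identityʳ k))))))
  choose-factorials (suc k) (suc m) = trans
    (cong (suc k ! * suc m ! *_) (sym (nCk+nC[k+1]≡[n+1]C[k+1] (k + suc m) k)))
    (trans (solve 6 (λ k m a b x y →
       (con 1 :+ k) :* a :* ((con 1 :+ m) :* b) :* (x :+ y) :=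
       (con 1 :+ k) :* (a :* ((con 1 :+ m) :* b) :* x) :+
       (con 1 :+ m) :* ((con 1 :+ k) :* a :* b :* y)) refl
       k m (k !) (m !) ((k + suc m) C k) ((k + suc m) C suc k))
    (trans (cong₂ (λ x y → suc k * x + suc m * y) (choose-factorials k (suc m))
      (trans (cong (λ n → suc k ! * m ! * (n C suc k)) (ℕₚ.+-suc k m))
        (trans (choose-factorials (suc k) m) (cong _! (sym (ℕₚ.+-suc k m))))))
    (sym (ℕₚ.*-distribʳ-+ ((k + suc m) !) (suc k) (suc m)))))
    where open +-*-Solver

  choose-step : ∀ k m → suc k * ((k + suc m) C suc k) ≡ suc m * ((k + suc m) C k)
  choose-step k m = ℕₚ.*-cancelˡ-≡ _ _ (k ! * m !) {{ℕₚ.m*n≢0 (k !) (m !) {{ℕₚ._!≢0 k}} {{ℕₚ._!≢0 m}}}}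
    (trans (solve 4 (λ k a b x → a :* b :* ((con 1 :+ k) :* x) := (con 1 :+ k) :* a :* b :* x) refl
       k (k !) (m !) ((k + suc m) C suc k))
    (trans (cong (λ n → suc k ! * m ! * (n C suc k)) (ℕₚ.+-suc k m))
    (trans (choose-factorials (suc k) m)
    (trans (cong _! (sym (ℕₚ.+-suc k m)))
    (trans (sym (choose-factorials k (suc m)))
    (solve 4 (λ m a b x → a :* ((con 1 :+ m) :* b) :* x := a :* b :* ((con 1 :+ m) :* x)) refl
       m (k !) (m !) ((k + suc m) C k)))))))
    where open +-*-Solver

  -- Consecutive entries in a row of Pascal's triangle have ratio (m + 1) / (k + 1). It is applied
  -- with `c` equal to 1 for monotonicity and to 2 for doubling.
  choose-increasing : ∀ c k m → c * suc k ≤ suc m → c * ((k + suc m) C k) ≤ (k + suc m) C suc k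
  choose-increasing c k m p = ℕₚ.*-cancelˡ-≤ (suc k) (begin
    suc k * (c * x)  ≡⟨ solve 3 (λ k c x → (con 1 :+ k) :* (c :* x) := c :* (con 1 :+ k) :* x) refl k c x ⟩
    c * suc k * x    ≤⟨ ℕₚ.*-monoˡ-≤ x p ⟩
    suc m * x        ≡⟨ choose-step k m ⟨
    suc k * ((k + suc m) C suc k) ∎)
    where
    open ℕₚ.≤-Reasoning
    open +-*-Solver
    x = (k + suc m) C k

  -- Pascal's rule writes the left side as a sum of two binomial coefficients,
  -- of which the larger is at most half of the right side.
  choose-diagonal : ∀ v e → (2 * (v + (2 + e)) + v) C v ≤ (2 * (suc v + e) + suc v) C suc v
  choose-diagonal zero e = ℕₚ.≤-trans (ℕₚ.≤-trans (s≤s z≤n) (choose-increasing 1 0 (2 * suc e) (s≤s z≤n)))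
    (ℕₚ.≤-reflexive (cong (_C 1) (sym (trans (ℕₚ.+-suc (2 * (1 + e)) 0) (ℕₚ.+-identityʳ (suc (2 * (1 + e))))))))
  choose-diagonal (suc w) e = subst₂ (λ a b → a C suc w ≤ b C suc (suc w)) (eq₁ w e) (eq₂ w e)
    (begin
      suc n C suc w              ≡⟨ nCk+nC[k+1]≡[n+1]C[k+1] n w ⟨
      n C w + n C suc w          ≤⟨ ℕₚ.+-monoˡ-≤ (n C suc w) low ⟩
      n C suc w + n C suc w      ≡⟨ cong (n C suc w +_) (sym (ℕₚ.+-identityʳ _)) ⟩
      2 * (n C suc w)            ≤⟨ high ⟩
      n C suc (suc w)            ∎)
    where
    open ℕₚ.≤-Reasoning
    open +-*-Solver
    m n : ℕ
    m = 2 * (w + (2 + e))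
    n = suc w + suc m
    eq₁ : ∀ w e → suc (suc w + suc (2 * (w + (2 + e)))) ≡ 2 * (suc w + (2 + e)) + suc w
    eq₁ = solve 2 (λ w e → con 1 :+ (con 1 :+ w :+ (con 1 :+ con 2 :* (w :+ (con 2 :+ e)))) :=
      con 2 :* (con 1 :+ w :+ (con 2 :+ e)) :+ (con 1 :+ w)) refl
    eq₂ : ∀ w e → suc w + suc (2 * (w + (2 + e))) ≡ 2 * (suc (suc w) + e) + suc (suc w)
    eq₂ = solve 2 (λ w e → con 1 :+ w :+ (con 1 :+ con 2 :* (w :+ (con 2 :+ e))) :=
      con 2 :* (con 2 :+ w :+ e) :+ (con 2 :+ w)) refl
    high : 2 * (n C suc w) ≤ n C suc (suc w)
    high = choose-increasing 2 (suc w) m (ℕₚ.≤-trans (ℕₚ.m≤m+n (2 * suc (suc w)) (e + e + 1))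
      (ℕₚ.≤-reflexive (solve 2 (λ w e → con 2 :* (con 2 :+ w) :+ (e :+ e :+ con 1) :=
        con 1 :+ con 2 :* (w :+ (con 2 :+ e))) refl w e)))
    low : n C w ≤ n C suc w
    low = subst (λ k → k C w ≤ k C suc w) (ℕₚ.+-suc w (suc m))
      (subst (_≤ (w + suc (suc m)) C suc w) (ℕₚ.*-identityˡ _) (choose-increasing 1 w (suc m)
        (ℕₚ.≤-trans (ℕₚ.m≤m+n (1 * suc w) (w + e + e + 5))
          (ℕₚ.≤-reflexive (solve 2 (λ w e → con 1 :* (con 1 :+ w) :+ (w :+ e :+ e :+ con 5) :=
            con 2 :+ con 2 :* (w :+ (con 2 :+ e))) refl w e)))))

  ⌊[2k+n]/2⌋ : ∀ k n → ⌊ 2 * k + n /2⌋ ≡ k + ⌊ n /2⌋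
  ⌊[2k+n]/2⌋ zero    n = refl
  ⌊[2k+n]/2⌋ (suc k) n = trans (cong (λ j → ⌊ suc (j + n) /2⌋) (ℕₚ.+-suc k (k + 0))) (cong suc (⌊[2k+n]/2⌋ k n))

  ⌈3[2k+e]/2⌉ : ∀ k e → ⌈ 3 * (2 * k + e) /2⌉ ≡ 3 * k + ⌈ 3 * e /2⌉
  ⌈3[2k+e]/2⌉ k e = trans (cong (λ n → ⌊ suc n /2⌋) (solve 2 (λ k e → con 3 :* (con 2 :* k :+ e) := con 2 :* (con 3 :* k) :+ con 3 :* e) refl k e))
    (trans (cong ⌊_/2⌋ (sym (ℕₚ.+-suc (2 * (3 * k)) (3 * e)))) (⌊[2k+n]/2⌋ (3 * k) (suc (3 * e))))
    where open +-*-Solver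

  rankBound : ℕ → ℕ
  rankBound d = ⌈ 3 * d /2⌉ C ⌊ d /2⌋

  rankBound-even : ∀ k → rankBound (2 * k + 0) ≡ (k + 2 * k) C k
  rankBound-even k = cong₂ _C_ (trans (⌈3[2k+e]/2⌉ k 0) (ℕₚ.+-identityʳ (3 * k))) (trans (⌊[2k+n]/2⌋ k 0) (ℕₚ.+-identityʳ k))

  rankBound-odd : ∀ k → rankBound (2 * k + 1) ≡ (k + (2 + 2 * k)) C k
  rankBound-odd k = cong₂ _C_ (trans (⌈3[2k+e]/2⌉ k 1) (solve 1 (λ k → con 3 :* k :+ con 2 := k :+ (con 2 :+ con 2 :* k)) refl k)) (trans (⌊[2k+n]/2⌋ k 1) (ℕₚ.+-identityʳ k))
    where open +-*-Solver

  -- Here `e` is u - v. Each use of `choose-diagonal` moves (u, v) to (u - 1, v + 1) and lowers `e`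
  -- by 2 with the sum fixed, ending at `e` = 0 for even sums and `e` = 1 for odd ones, where
  -- equality holds.
  choose≤rankBound′ : ∀ v e → (2 * (v + e) + v) C v ≤ rankBound ((v + e) + v)
  choose≤rankBound′ v 0 = ℕₚ.≤-reflexive (trans (cong (_C v) (solve 1 (λ v → con 2 :* (v :+ con 0) :+ v := v :+ con 2 :* v) refl v))
    (trans (sym (rankBound-even v)) (cong rankBound (solve 1 (λ v → con 2 :* v :+ con 0 := v :+ con 0 :+ v) refl v))))
    where open +-*-Solver
  choose≤rankBound′ v 1 = ℕₚ.≤-reflexive (trans (cong (_C v) (solve 1 (λ v → con 2 :* (v :+ con 1) :+ v := v :+ (con 2 :+ con 2 :* v)) refl v))
    (trans (sym (rankBound-odd v)) (cong rankBound (solve 1 (λ v → con 2 :* v :+ con 1 := v :+ con 1 :+ v) refl v))))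
    where open +-*-Solver
  choose≤rankBound′ v (suc (suc e)) = ℕₚ.≤-trans (choose-diagonal v e)
    (subst (λ n → (2 * (suc v + e) + suc v) C suc v ≤ rankBound n)
      (solve 2 (λ v e → con 1 :+ v :+ e :+ (con 1 :+ v) := v :+ (con 2 :+ e) :+ v) refl v e)
      (choose≤rankBound′ (suc v) e))
    where open +-*-Solver

  choose≤rankBound : ∀ {u v} → v ≤ u → (2 * u + v) C v ≤ rankBound (u + v)
  choose≤rankBound {u} {v} v≤u = subst (λ u → (2 * u + v) C v ≤ rankBound (u + v)) (ℕₚ.m+[n∸m]≡n v≤u) (choose≤rankBound′ v (u ℕ.∸ v))

  -- In either parity, passing from d to d + 2 in `rankBound` raises `k` by 1 and `m` by 2.
  -- Multiplied by `k ! * m !`, both sides become (k + m + 3)!.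
  choose-ratio : ∀ k m → suc k * (suc (suc m) * suc m) * ((suc k + suc (suc m)) C suc k) ≡
    (3 + (k + m)) * ((2 + (k + m)) * (1 + (k + m))) * ((k + m) C k)
  choose-ratio k m = ℕₚ.*-cancelˡ-≡ _ _ (k ! * m !) {{ℕₚ.m*n≢0 (k !) (m !) {{ℕₚ._!≢0 k}} {{ℕₚ._!≢0 m}}}}
    (trans (solve 5 (λ k m a b x → a :* b :* ((con 1 :+ k) :* ((con 2 :+ m) :* (con 1 :+ m)) :* x) :=
        (con 1 :+ k) :* a :* ((con 2 :+ m) :* ((con 1 :+ m) :* b)) :* x) refl k m (k !) (m !) ((suc k + suc (suc m)) C suc k))
    (trans (choose-factorials (suc k) (suc (suc m)))
    (trans (cong (λ n → suc n !) (trans (ℕₚ.+-suc k (suc m)) (cong suc (ℕₚ.+-suc k m))))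
    (trans (cong (λ y → (3 + (k + m)) * ((2 + (k + m)) * ((1 + (k + m)) * y))) (sym (choose-factorials k m)))
    (solve 5 (λ n m a b x → (con 3 :+ n) :* ((con 2 :+ n) :* ((con 1 :+ n) :* (a :* b :* x))) :=
        a :* b :* ((con 3 :+ n) :* ((con 2 :+ n) :* (con 1 :+ n)) :* x)) refl (k + m) m (k !) (m !) ((k + m) C k))))))
    where open +-*-Solver

  -- The factor 169/25 is 2.6² = 6.76, the growth allowed when d increases by 2. With `m` close to
  -- 2k the true ratio tends to 27/4 = 6.75, so 2.6 leaves only a narrow margin.
  choose-growth : ∀ k m → 25 * ((3 + (k + m)) * ((2 + (k + m)) * (1 + (k + m)))) ≤ 169 * (suc k * (suc (suc m) * suc m)) →
    25 * ((suc k + suc (suc m)) C suc k) ≤ 169 * ((k + m) C k)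
  choose-growth k m p = ℕₚ.*-cancelˡ-≤ D (begin
    D * (25 * y)              ≡⟨ solve 2 (λ d y → d :* (con 25 :* y) := con 25 :* (d :* y)) refl D y ⟩
    25 * (D * y)              ≡⟨ cong (25 *_) (choose-ratio k m) ⟩
    25 * (E * x)              ≡⟨ ℕₚ.*-assoc 25 E x ⟨
    25 * E * x                ≤⟨ ℕₚ.*-monoˡ-≤ x p ⟩
    169 * D * x               ≡⟨ solve 2 (λ d x → con 169 :* d :* x := d :* (con 169 :* x)) refl D x ⟩
    D * (169 * x)             ∎)
    where
    open ℕₚ.≤-Reasoning
    open +-*-Solver
    x y D E : ℕ
    x = (k + m) C k
    y = (suc k + suc (suc m)) C suc k
    D = suc k * (suc (suc m) * suc m)
    E = (3 + (k + m)) * ((2 + (k + m)) * (1 + (k + m)))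

  choose-growth-even : ∀ k → 25 * ((suc k + 2 * suc k) C suc k) ≤ 169 * ((k + 2 * k) C k)
  choose-growth-even k = subst (λ n → 25 * ((suc k + n) C suc k) ≤ 169 * ((k + 2 * k) C k))
    (solve 1 (λ k → con 2 :+ con 2 :* k := con 2 :* (con 1 :+ k)) refl k)
    (choose-growth k (2 * k) (ℕₚ.≤-trans
      -- This is the exact difference of the two sides. Its leading coefficient 1 is 169 · 4 - 25 ·
      -- 27, the margin between 6.76 and 27/4.
      (ℕₚ.m≤m+n _ (suc k * (k * k + 339 * k + 188)))
      (ℕₚ.≤-reflexive (solve 1 (λ k →
        con 25 :* ((con 3 :+ (k :+ con 2 :* k)) :* ((con 2 :+ (k :+ con 2 :* k)) :* (con 1 :+ (k :+ con 2 :* k))))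
        :+ (con 1 :+ k) :* (k :* k :+ con 339 :* k :+ con 188) :=
        con 169 :* ((con 1 :+ k) :* ((con 2 :+ con 2 :* k) :* (con 1 :+ con 2 :* k)))) refl k))))
    where open +-*-Solver

  choose-growth-odd : ∀ k → 25 * ((suc k + (2 + 2 * suc k)) C suc k) ≤ 169 * ((k + (2 + 2 * k)) C k)
  choose-growth-odd k = subst (λ n → 25 * ((suc k + n) C suc k) ≤ 169 * ((k + (2 + 2 * k)) C k))
    (solve 1 (λ k → con 2 :+ (con 2 :+ con 2 :* k) := con 2 :+ con 2 :* (con 1 :+ k)) refl k)
    (choose-growth k (2 + 2 * k) (ℕₚ.≤-trans
      (ℕₚ.m≤m+n _ (suc k * (k * k + 341 * k + 528)))
      (ℕₚ.≤-reflexive (solve 1 (λ k →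
        con 25 :* ((con 3 :+ (k :+ (con 2 :+ con 2 :* k))) :* ((con 2 :+ (k :+ (con 2 :+ con 2 :* k))) :* (con 1 :+ (k :+ (con 2 :+ con 2 :* k)))))
        :+ (con 1 :+ k) :* (k :* k :+ con 341 :* k :+ con 528) :=
        con 169 :* ((con 1 :+ k) :* ((con 2 :+ (con 2 :+ con 2 :* k)) :* (con 1 :+ (con 2 :+ con 2 :* k))))) refl k))))
    where open +-*-Solver

  scale-step : ∀ a b x y → 25 * y ≤ 169 * x → a * x < b → (25 * a) * y < 169 * b
  scale-step a b x y p q = begin-strict
    (25 * a) * y   ≡⟨ solve 2 (λ a y → con 25 :* a :* y := a :* (con 25 :* y)) refl a y ⟩
    a * (25 * y)   ≤⟨ ℕₚ.*-monoʳ-≤ a p ⟩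
    a * (169 * x)  ≡⟨ solve 2 (λ a x → a :* (con 169 :* x) := con 169 :* (a :* x)) refl a x ⟩
    169 * (a * x)  <⟨ ℕₚ.*-monoʳ-< 169 q ⟩
    169 * b        ∎
    where
    open ℕₚ.≤-Reasoning
    open +-*-Solver

  ^-2+ : ∀ a n → a * a * a ^ n ≡ a ^ (2 + n)
  ^-2+ a n = ℕₚ.*-assoc a a (a ^ n)

  -- The induction starts at d = 2 because at d = 0 both sides are 1. The base case is 25 · 3 = 75 <
  -- 169 = 76 + 93.
  power-bound-even : ∀ k → 5 ^ (2 * suc k) * ((suc k + 2 * suc k) C suc k) < 13 ^ (2 * suc k)
  power-bound-even zero = ℕₚ.m≤m+n 76 93
  power-bound-even (suc k) = subst (λ n → 5 ^ n * ((suc (suc k) + 2 * suc (suc k)) C suc (suc k)) < 13 ^ n)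
    (sym (ℕₚ.*-suc 2 (suc k)))
    (subst₂ (λ a b → a * ((suc (suc k) + 2 * suc (suc k)) C suc (suc k)) < b)
      (^-2+ 5 (2 * suc k)) (^-2+ 13 (2 * suc k))
      (scale-step (5 ^ (2 * suc k)) (13 ^ (2 * suc k)) _ _ (choose-growth-even (suc k)) (power-bound-even k)))

  power-bound-odd : ∀ k → 5 ^ (2 * k + 1) * ((k + (2 + 2 * k)) C k) < 13 ^ (2 * k + 1)
  power-bound-odd zero = ℕₚ.m≤m+n 6 7
  power-bound-odd (suc k) = subst (λ n → 5 ^ n * ((suc k + (2 + 2 * suc k)) C suc k) < 13 ^ n)
    (cong (_+ 1) (sym (ℕₚ.*-suc 2 k)))
    (subst₂ (λ a b → a * ((suc k + (2 + 2 * suc k)) C suc k) < b)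
      (^-2+ 5 (2 * k + 1)) (^-2+ 13 (2 * k + 1))
      (scale-step (5 ^ (2 * k + 1)) (13 ^ (2 * k + 1)) _ _ (choose-growth-odd k) (power-bound-odd k)))

  parity : ∀ d → ∃ λ k → (d ≡ 2 * k + 0) ⊎ (d ≡ 2 * k + 1)
  parity zero = 0 , inj₁ refl
  parity (suc d) with parity d
  ... | k , inj₁ refl = k , inj₂ (sym (ℕₚ.+-suc (2 * k) 0))
  ... | k , inj₂ refl = suc k , inj₁ (solve 1 (λ k → con 1 :+ (con 2 :* k :+ con 1) := con 2 :* (con 1 :+ k) :+ con 0) refl k)
    where open +-*-Solver

  power-bound : ∀ d → 0 < d → 5 ^ d * rankBound d < 13 ^ d
  power-bound d 0<d with parity d
  power-bound _ ()  | zero  , inj₁ refl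
  power-bound _ 0<d | suc k , inj₁ refl = subst₂ (λ n c → 5 ^ n * c < 13 ^ n)
    (sym (ℕₚ.+-identityʳ (2 * suc k))) (sym (rankBound-even (suc k))) (power-bound-even k)
  power-bound _ 0<d | k , inj₂ refl = subst (λ c → 5 ^ (2 * k + 1) * c < 13 ^ (2 * k + 1))
    (sym (rankBound-odd k)) (power-bound-odd k)

open Binomials

-- Finite sums and the positions of deleted columns.

module Sums {c ℓ} (R : CommutativeRing c ℓ) where

  open CommutativeRing R hiding (zero)
  open RingProperties ring using (-‿distribˡ-*)
  open SemiringSum semiring using (sum; sum-cong-≋; sum-replicate-zero; *-distribˡ-sum; ∑-distrib-+)
  open SetoidReasoning setoid

  sum-zero : ∀ {n} {t : Fin n → Carrier} → (∀ i → t i ≈ 0#) → sum t ≈ 0#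
  sum-zero {n} p = trans (sum-cong-≋ p) (sum-replicate-zero n)

  sum-+* : ∀ {n} s (a b q : Fin n → Carrier) →
    sum (λ i → (a i + s * b i) * q i) ≈ sum (λ i → a i * q i) + s * sum (λ i → b i * q i)
  sum-+* s a b q = begin
    sum (λ i → (a i + s * b i) * q i)
      ≈⟨ sum-cong-≋ (λ i → trans (distribʳ (q i) _ _) (+-congˡ (*-assoc s (b i) (q i)))) ⟩
    sum (λ i → a i * q i + s * (b i * q i))
      ≈⟨ ∑-distrib-+ (λ i → a i * q i) (λ i → s * (b i * q i)) ⟩
    sum (λ i → a i * q i) + sum (λ i → s * (b i * q i))
      ≈⟨ +-congˡ (*-distribˡ-sum s (λ i → b i * q i)) ⟨
    sum (λ i → a i * q i) + s * sum (λ i → b i * q i) ∎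

  sum--* : ∀ {n} s (a b q : Fin n → Carrier) →
    sum (λ i → (a i - s * b i) * q i) ≈ sum (λ i → a i * q i) - s * sum (λ i → b i * q i)
  sum--* s a b q = trans (sum-cong-≋ (λ i → *-congʳ {q i} (+-congˡ {a i} (-‿distribˡ-* s (b i)))))
    (trans (sum-+* (- s) a b q) (+-congˡ (sym (-‿distribˡ-* s _))))

-- The position of the column i after deletion of the column punchIn i k.
punchBack : ∀ {n} → Fin (suc (suc n)) → Fin (suc n) → Fin (suc n)
punchBack zero            k       = zero
punchBack (suc i)         zero    = i
punchBack {suc n} (suc i) (suc k) = suc (punchBack i k)

punchIn-punchBack : ∀ {n} (i : Fin (suc (suc n))) k → punchIn (punchIn i k) (punchBack i k) ≡ i
punchIn-punchBack zero            k       = ≡.refl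
punchIn-punchBack (suc i)         zero    = ≡.refl
punchIn-punchBack {suc n} (suc i) (suc k) = ≡.cong suc (punchIn-punchBack i k)

punchIn-comm : ∀ {n} (i : Fin (suc (suc n))) k c →
  punchIn (punchIn i k) (punchIn (punchBack i k) c) ≡ punchIn i (punchIn k c)
punchIn-comm zero            k       c       = ≡.refl
punchIn-comm (suc i)         zero    c       = ≡.refl
punchIn-comm {suc n} (suc i) (suc k) zero    = ≡.refl
punchIn-comm {suc n} (suc i) (suc k) (suc c) = ≡.cong suc (punchIn-comm i k c)

-- Determinants: column expansion, row operations, Vandermonde products.

module Determinants {c ℓ} (R : CommutativeRing c ℓ) where

  open CommutativeRing R hiding (zero)
  open RingProperties ring using (-0#≈0#; -‿involutive; -‿distribˡ-*; -‿distribʳ-*; -‿+-comm)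
  open SemiringSum semiring
    using (sum; sum-cong-≋; *-distribˡ-sum; ∑-comm; ∑-distrib-+)
  open CommutativeMonoidSum +-commutativeMonoid using (sum-remove)
  open NaturalCoefficientsSolver commutativeSemiring using (solve; _:=_; _:+_; _:*_)
  open SemiringExp semiring using (_^_)
  open SetoidReasoning setoid
  open Sums R using (sum-zero)
  open Determinant rawRing public

  sign-cong : ∀ k {x y} → x ≈ y → sign k x ≈ sign k y
  sign-cong zero    p = p
  sign-cong (suc k) p = -‿cong (sign-cong k p)

  sign-+ : ∀ k x y → sign k (x + y) ≈ sign k x + sign k y
  sign-+ zero    x y = refl
  sign-+ (suc k) x y = trans (-‿cong (sign-+ k x y)) (sym (-‿+-comm _ _))

  sign-*ˡ : ∀ k x y → sign k (x * y) ≈ sign k x * y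
  sign-*ˡ zero    x y = refl
  sign-*ˡ (suc k) x y = trans (-‿cong (sign-*ˡ k x y)) (-‿distribˡ-* _ _)

  sign-*ʳ : ∀ k x y → sign k (x * y) ≈ x * sign k y
  sign-*ʳ zero    x y = refl
  sign-*ʳ (suc k) x y = trans (-‿cong (sign-*ʳ k x y)) (-‿distribʳ-* _ _)

  sign-0 : ∀ k → sign k 0# ≈ 0#
  sign-0 zero    = refl
  sign-0 (suc k) = trans (-‿cong (sign-0 k)) -0#≈0#

  sign-neg : ∀ k x → sign k (- x) ≡ - sign k x
  sign-neg zero    x = ≡.refl
  sign-neg (suc k) x = ≡.cong -_ (sign-neg k x)

  sign-comm : ∀ j k x → sign j (sign k x) ≡ sign k (sign j x)
  sign-comm zero    k x = ≡.refl
  sign-comm (suc j) k x = ≡.trans (≡.cong -_ (sign-comm j k x)) (≡.sym (sign-neg k (sign j x)))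

  sign-self : ∀ k x → sign k (sign k x) ≈ x
  sign-self zero    x = refl
  sign-self (suc k) x = trans (-‿cong (reflexive (sign-neg k (sign k x))))
    (trans (-‿involutive _) (sign-self k x))

  sign-sum : ∀ k {n} (t : Fin n → Carrier) → sign k (sum t) ≈ sum (λ i → sign k (t i))
  sign-sum k {zero}  t = sign-0 k
  sign-sum k {suc n} t = trans (sign-+ k _ _) (+-congˡ (sign-sum k (t ∘ suc)))

  det-cong : ∀ {n} {A B : Fin n → Fin n → Carrier} → (∀ i j → A i j ≈ B i j) → det A ≈ det B
  det-cong {zero}  p = refl
  det-cong {suc n} p = sum-cong-≋ λ j → sign-cong (toℕ j)
    (*-cong (p zero j) (det-cong λ i k → p (suc i) (punchIn j k)))

  minor : ∀ {n} → Fin (suc n) → Fin (suc n) → (Fin (suc n) → Fin (suc n) → Carrier) →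
          Fin n → Fin n → Carrier
  minor i j A k l = A (punchIn i k) (punchIn j l)

  laplace : ∀ {n} → (Fin (suc n) → Fin (suc n) → Carrier) → Fin (suc n) → Carrier
  laplace A j = sign (toℕ j) (A zero j * det (minor zero j A))

  -- `punchIn i k` and `punchBack i k` have a sum that differs by one from that of `i` and `k`: of
  -- two deleted columns, exactly one is shifted by the deletion of the other. This gives the extra
  -- sign.
  sign-punch : ∀ {n} (i : Fin (suc (suc n))) k x →
    sign (toℕ (punchIn i k)) (sign (toℕ (punchBack i k)) x) ≈ sign (suc (toℕ i)) (sign (toℕ k) x)
  sign-punch zero            k       x = refl
  sign-punch (suc i)         zero    x = sym (-‿involutive _)
  sign-punch {suc n} (suc i) (suc k) x = begin
    - sign (toℕ (punchIn i k)) (- sign (toℕ (punchBack i k)) x)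
      ≈⟨ -‿cong (reflexive (sign-neg (toℕ (punchIn i k)) _)) ⟩
    - - sign (toℕ (punchIn i k)) (sign (toℕ (punchBack i k)) x)
      ≈⟨ -‿cong (-‿cong (sign-punch i k x)) ⟩
    - - sign (suc (toℕ i)) (sign (toℕ k) x)
      ≈⟨ -‿cong (reflexive (≡.sym (sign-neg (suc (toℕ i)) _))) ⟩
    sign (suc (toℕ (suc i))) (sign (toℕ (suc k)) x) ∎

  -- Both expansions contain the corner term of row 0 and column `i`. For the rest, the minors on
  -- the left are expanded along column `i` by induction and those on the right along their first
  -- row; the resulting double sums over rows and columns agree term by term.
  det-column : ∀ {n} (A : Fin (suc n) → Fin (suc n) → Carrier) i →
    det A ≈ sum λ j → sign (toℕ i) (sign (toℕ j) (A j i * det (minor j i A)))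
  det-column {zero}  A zero = refl
  det-column {suc n} A i = begin
    det A
      ≈⟨ sum-remove {i = i} (laplace A) ⟩
    corner + sum (λ k → laplace A (punchIn i k))
      ≈⟨ +-congˡ (sum-cong-≋ first) ⟩
    corner + sum (λ k → sum (signed k))
      ≈⟨ +-congˡ (trans (∑-comm signed) (sum-cong-≋ λ j → sym (rest j))) ⟩
    corner + sum (λ j → sign (toℕ i) (sign (toℕ (suc j)) (A (suc j) i * det (minor (suc j) i A)))) ∎
    where
    corner : Carrier
    corner = sign (toℕ i) (A zero i * det (minor zero i A))

    term : Fin (suc n) → Fin (suc n) → Carrier
    term k j = A (suc j) i *
      (A zero (punchIn i k) * det (λ a b → A (suc (punchIn j a)) (punchIn i (punchIn k b))))

    entry : ∀ k j →
      A zero (punchIn i k) * (A (suc j) (punchIn (punchIn i k) (punchBack i k)) *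
        det (λ a b → A (suc (punchIn j a)) (punchIn (punchIn i k) (punchIn (punchBack i k) b)))) ≈ term k j
    entry k j = trans (*-congˡ (*-cong (reflexive (≡.cong (A (suc j)) (punchIn-punchBack i k)))
      (det-cong λ a b → reflexive (≡.cong (A (suc (punchIn j a))) (punchIn-comm i k b)))))
      (solve 3 (λ x y z → x :* (y :* z) := y :* (x :* z)) refl _ (A (suc j) i) _)

    signed : Fin (suc n) → Fin (suc n) → Carrier
    signed k j = sign (suc (toℕ i)) (sign (toℕ k) (sign (toℕ j) (term k j)))

    first : ∀ k → laplace A (punchIn i k) ≈ sum (signed k)
    first k = begin
      sign p (a * det N)
        ≈⟨ sign-cong p (*-congˡ (det-column N b)) ⟩
      sign p (a * sum column)
        ≈⟨ sign-cong p (*-distribˡ-sum a column) ⟩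
      sign p (sum λ j → a * column j)
        ≈⟨ sign-sum p (λ j → a * column j) ⟩
      (sum λ j → sign p (a * column j))
        ≈⟨ sum-cong-≋ (λ j → trans
             (sign-cong p (trans (sym (sign-*ʳ (toℕ b) a _)) (sign-cong (toℕ b) (sym (sign-*ʳ (toℕ j) a _)))))
             (trans (sign-punch i k _)
               (sign-cong (suc (toℕ i)) (sign-cong (toℕ k) (sign-cong (toℕ j) (entry k j)))))) ⟩
      sum (signed k) ∎
      where
      p : ℕ
      p = toℕ (punchIn i k)
      b : Fin (suc n)
      b = punchBack i k
      a : Carrier
      a = A zero (punchIn i k)
      N : Fin (suc n) → Fin (suc n) → Carrier
      N = minor zero (punchIn i k) A
      column : Fin (suc n) → Carrier
      column j = sign (toℕ b) (sign (toℕ j) (N j b * det (minor j b N)))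

    rest : ∀ j → sign (toℕ i) (sign (toℕ (suc j)) (A (suc j) i * det (minor (suc j) i A))) ≈
                 sum λ k → signed k j
    rest j = begin
      sign (toℕ i) (- sign (toℕ j) (a * det N))
        ≈⟨ reflexive (sign-neg (toℕ i) _) ⟩
      sign (suc (toℕ i)) (sign (toℕ j) (a * det N))
        ≈⟨ sign-cong (suc (toℕ i)) (sign-cong (toℕ j) (*-distribˡ-sum a (laplace N))) ⟩
      sign (suc (toℕ i)) (sign (toℕ j) (sum λ k → a * laplace N k))
        ≈⟨ sign-cong (suc (toℕ i)) (sign-sum (toℕ j) (λ k → a * laplace N k)) ⟩
      sign (suc (toℕ i)) (sum λ k → sign (toℕ j) (a * laplace N k))
        ≈⟨ sign-sum (suc (toℕ i)) (λ k → sign (toℕ j) (a * laplace N k)) ⟩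
      (sum λ k → sign (suc (toℕ i)) (sign (toℕ j) (a * laplace N k)))
        ≈⟨ sum-cong-≋ (λ k → sign-cong (suc (toℕ i)) (trans
             (sign-cong (toℕ j) (sym (sign-*ʳ (toℕ k) a (N zero k * det (minor zero k N)))))
             (reflexive (sign-comm (toℕ j) (toℕ k) _)))) ⟩
      (sum λ k → signed k j) ∎
      where
      a : Carrier
      a = A (suc j) i
      N : Fin (suc n) → Fin (suc n) → Carrier
      N = minor (suc j) i A

  -- In the expansion along column 0 the first two terms cancel, and every other minor still
  -- contains the two equal rows, so induction applies to it.
  det-equal-rows : ∀ {n} (A : Fin (suc (suc n)) → Fin (suc (suc n)) → Carrier) →
    (∀ j → A zero j ≈ A (suc zero) j) → det A ≈ 0#
  det-equal-rows {n} A p = trans (det-column A zero) (begin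
    t zero + (t (suc zero) + sum (λ j → t (suc (suc j))))
      ≈⟨ +-congˡ (+-congˡ (sum-zero (high A p))) ⟩
    t zero + (- (A (suc zero) zero * det (minor (suc zero) zero A)) + 0#)
      ≈⟨ +-cong (*-cong (p zero) (det-cong swap)) (+-identityʳ _) ⟩
    A (suc zero) zero * det (minor (suc zero) zero A) - A (suc zero) zero * det (minor (suc zero) zero A)
      ≈⟨ -‿inverseʳ _ ⟩
    0# ∎)
    where
    t : Fin (suc (suc n)) → Carrier
    t j = sign (toℕ j) (A j zero * det (minor j zero A))

    swap : ∀ i j → minor zero zero A i j ≈ minor (suc zero) zero A i j
    swap zero    j = sym (p (suc j))
    swap (suc i) j = refl

    high : ∀ {n} (A : Fin (suc (suc n)) → Fin (suc (suc n)) → Carrier) →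
      (∀ j → A zero j ≈ A (suc zero) j) →
      ∀ j → sign (toℕ (suc (suc j))) (A (suc (suc j)) zero * det (minor (suc (suc j)) zero A)) ≈ 0#
    high {suc n} A p j = trans (sign-cong (toℕ (suc (suc j)))
      (trans (*-congˡ (det-equal-rows (minor (suc (suc j)) zero A) (λ k → p (suc k)))) (zeroʳ _)))
      (sign-0 (toℕ (suc (suc j))))

  -- The subtractions are simultaneous: each row loses a multiple of the original preceding row, not
  -- of the modified one.
  subtractRows : ∀ {n} → Carrier → (Fin n → Fin n → Carrier) → Fin n → Fin n → Carrier
  subtractRows s A zero    c = A zero c
  subtractRows s A (suc i) c = A (suc i) c - s * A (inject₁ i) c

  -- Linearity in row 1 splits off a multiple of det `B`, which vanishes because `B` begins with two
  -- equal rows. The remaining minors along row 0 are of the form `subtractRows s M`, so induction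
  -- applies to them.
  det-subtractRows : ∀ {n} s (A : Fin n → Fin n → Carrier) → det (subtractRows s A) ≈ det A
  det-subtractRows {zero}        s A = refl
  det-subtractRows {suc zero}    s A = refl
  det-subtractRows {suc (suc n)} s A = begin
    det (subtractRows s A)
      ≈⟨ sum-split (laplace (subtractRows s A)) (laplace A) (laplace B) (λ j → laplace-split (toℕ j) (split (det-subtractRows s) j)) ⟩
    det A + - s * det B
      ≈⟨ +-congˡ (trans (*-congˡ (det-equal-rows B (λ _ → refl))) (zeroʳ (- s))) ⟩
    det A + 0#
      ≈⟨ +-identityʳ _ ⟩
    det A ∎
    where
    -- The row 0 of A twice, followed by the rows A_i - s A_{i-1} for i ≥ 2.
    B : Fin (suc (suc n)) → Fin (suc (suc n)) → Carrier
    B zero          = A zero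
    B (suc zero)    = A zero
    B (suc (suc i)) = subtractRows s A (suc (suc i))

    sum-split : ∀ {n} (f g h : Fin n → Carrier) → (∀ j → f j ≈ g j + - s * h j) →
                sum f ≈ sum g + - s * sum h
    sum-split f g h p = trans (sum-cong-≋ p)
      (trans (∑-distrib-+ g (λ j → - s * h j)) (+-congˡ (sym (*-distribˡ-sum (- s) h))))

    laplace-split : ∀ k {a x y z} → x ≈ y + - s * z →
      sign k (a * x) ≈ sign k (a * y) + - s * sign k (a * z)
    laplace-split k {a} {x} {y} {z} p = trans
      (sign-cong k (trans (*-congˡ p) (solve 4 (λ a y z s → a :* (y :+ s :* z) := a :* y :+ s :* (a :* z))
        refl a y z (- s))))
      (trans (sign-+ k _ _) (+-congˡ (sign-*ʳ k (- s) (a * z))))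

    split : (∀ M → det (subtractRows s M) ≈ det M) → ∀ j → det (minor zero j (subtractRows s A)) ≈ det (minor zero j A) + - s * det (minor zero j B)
    split ih j = trans
      (sum-split (laplace (minor zero j (subtractRows s A))) (laplace (subtractRows s M)) (laplace (minor zero j B)) step)
      (+-congʳ (ih M))
      where
      M : Fin (suc n) → Fin (suc n) → Carrier
      M = minor zero j A

      step : ∀ k → laplace (minor zero j (subtractRows s A)) k ≈
                   laplace (subtractRows s M) k + - s * laplace (minor zero j B) k
      step k = trans
        (sign-cong (toℕ k) (trans (*-congʳ (+-congˡ (-‿distribˡ-* s _)))
          (solve 4 (λ a b d s → (a :+ s :* b) :* d := a :* d :+ s :* (b :* d))
            refl (A (suc zero) (punchIn j k)) (A zero (punchIn j k))
            (det (minor zero k (minor zero j (subtractRows s A)))) (- s))))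
        (trans (sign-+ (toℕ k) _ _) (+-congˡ (sign-*ʳ (toℕ k) (- s) (A zero (punchIn j k) *
          det (minor zero k (minor zero j (subtractRows s A)))))))

  ∏ : ∀ {n} → Vec Carrier n → Carrier
  ∏ = Vec.foldr _ _*_ 1#

  vandermonde : ∀ {n} → Vec Carrier n → Carrier
  vandermonde []       = 1#
  vandermonde (x ∷ xs) = ∏ (Vec.map (_- x) xs) * vandermonde xs

  det-scaleColumns : ∀ {n} (s : Vec Carrier n) (A : Fin n → Fin n → Carrier) →
    det (λ i j → lookup s j * A i j) ≈ ∏ s * det A
  det-scaleColumns []      A = sym (*-identityˡ _)
  det-scaleColumns (x ∷ s) A = begin
    det (λ i j → lookup (x ∷ s) j * A i j)
      ≈⟨ det-column (λ i j → lookup (x ∷ s) j * A i j) zero ⟩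
    (sum λ i → sign (toℕ i) (x * A i zero * det (λ k l → lookup s l * minor i zero A k l)))
      ≈⟨ sum-cong-≋ (λ i → trans (sign-cong (toℕ i) (trans (*-congˡ (det-scaleColumns s (minor i zero A)))
           (solve 4 (λ x a p d → x :* a :* (p :* d) := x :* p :* (a :* d)) refl x (A i zero) (∏ s) _)))
           (sign-*ʳ (toℕ i) _ _)) ⟩
    (sum λ i → x * ∏ s * sign (toℕ i) (A i zero * det (minor i zero A)))
      ≈⟨ *-distribˡ-sum (x * ∏ s) (λ i → sign (toℕ i) (A i zero * det (minor i zero A))) ⟨
    x * ∏ s * (sum λ i → sign (toℕ i) (A i zero * det (minor i zero A)))
      ≈⟨ *-congˡ (det-column A zero) ⟨
    x * ∏ s * det A ∎

  -- Subtracting `x` times the preceding row turns the column of `x` into (1, 0, ..., 0) and leaves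
  -- (y - x) y^i in the column of any other point `y`; the factors y - x come out by columns.
  det-vandermonde : ∀ {n} (xs : Vec Carrier n) →
    det (λ i j → lookup xs j ^ toℕ i) ≈ vandermonde xs
  det-vandermonde []       = refl
  det-vandermonde {suc n} (x ∷ xs) = begin
    det V
      ≈⟨ det-subtractRows x V ⟨
    det W
      ≈⟨ det-column W zero ⟩
    1# * det (minor zero zero W) + sum (λ i → - sign (toℕ i) (W (suc i) zero * det (minor (suc i) zero W)))
      ≈⟨ +-cong (*-identityˡ _) (sum-zero λ i → trans (sign-cong (suc (toℕ i)) (trans (*-congʳ (clear i)) (zeroˡ _)))
           (sign-0 (suc (toℕ i)))) ⟩
    det (minor zero zero W) + 0#
      ≈⟨ +-identityʳ _ ⟩
    det (minor zero zero W)
      ≈⟨ det-cong (λ i j → trans (factor x (lookup xs j) i)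
           (*-congʳ (reflexive (≡.sym (Vecₚ.lookup-map j (_- x) xs))))) ⟩
    det (λ i j → lookup (Vec.map (_- x) xs) j * lookup xs j ^ toℕ i)
      ≈⟨ det-scaleColumns (Vec.map (_- x) xs) _ ⟩
    ∏ (Vec.map (_- x) xs) * det (λ i j → lookup xs j ^ toℕ i)
      ≈⟨ *-congˡ (det-vandermonde xs) ⟩
    vandermonde (x ∷ xs) ∎
    where
    V W : Fin (suc n) → Fin (suc n) → Carrier
    V i j = lookup (x ∷ xs) j ^ toℕ i
    W = subtractRows x V

    clear : ∀ i → W (suc i) zero ≈ 0#
    clear i = trans (+-congˡ (-‿cong (*-congˡ (reflexive (≡.cong (x ^_) (Finₚ.toℕ-inject₁ i)))))) (-‿inverseʳ _)

    factor : ∀ x y {n} (i : Fin n) → y ^ toℕ (suc i) - x * y ^ toℕ (inject₁ i) ≈ (y - x) * y ^ toℕ i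
    factor x y i = begin
      y * y ^ toℕ i - x * y ^ toℕ (inject₁ i)  ≈⟨ +-congˡ (-‿cong (*-congˡ (reflexive (≡.cong (y ^_) (Finₚ.toℕ-inject₁ i))))) ⟩
      y * y ^ toℕ i - x * y ^ toℕ i            ≈⟨ +-congˡ (-‿distribˡ-* x _) ⟩
      y * y ^ toℕ i + - x * y ^ toℕ i          ≈⟨ distribʳ _ _ _ ⟨
      (y - x) * y ^ toℕ i                      ∎

  ∏-++ : ∀ {m n} (xs : Vec Carrier m) (ys : Vec Carrier n) → ∏ (xs ++ ys) ≈ ∏ xs * ∏ ys
  ∏-++ []       ys = sym (*-identityˡ _)
  ∏-++ (x ∷ xs) ys = trans (*-congˡ (∏-++ xs ys)) (sym (*-assoc _ _ _))

  differences : ∀ {m n} → Vec Carrier m → Vec Carrier n → Carrier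
  differences []       ys = 1#
  differences (x ∷ xs) ys = ∏ (Vec.map (_- x) ys) * differences xs ys

  vandermonde-++ : ∀ {m n} (xs : Vec Carrier m) (ys : Vec Carrier n) →
    vandermonde (xs ++ ys) ≈ vandermonde xs * vandermonde ys * differences xs ys
  vandermonde-++ []       ys = sym (trans (*-identityʳ _) (*-identityˡ _))
  vandermonde-++ (x ∷ xs) ys = begin
    ∏ (Vec.map (_- x) (xs ++ ys)) * vandermonde (xs ++ ys)
      ≈⟨ *-cong (trans (reflexive (≡.cong ∏ (Vecₚ.map-++ (_- x) xs ys))) (∏-++ (Vec.map (_- x) xs) _)) (vandermonde-++ xs ys) ⟩
    ∏ (Vec.map (_- x) xs) * ∏ (Vec.map (_- x) ys) * (vandermonde xs * vandermonde ys * differences xs ys)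
      ≈⟨ solve 5 (λ a b c d e → a :* b :* (c :* d :* e) := a :* c :* d :* (b :* e)) refl _ _ _ _ _ ⟩
    ∏ (Vec.map (_- x) xs) * vandermonde xs * vandermonde ys * (∏ (Vec.map (_- x) ys) * differences xs ys) ∎

-- Forms in several variables, polynomials in one variable, interpolation.

module Univariate {c ℓ} (R : CommutativeRing c ℓ) where

  open CommutativeRing R hiding (zero)
  open RingProperties ring using (-‿distribˡ-*; -‿distribʳ-*; -‿involutive; -‿+-comm)
  open SemiringSum semiring using (sum; sum-cong-≋)
  open NaturalCoefficientsSolver commutativeSemiring using (solve; _:=_; _:+_; _:*_)
  open SemiringExp semiring using (_^_; ^-assocʳ)
  open CommutativeSemigroupProperties *-commutativeSemigroup using () renaming (interchange to *-interchange)
  open CommutativeSemigroupProperties +-commutativeSemigroup using () renaming (interchange to +-interchange)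
  open SetoidReasoning setoid
  open Determinants R using (∏; ∏-++; differences)

  dot : ∀ {n} → Vec Carrier n → Vec Carrier n → Carrier
  dot []       []       = 0#
  dot (a ∷ as) (b ∷ bs) = a * b + dot as bs

  dot-sum : ∀ {n} (a b : Vec Carrier n) → dot a b ≈ sum λ i → lookup a i * lookup b i
  dot-sum []       []       = refl
  dot-sum (a ∷ as) (b ∷ bs) = +-congˡ (dot-sum as bs)

  dot-++ : ∀ {m n} (a b : Vec Carrier m) (a′ b′ : Vec Carrier n) →
    dot (a ++ a′) (b ++ b′) ≈ dot a b + dot a′ b′
  dot-++ []      []      a′ b′ = sym (+-identityˡ _)
  dot-++ (x ∷ a) (y ∷ b) a′ b′ = trans (+-congˡ (dot-++ a b a′ b′)) (sym (+-assoc _ _ _))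

  dot-scaleˡ : ∀ {n} s (a b : Vec Carrier n) → dot (Vec.map (s *_) a) b ≈ s * dot a b
  dot-scaleˡ s []      []      = sym (zeroʳ s)
  dot-scaleˡ s (x ∷ a) (y ∷ b) = trans (+-cong (*-assoc s x y) (dot-scaleˡ s a b)) (sym (distribˡ s _ _))

  dot-scaleʳ : ∀ {n} s (a b : Vec Carrier n) → dot a (Vec.map (s *_) b) ≈ s * dot a b
  dot-scaleʳ s []      []      = sym (zeroʳ s)
  dot-scaleʳ s (x ∷ a) (y ∷ b) = trans
    (+-cong (solve 3 (λ s x y → x :* (s :* y) := s :* (x :* y)) refl s x y) (dot-scaleʳ s a b)) (sym (distribˡ s _ _))

  dot-+ʳ : ∀ {n} (a b b′ : Vec Carrier n) → dot a (Vec.zipWith _+_ b b′) ≈ dot a b + dot a b′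
  dot-+ʳ []      []      []        = sym (+-identityˡ _)
  dot-+ʳ (x ∷ a) (y ∷ b) (y′ ∷ b′) = trans (+-cong (distribˡ x y y′) (dot-+ʳ a b b′)) (+-interchange _ _ _ _)

  dot-0ʳ : ∀ {n} (a : Vec Carrier n) → dot a (Vec.replicate n 0#) ≈ 0#
  dot-0ʳ []      = refl
  dot-0ʳ (x ∷ a) = trans (+-cong (zeroʳ x) (dot-0ʳ a)) (+-identityˡ _)

  monomials : ∀ s v → Vec Carrier s → Vec Carrier (#monomials s v)
  monomials s       zero    g       = 1# ∷ []
  monomials zero    (suc v) g       = []
  monomials (suc s) (suc v) (x ∷ g) = monomials s (suc v) g ++ Vec.map (x *_) (monomials (suc s) v (x ∷ g))

  -- The coefficients do not depend on `g`. This is what later separates two groups of points: `g`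
  -- is computed from one group and the coefficients from the other.
  record Form (s v : ℕ) (F : Vec Carrier s → Carrier) : Set (c ⊔ ℓ) where
    constructor form
    field
      coefficients : Vec Carrier (#monomials s v)
      expansion    : ∀ g → F g ≈ dot (monomials s v g) coefficients

  open Form public

  form-+ : ∀ {s v F G} → Form s v F → Form s v G → Form s v (λ g → F g + G g)
  form-+ {s} {v} (form y p) (form z q) = form (Vec.zipWith _+_ y z) λ g → trans (+-cong (p g) (q g)) (sym (dot-+ʳ (monomials s v g) y z))

  form-0 : ∀ {s v} → Form s v (λ _ → 0#)
  form-0 {s} {v} = form (Vec.replicate _ 0#) λ g → sym (dot-0ʳ (monomials s v g))

  form-scale : ∀ {s v F} a → Form s v F → Form s v (λ g → a * F g)
  form-scale {s} {v} a (form y p) = form (Vec.map (a *_) y) λ g → trans (*-congˡ (p g)) (sym (dot-scaleʳ a (monomials s v g) y))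

  form-cong : ∀ {s v F G} → (∀ g → G g ≈ F g) → Form s v F → Form s v G
  form-cong F≈G (form y p) = form y λ g → trans (F≈G g) (p g)

  form-head : ∀ {s v F} → Form (suc s) v F → Form (suc s) (suc v) (λ g → Vec.head g * F g)
  form-head {s} {v} (form y p) = form (Vec.replicate _ 0# ++ y) λ { (x ∷ g) → sym (trans
    (dot-++ (monomials s (suc v) g) _ _ y)
    (trans (+-cong (dot-0ʳ (monomials s (suc v) g)) (dot-scaleˡ x (monomials (suc s) v (x ∷ g)) y)) (trans (+-identityˡ _) (*-congˡ (sym (p (x ∷ g))))))) }

  form-tail : ∀ {s v F} → Form s v F → Form (suc s) v (F ∘ Vec.tail)
  form-tail {s} {zero}  (form y p) = form y λ { (x ∷ g) → p g }
  form-tail {s} {suc v} (form y p) = form (y ++ Vec.replicate _ 0#) λ { (x ∷ g) → sym (trans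
    (dot-++ (monomials s (suc v) g) y _ _)
    (trans (+-congˡ (dot-0ʳ (Vec.map (x *_) (monomials (suc s) v (x ∷ g))))) (trans (+-identityʳ _) (sym (p g))))) }

  -- For `suc k` the coefficients split, like `monomials`, into those without the first variable and
  -- those of its multiples. Variable `k` multiplies each block by recursion, and `form-tail` and
  -- `form-head` put the blocks back in place.
  form-variable : ∀ {s v F} k → Form s v F → Form s (suc v) (λ g → lookup g k * F g)
  form-variable {v = zero} zero f = form-cong (λ { (x ∷ g) → refl }) (form-head f)
  form-variable {v = suc v} zero f = form-cong (λ { (x ∷ g) → refl }) (form-head f)
  form-variable {suc s} {zero} (suc k) (form y p) = form-cong
    (λ { (x ∷ g) → *-congˡ (p (x ∷ g)) }) (form-tail (form-variable {s} {zero} k (form y λ g → refl)))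
  form-variable {suc s} {suc v} (suc k) (form y p) with Vec.splitAt (#monomials s (suc v)) y
  ... | y₁ , y₂ , ≡.refl = form-cong
    (λ { (x ∷ g) → trans (*-congˡ (trans (p (x ∷ g)) (trans (dot-++ (monomials s (suc v) g) y₁ _ y₂)
           (+-congˡ (dot-scaleˡ x (monomials (suc s) v (x ∷ g)) y₂)))))
         (solve 4 (λ l a x b → l :* (a :+ x :* b) := l :* a :+ x :* (l :* b)) refl _ _ _ _) })
    (form-+ (form-tail (form-variable {s} {suc v} k (form y₁ λ g → refl)))
            (form-head (form-variable {suc s} {v} (suc k) (form y₂ λ g → refl))))

  form-sum : ∀ {s v n} (F : Fin n → Vec Carrier s → Carrier) →
    (∀ k → Form s v (F k)) → Form s v (λ g → sum λ k → F k g)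
  form-sum {n = zero}  F p = form-0
  form-sum {n = suc n} F p = form-+ (p zero) (form-sum (F ∘ suc) (p ∘ suc))

  form-∏ : ∀ {s v} (zs : Vec (Vec Carrier s) v) → Form s v (λ g → ∏ (Vec.map (dot g) zs))
  form-∏ []       = form (1# ∷ []) λ g → sym (trans (+-identityʳ _) (*-identityˡ _))
  form-∏ (z ∷ zs) = form-cong
    (λ g → trans (*-congʳ (dot-sum g z)) (trans (*-distribʳ-sum _ (λ k → lookup g k * lookup z k))
      (sum-cong-≋ (λ k → pull (lookup g k) (lookup z k) (∏ (Vec.map (dot g) zs))))))
    (form-sum (λ k g → lookup z k * (lookup g k * ∏ (Vec.map (dot g) zs)))
      (λ k → form-scale (lookup z k) (form-variable k (form-∏ zs))))
    where
    open SemiringSum semiring using (*-distribʳ-sum)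
    pull : ∀ a b c → a * b * c ≈ b * (a * c)
    pull = solve 3 (λ a b c → a :* b :* c := b :* (a :* c)) refl

  powers : ∀ n → Carrier → Vec Carrier n
  powers zero    x = []
  powers (suc n) x = 1# ∷ Vec.map (x *_) (powers n x)

  lookup-powers : ∀ {n} x (i : Fin n) → lookup (powers n x) i ≈ x ^ toℕ i
  lookup-powers x zero    = refl
  lookup-powers {suc n} x (suc i) = trans (reflexive (Vecₚ.lookup-map i (x *_) (powers n x))) (*-congˡ (lookup-powers x i))

  evaluate : ∀ {n} → Vec Carrier n → Carrier → Carrier
  evaluate {n} p x = dot p (powers n x)

  -- Multiplies p by X - r and adds the constant c.
  timesLinear : ∀ {n} → Carrier → Carrier → Vec Carrier n → Vec Carrier (suc n)
  timesLinear r c []      = c ∷ []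
  timesLinear r c (a ∷ p) = (c - r * a) ∷ timesLinear r a p

  evaluate-timesLinear : ∀ {n} r c (p : Vec Carrier n) x →
    evaluate (timesLinear r c p) x ≈ c + (x - r) * evaluate p x
  evaluate-timesLinear r c []      x = trans (+-cong (*-identityʳ c) refl) (+-congˡ (sym (zeroʳ _)))
  evaluate-timesLinear {suc n} r c (a ∷ p) x = begin
    (c - r * a) * 1# + dot (timesLinear r a p) (Vec.map (x *_) (powers (suc n) x))
      ≈⟨ +-cong (*-identityʳ _) (dot-scaleʳ x (timesLinear r a p) (powers (suc n) x)) ⟩
    (c - r * a) + x * evaluate (timesLinear r a p) x
      ≈⟨ +-cong (+-congˡ (-‿distribˡ-* r a)) (*-congˡ (evaluate-timesLinear r a p x)) ⟩
    (c + - r * a) + x * (a + (x - r) * e)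
      ≈⟨ solve 5 (λ c r a x e → c :+ r :* a :+ x :* (a :+ (x :+ r) :* e) := c :+ (x :+ r) :* (a :+ x :* e))
           refl c (- r) a x e ⟩
    c + (x - r) * (a + x * e)
      ≈⟨ +-congˡ (*-congˡ (+-cong (*-identityʳ a) (dot-scaleʳ x p (powers n x)))) ⟨
    c + (x - r) * evaluate (a ∷ p) x ∎
    where
    e : Carrier
    e = evaluate p x

  fromRoots : ∀ {n} → Vec Carrier n → Vec Carrier (suc n)
  fromRoots []       = 1# ∷ []
  fromRoots (r ∷ rs) = timesLinear r 0# (fromRoots rs)

  evaluate-fromRoots : ∀ {n} (rs : Vec Carrier n) x →
    evaluate (fromRoots rs) x ≈ ∏ (Vec.map (λ r → x - r) rs)
  evaluate-fromRoots []       x = trans (+-identityʳ _) (*-identityˡ _)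
  evaluate-fromRoots (r ∷ rs) x = trans (evaluate-timesLinear r 0# (fromRoots rs) x)
    (trans (+-identityˡ _) (*-congˡ (evaluate-fromRoots rs x)))

  ∏-cong : ∀ {a} {A : Set a} {n} {f g : A → Carrier} → (∀ x → f x ≈ g x) → (xs : Vec A n) → ∏ (Vec.map f xs) ≈ ∏ (Vec.map g xs)
  ∏-cong p []       = refl
  ∏-cong p (x ∷ xs) = *-cong (p x) (∏-cong p xs)

  ∏-* : ∀ {a} {A : Set a} {n} (f g : A → Carrier) (xs : Vec A n) →
    ∏ (Vec.map f xs) * ∏ (Vec.map g xs) ≈ ∏ (Vec.map (λ x → f x * g x) xs)
  ∏-* f g []       = *-identityˡ _
  ∏-* f g (x ∷ xs) = trans (*-interchange _ _ _ _) (*-congˡ (∏-* f g xs))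

  ∏-1 : ∀ {a} {A : Set a} {n} (xs : Vec A n) → ∏ (Vec.map (λ _ → 1#) xs) ≈ 1#
  ∏-1 []       = refl
  ∏-1 (x ∷ xs) = trans (*-identityˡ _) (∏-1 xs)

  evaluate-double : ∀ {n} (rs : Vec Carrier n) x →
    evaluate (fromRoots (rs ++ rs)) x ≈ ∏ (Vec.map (λ r → x - r) rs) * ∏ (Vec.map (λ r → x - r) rs)
  evaluate-double rs x = trans (evaluate-fromRoots (rs ++ rs) x)
    (trans (reflexive (≡.cong ∏ (Vecₚ.map-++ (λ r → x - r) rs rs))) (∏-++ (Vec.map (λ r → x - r) rs) _))

  differences² : ∀ {m n} → Vec Carrier m → Vec Carrier n → Carrier
  differences² ys xs = differences ys xs * differences ys xs

  square-swap : ∀ x y → (x - y) * (x - y) ≈ (y - x) * (y - x)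
  square-swap x y = begin
    (x - y) * (x - y)        ≈⟨ *-cong flip flip ⟩
    - (y - x) * - (y - x)    ≈⟨ -‿distribˡ-* (y - x) (- (y - x)) ⟨
    - ((y - x) * - (y - x))  ≈⟨ -‿cong (-‿distribʳ-* (y - x) (y - x)) ⟨
    - - ((y - x) * (y - x))  ≈⟨ -‿involutive _ ⟩
    (y - x) * (y - x)        ∎
    where
    flip : x - y ≈ - (y - x)
    flip = sym (trans (sym (-‿+-comm y (- x))) (trans (+-comm _ _) (+-congʳ (-‿involutive x))))

  -- The factors of `differences` are x - y, those of the evaluation at y are y - x; squaring
  -- removes the sign, and this is why every root is taken twice.
  differences²-left : ∀ {m n} (ys : Vec Carrier m) (xs : Vec Carrier n) →
    differences² ys xs ≈ ∏ (Vec.map (evaluate (fromRoots (xs ++ xs))) ys)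
  differences²-left []       xs = *-identityˡ _
  differences²-left (y ∷ ys) xs = begin
    a * differences ys xs * (a * differences ys xs)
      ≈⟨ *-interchange _ _ _ _ ⟩
    a * a * differences² ys xs
      ≈⟨ *-cong (trans (∏-* (_- y) (_- y) xs) (trans (∏-cong (λ x → square-swap x y) xs)
           (trans (sym (∏-* (λ x → y - x) (λ x → y - x) xs)) (sym (evaluate-double xs y)))))
           (differences²-left ys xs) ⟩
    ∏ (Vec.map (evaluate (fromRoots (xs ++ xs))) (y ∷ ys)) ∎
    where
    a : Carrier
    a = ∏ (Vec.map (_- y) xs)

  differences²-right : ∀ {m n} (ys : Vec Carrier m) (xs : Vec Carrier n) →
    differences² ys xs ≈ ∏ (Vec.map (evaluate (fromRoots (ys ++ ys))) xs)
  differences²-right ys xs = trans (*-cong (swap ys) (swap ys)) (trans (∏-* _ _ xs)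
    (∏-cong (λ x → sym (evaluate-double ys x)) xs))
    where
    swap : ∀ {m} (ys : Vec Carrier m) → differences ys xs ≈ ∏ (Vec.map (λ x → ∏ (Vec.map (λ y → x - y) ys)) xs)
    swap []       = sym (∏-1 xs)
    swap (y ∷ ys) = trans (*-congˡ (swap ys)) (∏-* (_- y) _ xs)

  -- The variable is the coefficient vector `g`. At a fixed point, evaluation is linear in `g`, so
  -- `v` points give a product of `v` linear forms.
  ∏-evaluate-form : ∀ {s v} (ys : Vec Carrier v) →
    Form s v (λ g → ∏ (Vec.map (evaluate g) ys))
  ∏-evaluate-form {s} ys = form-cong
    (λ g → reflexive (≡.cong ∏ (Vecₚ.map-∘ (dot g) (powers s) ys))) (form-∏ (Vec.map (powers s) ys))

  Unit : Carrier → Set _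
  Unit x = ∃ λ y → x * y ≈ 1#

  ∏-unit : ∀ {a} {A : Set a} {n} (f : A → Carrier) (g : Fin n → A) → (∀ i → Unit (f (g i))) →
    Unit (∏ (Vec.map f (Vec.tabulate g)))
  ∏-unit {n = zero}  f g p = 1# , *-identityˡ 1#
  ∏-unit {n = suc n} f g p with p zero | ∏-unit f (g ∘ suc) (p ∘ suc)
  ... | y , q | z , r = y * z , trans (*-interchange _ _ _ _) (trans (*-cong q r) (*-identityˡ 1#))

  ∏-zero : ∀ {a} {A : Set a} {n} (f : A → Carrier) (g : Fin n → A) i → f (g i) ≈ 0# →
    ∏ (Vec.map f (Vec.tabulate g)) ≈ 0#
  ∏-zero f g zero    p = trans (*-congʳ p) (zeroˡ _)
  ∏-zero f g (suc i) p = trans (*-congˡ (∏-zero f (g ∘ suc) i p)) (zeroʳ _)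

  -- With the points b^p the Vandermonde matrix is symmetric, (b^p)^j = (b^j)^p,
  -- so the coefficients of the Lagrange polynomials at the nodes b^j invert it.
  module Interpolation (b : Carrier) (separated : ∀ i j → i ≢ j → Unit (b ^ i - b ^ j)) where

    node : ∀ {m} → Fin m → Carrier
    node k = b ^ toℕ k

    private
      roots : ∀ {n} → Fin (suc n) → Vec Carrier n
      roots k = Vec.tabulate (λ i → node (punchIn k i))

      value : ∀ {n} (k : Fin (suc n)) → Unit (∏ (Vec.map (λ r → node k - r) (roots k)))
      value k = ∏-unit _ _ λ i → separated (toℕ k) (toℕ (punchIn k i))
        λ eq → Finₚ.punchInᵢ≢i k i (≡.sym (Finₚ.toℕ-injective eq))

    lagrange : ∀ {m} → Fin m → Vec Carrier m
    lagrange {suc n} k = Vec.map (proj₁ (value k) *_) (fromRoots (roots k))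

    evaluate-lagrange : ∀ {n} (k : Fin (suc n)) x →
      evaluate (lagrange k) x ≈ proj₁ (value k) * ∏ (Vec.map (λ r → x - r) (roots k))
    evaluate-lagrange {n} k x = trans (dot-scaleˡ _ (fromRoots (roots k)) (powers (suc n) x))
      (*-congˡ (evaluate-fromRoots (roots k) x))

    lagrange-sum : ∀ {m} (k j : Fin m) →
      sum (λ p → lookup (lagrange k) p * node p ^ toℕ j) ≈ evaluate (lagrange k) (node j)
    lagrange-sum {m} k j = sym (trans (dot-sum (lagrange k) (powers m (node j)))
      (sum-cong-≋ λ p → *-congˡ {lookup (lagrange k) p} (begin
        lookup (powers m (node j)) p  ≈⟨ lookup-powers (node j) p ⟩
        (b ^ toℕ j) ^ toℕ p           ≈⟨ ^-assocʳ b (toℕ j) (toℕ p) ⟩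
        b ^ (toℕ j ℕ.* toℕ p)         ≈⟨ reflexive (≡.cong (b ^_) (ℕₚ.*-comm (toℕ j) (toℕ p))) ⟩
        b ^ (toℕ p ℕ.* toℕ j)         ≈⟨ ^-assocʳ b (toℕ p) (toℕ j) ⟨
        (b ^ toℕ p) ^ toℕ j           ∎)))

    lagrange-same : ∀ {m} (k : Fin m) → sum (λ p → lookup (lagrange k) p * node p ^ toℕ k) ≈ 1#
    lagrange-same {suc n} k = trans (lagrange-sum k k) (trans (evaluate-lagrange k (node k))
      (trans (*-comm _ _) (proj₂ (value k))))

    lagrange-different : ∀ {m} {k j : Fin m} → k ≢ j →
      sum (λ p → lookup (lagrange k) p * node p ^ toℕ j) ≈ 0#
    lagrange-different {suc n} {k} {j} k≢j = trans (lagrange-sum k j) (trans (evaluate-lagrange k (node j))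
      (trans (*-congˡ (∏-zero _ (λ i → node (punchIn k i)) (punchOut k≢j)
        (trans (+-congˡ (-‿cong (reflexive (≡.cong node (Finₚ.punchIn-punchOut k≢j))))) (-‿inverseʳ _)))) (zeroʳ _)))

-- Partial derivatives of the Hankel determinant.

module Derivatives {c ℓ} (K : CommutativeRing c ℓ) where

  open CommutativeRing K hiding (zero)
  open RingProperties ring using (-0#≈0#; -‿+-comm)
  open SemiringSum semiring using (sum; sum-cong-≋; sum-replicate-zero; *-distribˡ-sum; ∑-distrib-+)
  open CommutativeSemigroupProperties *-commutativeSemigroup using (x∙yz≈y∙xz)
  open Mult +-monoid using (×-congʳ) renaming (_×_ to _·_)
  open CommutativeMult +-commutativeMonoid using (×-distrib-+)
  open SetoidReasoning setoid
  module P = Polynomials K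
  open P using (Series; _≋_; _⊛_; var; monomial; ∂; ⊛≈0; sum≈0)

  0s : ∀ m → Vec ℕ m
  0s m = Vec.replicate m 0

  zero-⊛ : ∀ {m} (f : Series m) → (λ _ → 0#) ⊛ f ≋ (λ _ → 0#)
  zero-⊛ f α = ⊛≈0 _ f α λ β γ _ → zeroˡ _

  one-⊛ : ∀ {m} (f : Series m) → monomial (0s m) ⊛ f ≋ f
  one-⊛ f []      = *-identityˡ _
  one-⊛ f (n ∷ α) = trans
    (+-cong (one-⊛ (λ β → f (n ∷ β)) α) (sum≈0 {n} _ λ k → zero-⊛ _ α))
    (+-identityʳ _)

  var-⊛-updateAt : ∀ {m} (k : Fin m) f α → (var k ⊛ f) (updateAt α k suc) ≈ f α
  var-⊛-updateAt zero    f (n ∷ α) = trans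
    (+-cong (zero-⊛ _ α) (+-cong (one-⊛ (λ β → f (n ∷ β)) α) (sum≈0 {n} _ λ k → zero-⊛ _ α)))
    (trans (+-identityˡ _) (+-identityʳ _))
  var-⊛-updateAt (suc k) f (n ∷ α) = trans
    (+-cong (var-⊛-updateAt k (λ β → f (n ∷ β)) α) (sum≈0 {n} _ λ j → zero-⊛ (λ β → f (n ∸ suc (toℕ j) ∷ β)) (updateAt α k suc)))
    (+-identityʳ _)

  var-⊛-0 : ∀ {m} (k : Fin m) f α → lookup α k ≡ 0 → (var k ⊛ f) α ≈ 0#
  var-⊛-0 zero    f (zero ∷ α) p = trans (+-identityʳ _) (zero-⊛ _ α)
  var-⊛-0 (suc k) f (n ∷ α)    p = trans
    (+-cong (var-⊛-0 k (λ β → f (n ∷ β)) α p) (sum≈0 {n} _ λ k → zero-⊛ _ α))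
    (+-identityʳ _)

  δ : ∀ {m} → Fin m → Fin m → Carrier
  δ i k = if does (i Finₚ.≟ k) then 1# else 0#

  updateAt-pred : ∀ {m} (α : Vec ℕ m) k {n} → lookup α k ≡ suc n → updateAt (updateAt α k pred) k suc ≡ α
  updateAt-pred (suc n ∷ α) zero    p = ≡.refl
  updateAt-pred (n ∷ α)     (suc k) p = ≡.cong (n ∷_) (updateAt-pred α k p)

  -- Leibniz rule, read off on coefficients. Multiplication by `var k` shifts exponents, so the
  -- cases ask whether `i` is `k` and whether α_k is 0. For `i` equal to `k`, the multiple (α_i + 1)
  -- f_α is f_α, from the derivative of the variable, plus α_i f_α, from the derivative of `f`.
  ∂-var-⊛ : ∀ {m} (i k : Fin m) f α →
    ∂ i (var k ⊛ f) α ≈ δ i k * f α + (var k ⊛ ∂ i f) α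
  ∂-var-⊛ {m} i k f α with i Finₚ.≟ k | lookup α k in eq
  ... | yes ≡.refl | zero = trans (×-congʳ (suc (lookup α i)) (var-⊛-updateAt i f α))
    (trans (reflexive (≡.cong (λ n → suc n · f α) eq))
      (+-cong (sym (*-identityˡ _)) (sym (var-⊛-0 i (∂ i f) α eq))))
  ... | yes ≡.refl | suc n = trans (×-congʳ (suc (lookup α i)) (var-⊛-updateAt i f α))
    (+-cong (sym (*-identityˡ _)) (begin
      lookup α i · f α
        ≡⟨ ≡.cong₂ (λ j β → j · f β) (≡.trans (≡.cong (λ β → lookup β i) (≡.sym up)) (Vecₚ.lookup∘updateAt i α′)) (≡.sym up) ⟩
      ∂ i f α′
        ≈⟨ var-⊛-updateAt i (∂ i f) α′ ⟨
      (var i ⊛ ∂ i f) (updateAt α′ i suc)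
        ≡⟨ ≡.cong (var i ⊛ ∂ i f) up ⟩
      (var i ⊛ ∂ i f) α ∎))
    where
    α′ : Vec ℕ m
    α′ = updateAt α i pred
    up : updateAt α′ i suc ≡ α
    up = updateAt-pred α i eq
  ... | no i≢k | zero = trans
    (P.·≈0 (suc (lookup α i)) (var-⊛-0 k f (updateAt α i suc) (≡.trans (Vecₚ.lookup∘updateAt′ k i (i≢k ∘ ≡.sym) α) eq)))
    (sym (trans (+-cong (zeroˡ _) (var-⊛-0 k (∂ i f) α eq)) (+-identityˡ _)))
  ... | no i≢k | suc n = begin
      suc (lookup α i) · (var k ⊛ f) (updateAt α i suc)
        ≡⟨ ≡.cong₂ (λ j β → suc j · (var k ⊛ f) β)
             (≡.trans (≡.cong (λ β → lookup β i) (≡.sym up)) (Vecₚ.lookup∘updateAt′ i k i≢k α′))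
             (≡.trans (≡.cong (λ β → updateAt β i suc) (≡.sym up)) (Vecₚ.updateAt-commutes i k i≢k α′)) ⟩
      suc (lookup α′ i) · (var k ⊛ f) (updateAt (updateAt α′ i suc) k suc)
        ≈⟨ ×-congʳ (suc (lookup α′ i)) (var-⊛-updateAt k f (updateAt α′ i suc)) ⟩
      ∂ i f α′
        ≈⟨ var-⊛-updateAt k (∂ i f) α′ ⟨
      (var k ⊛ ∂ i f) (updateAt α′ k suc)
        ≡⟨ ≡.cong (var k ⊛ ∂ i f) up ⟩
      (var k ⊛ ∂ i f) α
        ≈⟨ trans (+-congʳ (zeroˡ _)) (+-identityˡ _) ⟨
      0# * f α + (var k ⊛ ∂ i f) α ∎
    where
    α′ : Vec ℕ m
    α′ = updateAt α k pred
    up : updateAt α′ k suc ≡ α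
    up = updateAt-pred α k eq

  -- Differentiation is along words instead of exponent vectors, because the Leibniz rule removes a
  -- single letter and each letter is later matched with a point of its own.
  D : ∀ {m n} → Vec (Fin m) n → Series m → Series m
  D []      f = f
  D (i ∷ w) f = ∂ i (D w f)

  ∂-cong : ∀ {m} (i : Fin m) {f g : Series m} → f ≋ g → ∂ i f ≋ ∂ i g
  ∂-cong i p α = ×-congʳ (suc (lookup α i)) (p (updateAt α i suc))

  ∂-+ : ∀ {m} (i : Fin m) (f g : Series m) → ∂ i (λ α → f α + g α) ≋ λ α → ∂ i f α + ∂ i g α
  ∂-+ i f g α = ×-distrib-+ _ _ (suc (lookup α i))

  ∂-0 : ∀ {m} (i : Fin m) → ∂ i (λ _ → 0#) ≋ λ _ → 0#
  ∂-0 i α = P.·≈0 (suc (lookup α i)) refl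

  ∂-neg : ∀ {m} (i : Fin m) (f : Series m) → ∂ i (λ α → - f α) ≋ λ α → - ∂ i f α
  ∂-neg i f α = go (suc (lookup α i))
    where
    go : ∀ n → n · (- f (updateAt α i suc)) ≈ - (n · f (updateAt α i suc))
    go zero    = sym -0#≈0#
    go (suc n) = trans (+-congˡ (go n)) (-‿+-comm _ _)

  ∂-scale : ∀ {m} (i : Fin m) a (f : Series m) → ∂ i (λ α → a * f α) ≋ λ α → a * ∂ i f α
  ∂-scale i a f α = go (suc (lookup α i))
    where
    go : ∀ n → n · (a * f (updateAt α i suc)) ≈ a * (n · f (updateAt α i suc))
    go zero    = sym (zeroʳ a)
    go (suc n) = trans (+-congˡ (go n)) (sym (distribˡ a _ _))

  ∂-sum : ∀ {m n} (i : Fin m) (a : Fin n → Carrier) (f : Fin n → Series m) →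
    ∂ i (λ α → sum λ j → a j * f j α) ≋ λ α → sum λ j → a j * ∂ i (f j) α
  ∂-sum {n = zero}  i a f α = ∂-0 i α
  ∂-sum {n = suc n} i a f α = trans (∂-+ i (λ α → a zero * f zero α) (λ α → sum λ j → a (suc j) * f (suc j) α) α)
    (+-cong (∂-scale i (a zero) (f zero) α) (∂-sum i (a ∘ suc) (f ∘ suc) α))

  -- A variable has no second derivatives, so at most one letter of the word acts on `var k` and all
  -- others act on `f`.
  D-var-⊛ : ∀ {m n} (w : Vec (Fin m) (suc n)) k (f : Series m) α →
    D w (var k ⊛ f) α ≈ sum (λ i → δ (lookup w i) k * D (removeAt w i) f α) + (var k ⊛ D w f) α
  D-var-⊛ (i ∷ [])        k f α = trans (∂-var-⊛ i k f α) (+-congʳ (sym (+-identityʳ _)))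
  D-var-⊛ {m} (i ∷ w@(_ ∷ _)) k f α = begin
    ∂ i (D w (var k ⊛ f)) α
      ≈⟨ ∂-cong i (D-var-⊛ w k f) α ⟩
    ∂ i (λ α → sum (λ j → a j * g j α) + (var k ⊛ D w f) α) α
      ≈⟨ ∂-+ i (λ α → sum (λ j → a j * g j α)) (var k ⊛ D w f) α ⟩
    ∂ i (λ α → sum (λ j → a j * g j α)) α + ∂ i (var k ⊛ D w f) α
      ≈⟨ +-cong (∂-sum i a g α) (∂-var-⊛ i k (D w f) α) ⟩
    s + (d + r)
      ≈⟨ +-assoc s d r ⟨
    s + d + r
      ≈⟨ +-congʳ (+-comm s d) ⟩
    d + s + r ∎
    where
    a : Fin _ → Carrier
    a j = δ (lookup w j) k
    g : Fin _ → Series m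
    g j = D (removeAt w j) f
    s d r : Carrier
    s = sum λ j → a j * ∂ i (g j) α
    d = δ i k * D w f α
    r = (var k ⊛ ∂ i (D w f)) α

  D-var-⊛-at-0 : ∀ {m n} (w : Vec (Fin m) (suc n)) k (f : Series m) →
    D w (var k ⊛ f) (0s m) ≈ sum (λ i → δ (lookup w i) k * D (removeAt w i) f (0s m))
  D-var-⊛-at-0 {m} w k f = trans (D-var-⊛ w k f (0s m))
    (trans (+-congˡ (var-⊛-0 k (D w f) (0s m) (Vecₚ.lookup-replicate k 0))) (+-identityʳ _))

  D-sum : ∀ {m n j} (w : Vec (Fin m) n) (t : Fin j → Series m) α →
    D w (RawMonoidDefinitions.sum (RawRing.+-rawMonoid (P.series-rawRing m)) t) α ≈ sum λ i → D w (t i) α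
  D-sum {j = zero}  w t α = go w α
    where
    go : ∀ {m n} (w : Vec (Fin m) n) → D w (λ _ → 0#) ≋ λ _ → 0#
    go []      α = refl
    go (i ∷ w) α = trans (∂-cong i (go w) α) (∂-0 i α)
  D-sum {m} {j = suc j} w t α = trans (go w (t zero) _ α) (+-congˡ (D-sum w (t ∘ suc) α))
    where
    go : ∀ {n} (w : Vec (Fin m) n) f g → D w (λ α → f α + g α) ≋ λ α → D w f α + D w g α
    go []      f g α = refl
    go (i ∷ w) f g α = trans (∂-cong i (go w f g) α) (∂-+ i (D w f) (D w g) α)

  open Determinants K

  D-sign : ∀ {m n} (w : Vec (Fin m) n) k (f : Series m) α → D w (P.sign k f) α ≈ sign k (D w f α)
  D-sign w zero    f α = refl
  D-sign w (suc k) f α = trans (go w (P.sign k f) α) (-‿cong (D-sign w k f α))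
    where
    go : ∀ {m n} (w : Vec (Fin m) n) f → D w (λ α → - f α) ≋ λ α → - D w f α
    go []      f α = refl
    go (i ∷ w) f α = trans (∂-cong i (go w f) α) (∂-neg i (D w f) α)

  -- Contraction of polarizations with moment vectors.

  module Contraction {m} (c : Fin m → Fin m → Carrier) (x : Fin m → Carrier) where

    open SemiringExp semiring using (_^_; ^-homo-*)
    open NaturalCoefficientsSolver commutativeSemiring using (solve; _:=_; _:*_)
    open SemiringSum semiring using (∑-comm; *-distribʳ-sum)

    -- The tensor product of the functionals `contract k`, one for each letter of the word. When
    -- these extract the coefficients of powers, `L` recovers a polarization from its values on
    -- moment vectors.
    L : ∀ {n} → Vec (Fin m) n → (Vec Carrier n → Carrier) → Carrier
    L []      F = F []
    L (k ∷ w) F = sum λ p → c k p * L w (λ xs → F (x p ∷ xs))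

    L-cong : ∀ {n} (w : Vec (Fin m) n) {F G} → (∀ xs → F xs ≈ G xs) → L w F ≈ L w G
    L-cong []      p = p []
    L-cong (k ∷ w) p = sum-cong-≋ λ q → *-congˡ (L-cong w λ xs → p (x q ∷ xs))

    L-+ : ∀ {n} (w : Vec (Fin m) n) F G → L w (λ xs → F xs + G xs) ≈ L w F + L w G
    L-+ []      F G = refl
    L-+ (k ∷ w) F G = trans
      (sum-cong-≋ λ p → trans (*-congˡ (L-+ w (λ xs → F (x p ∷ xs)) (λ xs → G (x p ∷ xs)))) (distribˡ (c k p) _ _))
      (∑-distrib-+ (λ p → c k p * L w (λ xs → F (x p ∷ xs))) (λ p → c k p * L w (λ xs → G (x p ∷ xs))))

    L-scale : ∀ {n} (w : Vec (Fin m) n) a F → L w (λ xs → a * F xs) ≈ a * L w F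
    L-scale []      a F = refl
    L-scale (k ∷ w) a F = trans
      (sum-cong-≋ λ p → trans (*-congˡ (L-scale w a (λ xs → F (x p ∷ xs)))) (x∙yz≈y∙xz (c k p) a _))
      (sym (*-distribˡ-sum a (λ p → c k p * L w (λ xs → F (x p ∷ xs)))))

    L-scaleʳ : ∀ {n} (w : Vec (Fin m) n) a F → L w (λ xs → F xs * a) ≈ L w F * a
    L-scaleʳ w a F = trans (L-cong w λ xs → *-comm (F xs) a) (trans (L-scale w a F) (*-comm a _))

    L-0 : ∀ {n} (w : Vec (Fin m) n) → L w (λ _ → 0#) ≈ 0#
    L-0 []      = refl
    L-0 (k ∷ w) = trans (sum-cong-≋ λ p → trans (*-congˡ (L-0 w)) (zeroʳ (c k p))) (sum-replicate-zero m)

    L-sum : ∀ {n j} (w : Vec (Fin m) n) (F : Fin j → Vec Carrier n → Carrier) →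
      L w (λ xs → sum λ i → F i xs) ≈ sum λ i → L w (F i)
    L-sum {j = zero}  w F = L-0 w
    L-sum {j = suc j} w F = trans (L-+ w (F zero) _) (+-congˡ (L-sum w (F ∘ suc)))

    L-sign : ∀ {n} (w : Vec (Fin m) n) k F → L w (λ xs → sign k (F xs)) ≈ sign k (L w F)
    L-sign w zero    F = refl
    L-sign w (suc k) F = trans (L-neg w (λ xs → sign k (F xs))) (-‿cong (L-sign w k F))
      where
      open RingProperties ring using (-1*x≈-x)
      L-neg : ∀ {n} (w : Vec (Fin m) n) F → L w (λ xs → - F xs) ≈ - L w F
      L-neg w F = trans (L-cong w λ xs → sym (-1*x≈-x (F xs))) (trans (L-scale w (- 1#) F) (-1*x≈-x _))

    L-++ : ∀ {n n′} (w : Vec (Fin m) n) (w′ : Vec (Fin m) n′) F →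
      L (w ++ w′) F ≈ L w (λ xs → L w′ (λ ys → F (xs ++ ys)))
    L-++ []      w′ F = refl
    L-++ (k ∷ w) w′ F = sum-cong-≋ λ p → *-congˡ (L-++ w w′ (λ xs → F (x p ∷ xs)))

    contract : Fin m → (Carrier → Carrier) → Carrier
    contract k f = sum λ p → c k p * f (x p)

    -- A tensor product of functionals is multiplicative on functions with separated variables. Read
    -- from right to left, it matches the removal of a letter by the Leibniz rule with the removal
    -- of a point.
    L-extract : ∀ {n} (w : Vec (Fin m) (suc n)) i (f : Carrier → Carrier) (G : Vec Carrier n → Carrier) →
      L w (λ xs → f (lookup xs i) * G (removeAt xs i)) ≈ contract (lookup w i) f * L (removeAt w i) G
    L-extract (k ∷ w) zero f G = trans
      (sum-cong-≋ λ p → trans (*-congˡ (L-scale w (f (x p)) G)) (sym (*-assoc (c k p) _ _)))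
      (sym (*-distribʳ-sum (L w G) (λ p → c k p * f (x p))))
    L-extract (k ∷ w@(_ ∷ _)) (suc i) f G = trans
      (sum-cong-≋ λ p → trans
        (*-congˡ (trans (L-cong w (λ xs → *-congˡ {f (lookup xs i)} (reflexive (≡.cong G (removeAt-∷ (x p) xs i))))) (L-extract w i f (λ xs → G (x p ∷ xs)))))
        (x∙yz≈y∙xz (c k p) _ _))
      (sym (*-distribˡ-sum (contract (lookup w i) f) (λ p → c k p * L (removeAt w i) (λ xs → G (x p ∷ xs)))))
      where
      removeAt-∷ : ∀ {n} y (xs : Vec Carrier (suc n)) i → removeAt (y ∷ xs) (suc i) ≡ y ∷ removeAt xs i
      removeAt-∷ y (_ ∷ _) i = ≡.refl

    lookup-removeAt : ∀ {n} (xs : Vec Carrier (suc n)) i j → lookup (removeAt xs i) j ≡ lookup xs (punchIn i j)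
    lookup-removeAt (x ∷ xs)         zero    j       = ≡.refl
    lookup-removeAt (x ∷ xs@(_ ∷ _)) (suc i) zero    = ≡.refl
    lookup-removeAt (x ∷ xs@(_ ∷ _)) (suc i) (suc j) = lookup-removeAt xs i j

    -- A generalized Vandermonde determinant. Arbitrary exponents are needed for induction: minors
    -- of a Hankel matrix need not be Hankel, but their entries keep indices of the form
    -- `ρ a + χ b`, and minors of alternants are alternants.
    alternant : ∀ {n} → (Fin n → ℕ) → Vec Carrier n → Carrier
    alternant ρ xs = det λ a l → lookup xs l ^ ρ a

    alternant-minor : ∀ {n} (ρ : Fin (suc n) → ℕ) xs j i →
      det (minor j i (λ a l → lookup xs l ^ ρ a)) ≈ alternant (ρ ∘ punchIn j) (removeAt xs i)
    alternant-minor ρ xs j i = det-cong λ a l →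
      reflexive (≡.cong (_^ ρ (punchIn j a)) (≡.sym (lookup-removeAt xs i l)))

    -- The first factor is expanded along row 0. In its term for the point `i`, the second factor is
    -- expanded along column `i`, so that both minors omit the same point and the two signs of `i`
    -- cancel.
    alternant-product : ∀ {n} (ρ χ : Fin (suc n) → ℕ) xs →
      alternant ρ xs * alternant χ xs ≈
      sum λ j → sum λ i → sign (toℕ j) (lookup xs i ^ (ρ zero ℕ.+ χ j) *
        (alternant (ρ ∘ suc) (removeAt xs i) * alternant (χ ∘ punchIn j) (removeAt xs i)))
    alternant-product {n} ρ χ xs = begin
      sum (laplace R) * det T
        ≈⟨ *-distribʳ-sum (det T) (laplace R) ⟩
      sum (λ i → laplace R i * det T)
        ≈⟨ sum-cong-≋ (λ i → trans (*-congˡ (det-column T i)) (*-distribˡ-sum (laplace R i) (column i))) ⟩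
      sum (λ i → sum λ j → laplace R i * column i j)
        ≈⟨ ∑-comm (λ i j → laplace R i * column i j) ⟩
      sum (λ j → sum λ i → laplace R i * column i j)
        ≈⟨ sum-cong-≋ (λ j → sum-cong-≋ (λ i → entry i j)) ⟩
      (sum λ j → sum λ i → sign (toℕ j) (term i j)) ∎
      where
      R T : Fin (suc n) → Fin (suc n) → Carrier
      R a l = lookup xs l ^ ρ a
      T a l = lookup xs l ^ χ a

      column term : Fin (suc n) → Fin (suc n) → Carrier
      column i j = sign (toℕ i) (sign (toℕ j) (T j i * det (minor j i T)))
      term i j = lookup xs i ^ (ρ zero ℕ.+ χ j) *
        (alternant (ρ ∘ suc) (removeAt xs i) * alternant (χ ∘ punchIn j) (removeAt xs i))

      pull : ∀ a b c d → a * b * (c * d) ≈ a * c * (b * d)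
      pull = solve 4 (λ a b c d → a :* b :* (c :* d) := a :* c :* (b :* d)) refl

      entry : ∀ i j → laplace R i * column i j ≈ sign (toℕ j) (term i j)
      entry i j = begin
        sign (toℕ i) r * sign (toℕ i) (sign (toℕ j) s)
          ≈⟨ sign-*ˡ (toℕ i) r _ ⟨
        sign (toℕ i) (r * sign (toℕ i) (sign (toℕ j) s))
          ≈⟨ sign-cong (toℕ i) (sign-*ʳ (toℕ i) r _) ⟨
        sign (toℕ i) (sign (toℕ i) (r * sign (toℕ j) s))
          ≈⟨ sign-self (toℕ i) _ ⟩
        r * sign (toℕ j) s
          ≈⟨ sign-*ʳ (toℕ j) r s ⟨
        sign (toℕ j) (r * s)
          ≈⟨ sign-cong (toℕ j) (trans (pull _ _ _ _) (*-cong (sym (^-homo-* (lookup xs i) (ρ zero) (χ j)))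
               (*-cong (alternant-minor ρ xs zero i) (alternant-minor χ xs j i)))) ⟩
        sign (toℕ j) (term i j) ∎
        where
        r s : Carrier
        r = R zero i * det (minor zero i R)
        s = T j i * det (minor j i T)

    module _ (interpolates : ∀ k j → contract k (_^ toℕ j) ≈ δ k j) where

      -- Repeated differentiation of the determinant is a permanent-like
      -- double expansion, and interpolation turns each Kronecker delta into
      -- a contraction of the product of an entry of each alternant.
      D-det : ∀ {n} (w : Vec (Fin m) n) (κ : Fin n → Fin n → Fin m) (ρ χ : Fin n → ℕ) →
        (∀ a b → toℕ (κ a b) ≡ ρ a ℕ.+ χ b) →
        D w (P.det λ a b → var (κ a b)) (0s m) ≈ L w (λ xs → alternant ρ xs * alternant χ xs)
      D-det [] κ ρ χ κ≡ = trans
        (reflexive (≡.cong (if_then 1# else 0#) (dec-true (Vecₚ.≡-dec ℕₚ._≟_ (0s m) (0s m)) ≡.refl)))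
        (sym (*-identityˡ 1#))
      D-det {suc n} w κ ρ χ κ≡ = begin
        D w (P.det A) (0s m)
          ≈⟨ D-sum w (λ j → P.sign (toℕ j) (var (κ zero j) ⊛ M j)) (0s m) ⟩
        sum (λ j → D w (P.sign (toℕ j) (var (κ zero j) ⊛ M j)) (0s m))
          ≈⟨ sum-cong-≋ row ⟩
        sum (λ j → sum λ i → L w (F j i))
          ≈⟨ sum-cong-≋ (λ j → L-sum w (F j)) ⟨
        sum (λ j → L w (λ xs → sum λ i → F j i xs))
          ≈⟨ L-sum w (λ j xs → sum λ i → F j i xs) ⟨
        L w (λ xs → sum λ j → sum λ i → F j i xs)
          ≈⟨ L-cong w (alternant-product ρ χ) ⟨
        L w (λ xs → alternant ρ xs * alternant χ xs) ∎
        where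
        A : Fin (suc n) → Fin (suc n) → Series m
        A a b = var (κ a b)

        M : Fin (suc n) → Series m
        M j = P.det λ a b → A (suc a) (punchIn j b)

        G : Fin (suc n) → Vec Carrier n → Carrier
        G j xs = alternant (ρ ∘ suc) xs * alternant (χ ∘ punchIn j) xs

        F : Fin (suc n) → Fin (suc n) → Vec Carrier (suc n) → Carrier
        F j i xs = sign (toℕ j) (lookup xs i ^ (ρ zero ℕ.+ χ j) * G j (removeAt xs i))

        entry : ∀ j i → sign (toℕ j) (δ (lookup w i) (κ zero j) * D (removeAt w i) (M j) (0s m)) ≈ L w (F j i)
        entry j i = begin
          sign (toℕ j) (δ (lookup w i) (κ zero j) * D (removeAt w i) (M j) (0s m))
            ≈⟨ sign-cong (toℕ j) (*-cong (sym (interpolates (lookup w i) (κ zero j)))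
                 (D-det (removeAt w i) _ (ρ ∘ suc) (χ ∘ punchIn j) (λ a b → κ≡ (suc a) (punchIn j b)))) ⟩
          sign (toℕ j) (contract (lookup w i) (_^ toℕ (κ zero j)) * L (removeAt w i) (G j))
            ≡⟨ ≡.cong (λ e → sign (toℕ j) (contract (lookup w i) (_^ e) * L (removeAt w i) (G j))) (κ≡ zero j) ⟩
          sign (toℕ j) (contract (lookup w i) (_^ (ρ zero ℕ.+ χ j)) * L (removeAt w i) (G j))
            ≈⟨ sign-cong (toℕ j) (L-extract w i (_^ (ρ zero ℕ.+ χ j)) (G j)) ⟨
          sign (toℕ j) (L w (λ xs → lookup xs i ^ (ρ zero ℕ.+ χ j) * G j (removeAt xs i)))
            ≈⟨ L-sign w (toℕ j) _ ⟨
          L w (F j i) ∎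

        row : ∀ j → D w (P.sign (toℕ j) (var (κ zero j) ⊛ M j)) (0s m) ≈ sum λ i → L w (F j i)
        row j = begin
          D w (P.sign (toℕ j) (var (κ zero j) ⊛ M j)) (0s m)
            ≈⟨ D-sign w (toℕ j) _ (0s m) ⟩
          sign (toℕ j) (D w (var (κ zero j) ⊛ M j) (0s m))
            ≈⟨ sign-cong (toℕ j) (D-var-⊛-at-0 w (κ zero j) (M j)) ⟩
          sign (toℕ j) (sum (λ i → δ (lookup w i) (κ zero j) * D (removeAt w i) (M j) (0s m)))
            ≈⟨ sign-sum (toℕ j) (λ i → δ (lookup w i) (κ zero j) * D (removeAt w i) (M j) (0s m)) ⟩
          sum (λ i → sign (toℕ j) (δ (lookup w i) (κ zero j) * D (removeAt w i) (M j) (0s m)))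
            ≈⟨ sum-cong-≋ (entry j) ⟩
          (sum λ i → L w (F j i)) ∎

-- From exponent vectors to words, and coefficients as derivatives at the origin.

module Iteration {c ℓ} (K : CommutativeRing c ℓ) where

  open CommutativeRing K hiding (zero)
  open Mult +-monoid using (×-congʳ; ×-congˡ; ×-assocˡ) renaming (_×_ to _·_)
  open SetoidReasoning setoid
  open Derivatives K
  open P using (Series; ∂; ∂^; total; total-lookup)

  D-++ : ∀ {m n n′} (w : Vec (Fin m) n) (w′ : Vec (Fin m) n′) (f : Series m) → D (w ++ w′) f ≡ D w (D w′ f)
  D-++ []      w′ f = ≡.refl
  D-++ (i ∷ w) w′ f = ≡.cong (∂ i) (D-++ w w′ f)

  D-replicate : ∀ {m} k (i : Fin m) (f : Series m) → D (Vec.replicate k i) f ≡ fold f (∂ i) k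
  D-replicate zero    i f = ≡.refl
  D-replicate (suc k) i f = ≡.cong (∂ i) (D-replicate k i f)

  derive : ∀ {m n} → (Fin m → ℕ) → (Fin n → Fin m) → Series m → Series m
  derive a is f = Vector.foldr (λ i g → fold g (∂ i) (a i)) f is

  derive-word : ∀ {m n} (a : Fin m → ℕ) (is : Fin n → Fin m) →
    ∃ λ (w : Vec (Fin m) (total (a ∘ is))) → ∀ f → D w f ≡ derive a is f
  derive-word {n = zero}  a is = [] , λ f → ≡.refl
  derive-word {n = suc n} a is with derive-word a (is ∘ suc)
  ... | w , p = Vec.replicate (a (is zero)) (is zero) ++ w , λ f →
    ≡.trans (D-++ (Vec.replicate (a (is zero)) (is zero)) w f)
    (≡.trans (≡.cong (D (Vec.replicate (a (is zero)) (is zero))) (p f))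
      (D-replicate (a (is zero)) (is zero) (derive a (is ∘ suc) f)))

  -- The length of the word is the degree, so `L` along it takes functions of exactly `u` points.
  ∂^-word : ∀ {m u} (α : Vec ℕ m) → Vec.sum α ≡ u →
    ∃ λ (w : Vec (Fin m) u) → ∀ f → D w f ≡ ∂^ α f
  ∂^-word {m} α p = ≡.subst (λ n → ∃ λ (w : Vec (Fin m) n) → ∀ f → D w f ≡ ∂^ α f)
    (≡.trans (total-lookup α) p) (derive-word (lookup α) (λ i → i))

  fold-∂-suc : ∀ {m} (i : Fin m) {f : Series (suc m)} {g : Series m} {n} → (∀ α → f (n ∷ α) ≡ g α) →
    ∀ k α → fold f (∂ (suc i)) k (n ∷ α) ≡ fold g (∂ i) k α
  fold-∂-suc i p zero    α = p α
  fold-∂-suc i p (suc k) α = ≡.cong (suc (lookup α i) ·_) (fold-∂-suc i p k (updateAt α i suc))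

  derive-suc : ∀ {m n} b (β : Vec ℕ m) (is : Fin n → Fin m) (f : Series (suc m)) c α →
    derive (lookup (b ∷ β)) (suc ∘ is) f (c ∷ α) ≡ derive (lookup β) is (λ α → f (c ∷ α)) α
  derive-suc {n = zero}  b β is f c α = ≡.refl
  derive-suc {n = suc n} b β is f c α =
    fold-∂-suc (is zero) (derive-suc b β (is ∘ suc) f c) (lookup β (is zero)) α

  -- Differentiating `k` times produces the factor (k + n)! / n!; multiplying by n! avoids the
  -- quotient.
  fold-∂-zero : ∀ {m} k (f : Series (suc m)) n α →
    (n !) · fold f (∂ zero) k (n ∷ α) ≈ ((k ℕ.+ n) !) · f (k ℕ.+ n ∷ α)
  fold-∂-zero zero    f n α = refl
  fold-∂-zero (suc k) f n α = begin
    (n !) · (suc n · g)                    ≈⟨ ×-assocˡ g (n !) (suc n) ⟩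
    (n ! ℕ.* suc n) · g                    ≈⟨ ×-congˡ (ℕₚ.*-comm (n !) (suc n)) ⟩
    (suc n !) · g                          ≈⟨ fold-∂-zero k f (suc n) α ⟩
    ((k ℕ.+ suc n) !) · f (k ℕ.+ suc n ∷ α) ≡⟨ ≡.cong (λ j → (j !) · f (j ∷ α)) (ℕₚ.+-suc k n) ⟩
    ((suc k ℕ.+ n) !) · f (suc k ℕ.+ n ∷ α) ∎
    where
    g : Carrier
    g = fold f (∂ zero) k (suc n ∷ α)

  factorials : ∀ {m} → Vec ℕ m → ℕ
  factorials []      = 1
  factorials (b ∷ β) = b ! ℕ.* factorials β

  factorials≢0 : ∀ {m} (β : Vec ℕ m) → ℕ.NonZero (factorials β)
  factorials≢0 []      = _
  factorials≢0 (b ∷ β) = ℕₚ.m*n≢0 (b !) (factorials β) {{ℕₚ._!≢0 b}} {{factorials≢0 β}}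

  ∂^-at-0 : ∀ {m} (β : Vec ℕ m) (f : Series m) → ∂^ β f (0s m) ≈ factorials β · f β
  ∂^-at-0 []      f = sym (+-identityʳ _)
  ∂^-at-0 {suc m} (b ∷ β) f = begin
    fold g (∂ zero) b (0 ∷ 0s m)                ≈⟨ +-identityʳ _ ⟨
    1 · fold g (∂ zero) b (0 ∷ 0s m)            ≈⟨ fold-∂-zero b g 0 (0s m) ⟩
    ((b ℕ.+ 0) !) · g (b ℕ.+ 0 ∷ 0s m)          ≡⟨ ≡.cong (λ n → (n !) · g (n ∷ 0s m)) (ℕₚ.+-identityʳ b) ⟩
    (b !) · g (b ∷ 0s m)                        ≡⟨ ≡.cong ((b !) ·_) (derive-suc b β (λ i → i) f b (0s m)) ⟩
    (b !) · ∂^ β (λ α → f (b ∷ α)) (0s m)       ≈⟨ ×-congʳ (b !) (∂^-at-0 β (λ α → f (b ∷ α))) ⟩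
    (b !) · (factorials β · f (b ∷ β))          ≈⟨ ×-assocˡ _ (b !) (factorials β) ⟩
    factorials (b ∷ β) · f (b ∷ β)              ∎
    where
    g : Series (suc m)
    g = derive (lookup (b ∷ β)) suc f

-- Factorization of the catalecticant matrix.

module Catalecticant {c ℓ} (K : CommutativeRing c ℓ)
  (natural-unit : ∀ n → Univariate.Unit K
    (Mult._×_ (CommutativeRing.+-monoid K) (suc n) (CommutativeRing.1# K))) where

  open CommutativeRing K hiding (zero)
  open RingProperties ring using (-‿distribˡ-*; -‿distribʳ-*; -‿involutive; -‿+-comm)
  open Mult +-monoid using (×-congʳ; ×-homo-+) renaming (_×_ to _·_)
  open SemiringMult semiring using (×1-homo-*; ×-assoc-*)
  open SemiringSum semiring using (sum; sum-cong-≋; *-distribˡ-sum)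
  open SemiringExp semiring using (_^_)
  open NaturalCoefficientsSolver commutativeSemiring using (solve; _:=_; _:*_)
  open CommutativeSemigroupProperties *-commutativeSemigroup using (x∙yz≈y∙xz)
  open SetoidReasoning setoid
  open Univariate K
  open Determinants K using (vandermonde; vandermonde-++; differences; det-vandermonde)
  open Derivatives K
  open Iteration K
  open P using (∂^; coeff; h)

  2# : Carrier
  2# = 2 · 1#

  2^≈ : ∀ n → 2# ^ n ≈ (2 ℕ.^ n) · 1#
  2^≈ zero    = sym (+-identityʳ 1#)
  2^≈ (suc n) = trans (*-congˡ (2^≈ n)) (sym (×1-homo-* 2 (2 ℕ.^ n)))

  -- The difference is a positive natural number, hence a unit. Powers of 2 are therefore admissible
  -- interpolation nodes.
  2^-separated-< : ∀ {i j} → i ℕ.< j → Unit (2# ^ j - 2# ^ i)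
  2^-separated-< {i} {j} i<j with ℕₚ.m≤n⇒∃[o]m+o≡n (ℕₚ.^-monoʳ-< 2 (ℕ.s≤s (ℕ.s≤s ℕ.z≤n)) i<j)
  ... | k , p with natural-unit k
  ...   | y , q = y , trans (*-congʳ (begin
    2# ^ j - 2# ^ i                     ≈⟨ +-cong (2^≈ j) (-‿cong (2^≈ i)) ⟩
    (2 ℕ.^ j) · 1# - n · 1#             ≡⟨ ≡.cong (λ m → m · 1# - n · 1#) (≡.sym p) ⟩
    suc (n ℕ.+ k) · 1# - n · 1#         ≡⟨ ≡.cong (λ m → m · 1# - n · 1#) (≡.sym (ℕₚ.+-suc n k)) ⟩
    (n ℕ.+ suc k) · 1# - n · 1#         ≈⟨ +-congʳ (trans (×-homo-+ 1# n (suc k)) (+-comm _ _)) ⟩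
    suc k · 1# + n · 1# - n · 1#        ≈⟨ trans (+-assoc _ _ _) (+-congˡ (-‿inverseʳ _)) ⟩
    suc k · 1# + 0#                     ≈⟨ +-identityʳ _ ⟩
    suc k · 1#                          ∎)) q
    where
    n : ℕ
    n = 2 ℕ.^ i

  unit-flip : ∀ {x y} → Unit (x - y) → Unit (y - x)
  unit-flip {x} {y} (z , p) = - z , (begin
    (y - x) * - z    ≈⟨ -‿distribʳ-* (y - x) z ⟨
    - ((y - x) * z)  ≈⟨ -‿distribˡ-* (y - x) z ⟩
    - (y - x) * z    ≈⟨ *-congʳ (trans (sym (-‿+-comm y (- x))) (trans (+-comm _ _) (+-congʳ (-‿involutive x)))) ⟩
    (x - y) * z      ≈⟨ p ⟩
    1#               ∎)

  2^-separated : ∀ i j → i ≢ j → Unit (2# ^ i - 2# ^ j)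
  2^-separated i j i≢j with ℕₚ.<-cmp i j
  ... | tri< i<j _ _ = unit-flip (2^-separated-< i<j)
  ... | tri≈ _ i≡j _ = contradiction i≡j i≢j
  ... | tri> _ _ j<i = 2^-separated-< j<i

  open Interpolation 2# 2^-separated

  module _ {m : ℕ} where
    open Contraction {m} (λ k p → lookup (lagrange k) p) node public

    interpolates : ∀ k j → contract k (_^ toℕ j) ≈ δ k j
    interpolates k j with k Finₚ.≟ j
    ... | yes ≡.refl = lagrange-same k
    ... | no k≢j     = lagrange-different k≢j

  vandermonde² : ∀ {n} → Vec Carrier n → Carrier
  vandermonde² xs = vandermonde xs * vandermonde xs

  D-hankel : ∀ {d n} → n ≡ d → (w : Vec (Fin (2 ℕ.* d ∸ 1)) n) →
    D w (coeff (h d)) (0s (2 ℕ.* d ∸ 1)) ≈ L w vandermonde²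
  D-hankel {d} ≡.refl w = trans
    -- Entry (i, j) is the variable number i + j, counted from 0. Both exponent families are thus
    -- `toℕ`, and the alternants are ordinary Vandermonde determinants.
    (D-det interpolates w _ toℕ toℕ (λ i j → Finₚ.toℕ-fromℕ< (P.index< i j)))
    (L-cong w λ xs → *-cong (det-vandermonde xs) (det-vandermonde xs))

  vandermonde²-++ : ∀ {m n} (ys : Vec Carrier m) (xs : Vec Carrier n) →
    vandermonde² (ys ++ xs) ≈ vandermonde² ys * vandermonde² xs * differences² ys xs
  vandermonde²-++ ys xs = trans (*-cong (vandermonde-++ ys xs) (vandermonde-++ ys xs))
    (solve 3 (λ a b c → a :* b :* c :* (a :* b :* c) := a :* a :* (b :* b) :* (c :* c)) refl
      (vandermonde ys) (vandermonde xs) (differences ys xs))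

  natural-inverse : ∀ n → .{{ℕ.NonZero n}} → ∃ λ z → ∀ x → z * (n · x) ≈ x
  natural-inverse (suc n) with natural-unit n
  ... | z , p = z , λ x → begin
    z * (suc n · x)         ≈⟨ *-congˡ (trans (×-congʳ (suc n) (sym (*-identityˡ x))) (sym (×-assoc-* (suc n) 1# x))) ⟩
    z * (suc n · 1# * x)    ≈⟨ solve 3 (λ z n x → z :* (n :* x) := n :* z :* x) refl z (suc n · 1#) x ⟩
    suc n · 1# * z * x      ≈⟨ *-congʳ p ⟩
    1# * x                  ≈⟨ *-identityˡ x ⟩
    x                       ∎

  -- A factorization of the matrix in the monomial bases, with inner dimension `N`; its rows are the
  -- images of the monomials of degree `u`.
  record Factorization (u v d N : ℕ) : Set (c ⊔ ℓ) where
    field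
      left    : ∀ (α : Vec ℕ (2 ℕ.* d ∸ 1)) → Vec.sum α ≡ u → Fin N → Carrier
      right   : ∀ (β : Vec ℕ (2 ℕ.* d ∸ 1)) → Vec.sum β ≡ v → Fin N → Carrier
      factors : ∀ α p β q → ∂^ α (coeff (h d)) β ≈ sum λ n → left α p n * right β q n

  -- `L` along a concatenated word is an iterated functional, so an expansion of the squared
  -- Vandermonde product with separated groups of points becomes a matrix product with as many
  -- terms.
  factorize : ∀ {u v d N} (u+v≡d : u ℕ.+ v ≡ d)
    (A : Fin N → Vec Carrier u → Carrier) (B : Fin N → Vec Carrier v → Carrier) →
    (∀ ys xs → vandermonde² (ys ++ xs) ≈ sum λ n → A n xs * B n ys) → Factorization u v d N
  factorize {u} {v} {d} {N} u+v≡d A B split = record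
    { left    = λ α p n → L (proj₁ (∂^-word α p)) (A n)
    ; right   = λ β q n → proj₁ (natural-inverse (factorials β) {{factorials≢0 β}}) * L (proj₁ (∂^-word β q)) (B n)
    ; factors = factors
    }
    where
    m : ℕ
    m = 2 ℕ.* d ∸ 1
    factors : ∀ (α : Vec ℕ m) p (β : Vec ℕ m) q → ∂^ α (coeff (h d)) β ≈ sum λ n →
      L (proj₁ (∂^-word α p)) (A n) *
      (proj₁ (natural-inverse (factorials β) {{factorials≢0 β}}) * L (proj₁ (∂^-word β q)) (B n))
    factors α p β q with ∂^-word α p | ∂^-word β q | natural-inverse (factorials β) {{factorials≢0 β}}
    ... | w , D≡ | w′ , D′≡ | z , inv = begin
      -- The coefficient at `β` is the derivative along `β` at the origin divided by β!, whose
      -- inverse is `z`.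
      ∂^ α H β
        ≈⟨ inv _ ⟨
      z * (factorials β · ∂^ α H β)
        ≈⟨ *-congˡ (∂^-at-0 β (∂^ α H)) ⟨
      z * ∂^ β (∂^ α H) (0s m)
        -- The letters of `α` act first and so stand last in the word; this is why the points `ys`
        -- belonging to `β` precede `xs` in `split`.
        ≡⟨ ≡.cong (λ f → z * f (0s m)) (≡.trans (≡.cong (∂^ β) (≡.sym (D≡ H)))
             (≡.trans (≡.sym (D′≡ _)) (≡.sym (D-++ w′ w H)))) ⟩
      z * D (w′ ++ w) H (0s m)
        ≈⟨ *-congˡ (D-hankel (≡.trans (ℕₚ.+-comm v u) u+v≡d) (w′ ++ w)) ⟩
      z * L (w′ ++ w) vandermonde²
        ≈⟨ *-congˡ (trans (L-++ w′ w _) (L-cong w′ λ ys → trans (L-cong w (split ys))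
             (trans (L-sum w (λ n xs → A n xs * B n ys)) (sum-cong-≋ λ n → L-scaleʳ w (B n ys) (A n))))) ⟩
      z * L w′ (λ ys → sum λ n → L w (A n) * B n ys)
        ≈⟨ *-congˡ (trans (L-sum w′ (λ n ys → L w (A n) * B n ys)) (sum-cong-≋ λ n → L-scale w′ (L w (A n)) (B n))) ⟩
      z * sum (λ n → L w (A n) * L w′ (B n))
        ≈⟨ *-distribˡ-sum z (λ n → L w (A n) * L w′ (B n)) ⟩
      sum (λ n → z * (L w (A n) * L w′ (B n)))
        ≈⟨ sum-cong-≋ (λ n → x∙yz≈y∙xz z (L w (A n)) (L w′ (B n))) ⟩
      (sum λ n → L w (A n) * (z * L w′ (B n))) ∎
      where
      H = coeff (h d)

  private
    evaluationCoefficients : ∀ s {v} → Vec Carrier v → Vec Carrier (#monomials s v)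
    evaluationCoefficients s ys = coefficients (∏-evaluate-form {s} ys)

    doubled : ∀ {n} → Vec Carrier n → Vec Carrier (suc (n ℕ.+ n))
    doubled xs = fromRoots (xs ++ xs)

    expand : ∀ {s v} (a b : Carrier) (g : Vec Carrier s) (ys : Vec Carrier v) {x} →
      x ≈ dot (monomials s v g) (evaluationCoefficients s ys) →
      a * b * x ≈ sum λ n → (b * lookup (monomials s v g) n) * (a * lookup (evaluationCoefficients s ys) n)
    expand {s} {v} a b g ys {x} p = trans (*-congˡ (trans p (dot-sum (monomials s v g) _)))
      (trans (*-distribˡ-sum (a * b) (λ n → lookup (monomials s v g) n * lookup (evaluationCoefficients s ys) n)) (sum-cong-≋ λ n →
        pull a b (lookup (monomials s v g) n) (lookup (evaluationCoefficients s ys) n)))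
      where
      pull : ∀ a b c d → a * b * (c * d) ≈ b * c * (a * d)
      pull = solve 4 (λ a b c d → a :* b :* (c :* d) := b :* c :* (a :* d)) refl

  factorizationˡ : ∀ {u v d} (u+v≡d : u ℕ.+ v ≡ d) → Factorization u v d (#monomials (suc (u ℕ.+ u)) v)
  factorizationˡ {u} {v} u+v≡d = factorize {u} {v} u+v≡d
    (λ n xs → vandermonde² xs * lookup (monomials (suc (u ℕ.+ u)) v (doubled xs)) n)
    (λ n ys → vandermonde² ys * lookup (evaluationCoefficients (suc (u ℕ.+ u)) ys) n)
    λ ys xs → trans (vandermonde²-++ ys xs) (expand (vandermonde² ys) (vandermonde² xs) (doubled xs) ys
      (trans (differences²-left ys xs) (expansion (∏-evaluate-form ys) (doubled xs))))

  -- The matrix is not transposed. Only the mixed factor is read differently: its polynomial has the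
  -- double roots `ys` and is evaluated at `xs`.
  factorizationʳ : ∀ {u v d} (u+v≡d : u ℕ.+ v ≡ d) → Factorization u v d (#monomials (suc (v ℕ.+ v)) u)
  factorizationʳ {u} {v} u+v≡d = factorize {u} {v} u+v≡d
    (λ n xs → vandermonde² xs * lookup (evaluationCoefficients (suc (v ℕ.+ v)) xs) n)
    (λ n ys → vandermonde² ys * lookup (monomials (suc (v ℕ.+ v)) u (doubled ys)) n)
    λ ys xs → trans (vandermonde²-++ ys xs) (trans (*-congʳ (*-comm _ _))
      (trans (expand (vandermonde² xs) (vandermonde² ys) (doubled ys) xs
        (trans (differences²-right ys xs) (expansion (∏-evaluate-form xs) (doubled ys))))
        (sum-cong-≋ λ n → *-comm (vandermonde² ys * lookup (monomials (suc (v ℕ.+ v)) u (doubled ys)) n)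
          (vandermonde² xs * lookup (evaluationCoefficients (suc (v ℕ.+ v)) xs) n))))

  factorization : ∀ {u v d} (u+v≡d : u ℕ.+ v ≡ d) → ∃ λ N → N ℕ.≤ rankBound d × Factorization u v d N
  factorization {u} {v} u+v≡d with ℕₚ.≤-total v u
  ... | inj₁ v≤u = _ , ≡.subst₂ ℕ._≤_ (monomials-count u v) (≡.cong rankBound u+v≡d) (choose≤rankBound v≤u)
                 , factorizationˡ {u} {v} u+v≡d
  ... | inj₂ u≤v = _ , ≡.subst₂ ℕ._≤_ (monomials-count v u) (≡.cong rankBound (≡.trans (ℕₚ.+-comm v u) u+v≡d))
                     (choose≤rankBound u≤v)
                 , factorizationʳ {u} {v} u+v≡d

-- Gaussian elimination on a factored matrix.

module Elimination {c₁ ℓ₁ c₂ ℓ₂} (F : CommutativeRing c₁ ℓ₁) (K : CommutativeRing c₂ ℓ₂)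
  (φ : CommutativeRing.Carrier F → CommutativeRing.Carrier K)
  (φ-homo : IsRingHomomorphism (CommutativeRing.rawRing F) (CommutativeRing.rawRing K) φ) where

  private
    module F = CommutativeRing F
    module K = CommutativeRing K
    module φ = IsRingHomomorphism φ-homo
    module ΣF = SemiringSum F.semiring
    module ΣK = SemiringSum K.semiring

  -- A basis of the row space consisting of actual rows of `M`. Independence is asked with
  -- coefficients in `K`; it survives elimination because the pivots are units of `F`, which `φ`
  -- maps to units of `K`.
  record Basis {a b} (M : Fin a → Fin b → F.Carrier) (N : ℕ) : Set (c₁ ⊔ ℓ₁ ⊔ c₂ ⊔ ℓ₂) where
    field
      rank        : ℕ
      rank≤       : rank ℕ.≤ N
      row         : Fin rank → Fin a
      coordinate  : Fin a → Fin rank → F.Carrier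
      spanning    : ∀ i j → M i j F.≈ ΣF.sum λ k → coordinate i k F.* M (row k) j
      independent : ∀ (x : Fin rank → K.Carrier) →
                    (∀ j → ΣK.sum (λ k → x k K.* φ (M (row k) j)) K.≈ K.0#) → ∀ k → x k K.≈ K.0#

  module _ (inverse? : ∀ x → (x F.≈ F.0#) ⊎ (∃ λ y → x F.* y F.≈ F.1#)) where

    findUnit : ∀ {n} (t : Fin n → F.Carrier) →
      (∀ i → t i F.≈ F.0#) ⊎ (∃ λ i → ∃ λ y → t i F.* y F.≈ F.1#)
    findUnit {zero}  t = inj₁ λ ()
    findUnit {suc n} t with inverse? (t zero) | findUnit (t ∘ suc)
    ... | inj₂ unit | _                = inj₂ (zero , unit)
    ... | inj₁ _    | inj₂ (i , unit)  = inj₂ (suc i , unit)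
    ... | inj₁ t0≈0 | inj₁ rest≈0      = inj₁ λ { zero → t0≈0 ; (suc i) → rest≈0 i }

    findPivot : ∀ {a b} (M : Fin a → Fin b → F.Carrier) →
      (∀ i j → M i j F.≈ F.0#) ⊎ (∃ λ i → ∃ λ j → ∃ λ y → M i j F.* y F.≈ F.1#)
    findPivot {zero}  M = inj₁ λ ()
    findPivot {suc a} M with findUnit (M zero) | findPivot (M ∘ suc)
    ... | inj₂ unit | _               = inj₂ (zero , unit)
    ... | inj₁ _    | inj₂ (i , unit) = inj₂ (suc i , unit)
    ... | inj₁ M0≈0 | inj₁ rest≈0     = inj₁ λ { zero → M0≈0 ; (suc i) → rest≈0 i }

    zeroBasis : ∀ {a b N} {M : Fin a → Fin b → F.Carrier} → (∀ i j → M i j F.≈ F.0#) → Basis M N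
    zeroBasis M≈0 = record
      { rank        = 0
      ; rank≤       = z≤n
      ; row         = λ ()
      ; coordinate  = λ _ ()
      ; spanning    = M≈0
      ; independent = λ _ _ ()
      }

    module Pivot {a b} (M : Fin a → Fin b → F.Carrier) (i₀ : Fin a) (j₀ : Fin b)
                 (y : F.Carrier) (unit : M i₀ j₀ F.* y F.≈ F.1#) where

      open F hiding (zero)
      open RingProperties ring using (-‿distribˡ-*; -‿distribʳ-*)
      open Sums F
      open SemiringSum semiring using (sum; sum-cong-≋)
      open CommutativeMonoidSum +-commutativeMonoid using (sum-remove)
      open NaturalCoefficientsSolver commutativeSemiring using (solve; _:=_; _:+_; _:*_)
      open SetoidReasoning setoid

      scale : Fin a → Carrier
      scale i = M i j₀ * y

      reduced : Fin a → Fin b → Carrier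
      reduced i j = M i j - scale i * M i₀ j

      reduced-column : ∀ i → reduced i j₀ ≈ 0#
      reduced-column i = trans (+-congˡ (-‿cong
        (trans (solve 3 (λ m y p → m :* y :* p := m :* (p :* y)) refl (M i j₀) y (M i₀ j₀))
          (trans (*-congˡ unit) (*-identityʳ _))))) (-‿inverseʳ _)

      restore : ∀ i j → M i j ≈ reduced i j + scale i * M i₀ j
      restore i j = sym (trans (+-assoc _ _ _) (trans (+-congˡ (-‿inverseˡ _)) (+-identityʳ _)))

      -- The column j₀ of M = P Q is a combination of the columns of P, and
      -- it vanishes after the reduction: this removes one column of P.
      shrink : ∀ {N} (P : Fin a → Fin (suc N) → Carrier) (Q : Fin (suc N) → Fin b → Carrier) →
        (∀ i j → M i j ≈ sum λ n → P i n * Q n j) →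
        ∀ n₀ z → Q n₀ j₀ * z ≈ 1# →
        ∃ λ (P′ : Fin a → Fin N → Carrier) → ∃ λ (Q′ : Fin N → Fin b → Carrier) →
          ∀ i j → reduced i j ≈ sum λ n → P′ i n * Q′ n j
      shrink {N} P Q factors n₀ z unit′ = P′ , Q′ , λ i j → begin
        reduced i j
          ≈⟨ remove i j ⟩
        P₁ i n₀ * Q n₀ j + S i j
          ≈⟨ +-congʳ (*-congʳ (pivotColumn i)) ⟩
        - (S i j₀ * z) * Q n₀ j + S i j
          ≈⟨ +-comm _ _ ⟩
        S i j + - (S i j₀ * z) * Q n₀ j
          ≈⟨ +-congˡ (sym (-‿distribˡ-* _ _)) ⟩
        S i j - S i j₀ * z * Q n₀ j
          ≈⟨ +-congˡ (-‿cong (solve 3 (λ s z q → s :* z :* q := z :* q :* s) refl (S i j₀) z (Q n₀ j))) ⟩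
        S i j - z * Q n₀ j * S i j₀
          ≈⟨ sum--* (z * Q n₀ j) (λ n → Q (punchIn n₀ n) j) (λ n → Q (punchIn n₀ n) j₀) (P′ i) ⟨
        sum (λ n → Q′ n j * P′ i n)
          ≈⟨ sum-cong-≋ (λ n → *-comm (Q′ n j) (P′ i n)) ⟩
        sum (λ n → P′ i n * Q′ n j) ∎
        where
        P₁ : Fin a → Fin (suc N) → Carrier
        P₁ i n = P i n - scale i * P i₀ n
        P′ : Fin a → Fin N → Carrier
        P′ i n = P₁ i (punchIn n₀ n)
        Q′ : Fin N → Fin b → Carrier
        Q′ n j = Q (punchIn n₀ n) j - z * Q n₀ j * Q (punchIn n₀ n) j₀
        S : Fin a → Fin b → Carrier
        S i j = sum λ n → Q (punchIn n₀ n) j * P′ i n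
        remove : ∀ i j → reduced i j ≈ P₁ i n₀ * Q n₀ j + S i j
        remove i j = begin
          reduced i j
            ≈⟨ +-cong (factors i j) (-‿cong (*-congˡ (factors i₀ j))) ⟩
          sum (λ n → P i n * Q n j) - scale i * sum (λ n → P i₀ n * Q n j)
            ≈⟨ sum--* (scale i) (P i) (P i₀) (λ n → Q n j) ⟨
          sum (λ n → P₁ i n * Q n j)
            ≈⟨ sum-remove {i = n₀} (λ n → P₁ i n * Q n j) ⟩
          P₁ i n₀ * Q n₀ j + sum (λ n → P′ i n * Q (punchIn n₀ n) j)
            ≈⟨ +-congˡ (sum-cong-≋ (λ n → *-comm (P′ i n) (Q (punchIn n₀ n) j))) ⟩
          P₁ i n₀ * Q n₀ j + S i j ∎
        pivotColumn : ∀ i → P₁ i n₀ ≈ - (S i j₀ * z)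
        pivotColumn i = begin
          p                          ≈⟨ *-identityʳ p ⟨
          p * 1#                     ≈⟨ *-congˡ unit′ ⟨
          p * (q * z)                ≈⟨ *-assoc p q z ⟨
          p * q * z                  ≈⟨ +-identityʳ _ ⟨
          p * q * z + 0#             ≈⟨ +-congˡ (-‿inverseʳ (s * z)) ⟨
          p * q * z + (s * z - s * z) ≈⟨ +-assoc _ _ _ ⟨
          p * q * z + s * z - s * z  ≈⟨ +-congʳ (distribʳ z (p * q) s) ⟨
          (p * q + s) * z - s * z    ≈⟨ +-congʳ (*-congʳ (trans (sym (remove i j₀)) (reduced-column i))) ⟩
          0# * z - s * z             ≈⟨ trans (+-congʳ (zeroˡ z)) (+-identityˡ _) ⟩
          - (s * z)                  ∎
          where
          p q s : Carrier
          p = P₁ i n₀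
          q = Q n₀ j₀
          s = S i j₀

      module _ {N} (B : Basis reduced N) where

        open Basis B

        rows : Fin (suc rank) → Fin a
        rows zero    = i₀
        rows (suc k) = row k

        -- The basis of `reduced` consists of reduced rows. Replacing them by rows of `M` adds
        -- multiples of row `i₀`, and the subtracted sum compensates for these.
        coordinates : Fin a → Fin (suc rank) → Carrier
        coordinates i zero    = scale i - sum λ k → scale (row k) * coordinate i k
        coordinates i (suc k) = coordinate i k

        spans : ∀ i j → M i j ≈ sum λ k → coordinates i k * M (rows k) j
        spans i j = begin
          M i j
            ≈⟨ restore i j ⟩
          reduced i j + scale i * m
            ≈⟨ +-congʳ (trans (spanning i j) (sum-cong-≋ λ k → trans (*-comm (coordinate i k) _)
                 (*-congʳ {coordinate i k} (+-congˡ {M (row k) j} (-‿cong (*-comm (scale (row k)) m)))))) ⟩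
          sum (λ k → (M (row k) j - m * scale (row k)) * coordinate i k) + scale i * m
            ≈⟨ +-congʳ (sum--* m (λ k → M (row k) j) (λ k → scale (row k)) (coordinate i)) ⟩
          X - m * Y + scale i * m
            ≈⟨ +-congʳ (+-congˡ (-‿distribʳ-* m Y)) ⟩
          X + m * - Y + scale i * m
            ≈⟨ solve 4 (λ x m y s → x :+ m :* y :+ s :* m := (s :+ y) :* m :+ x) refl X m (- Y) (scale i) ⟩
          (scale i - Y) * m + X
            ≈⟨ +-congˡ (sum-cong-≋ λ k → *-comm (M (row k) j) (coordinate i k)) ⟩
          (scale i - Y) * m + sum (λ k → coordinate i k * M (row k) j) ∎
          where
          m X Y : Carrier
          m = M i₀ j
          X = sum λ k → M (row k) j * coordinate i k
          Y = sum λ k → scale (row k) * coordinate i k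

        private module S = Sums K

        -- Rewriting each row of `M` as its reduced row plus a multiple of row `i₀` gives row `i₀`
        -- the total coefficient `z`. In column `j₀` the reduced rows vanish and the pivot is a
        -- unit, so `z` is 0; then the reduced rows have zero coefficients, and `z` is just
        -- `x zero`.
        independence : ∀ (x : Fin (suc rank) → K.Carrier) →
          (∀ j → ΣK.sum (λ k → x k K.* φ (M (rows k) j)) K.≈ K.0#) → ∀ k → x k K.≈ K.0#
        independence x p = λ
          { zero    → K.trans (K.sym (K.trans (K.+-congˡ
                        (S.sum-zero λ k → K.trans (K.*-congˡ (tail≈0 k)) (K.zeroʳ (φ (scale (row k))))))
                        (K.+-identityʳ (x zero)))) head≈0
          ; (suc k) → tail≈0 k
          }
          where
          z : K.Carrier
          z = x zero K.+ ΣK.sum λ k → φ (scale (row k)) K.* x (suc k)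

          T : Fin b → K.Carrier
          T j = ΣK.sum λ k → x (suc k) K.* φ (reduced (row k) j)

          relation : ∀ j → z K.* φ (M i₀ j) K.+ T j K.≈ K.0#
          relation j = KR.begin
            z K.* m K.+ T j
              KR.≈⟨ KS.solve 4 (λ x s m t → (x KS.:+ s) KS.:* m KS.:+ t KS.:= x KS.:* m KS.:+ (t KS.:+ m KS.:* s))
                     K.refl (x zero) _ m (T j) ⟩
            x zero K.* m K.+ (T j K.+ m K.* ΣK.sum (λ k → φ (scale (row k)) K.* x (suc k)))
              KR.≈⟨ K.+-congˡ (K.+-congʳ (ΣK.sum-cong-≋ λ k → K.*-comm (x (suc k)) (φ (reduced (row k) j)))) ⟩
            x zero K.* m K.+ (ΣK.sum (λ k → φ (reduced (row k) j) K.* x (suc k)) K.+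
                              m K.* ΣK.sum (λ k → φ (scale (row k)) K.* x (suc k)))
              KR.≈⟨ K.+-congˡ (S.sum-+* m (λ k → φ (reduced (row k) j)) (λ k → φ (scale (row k))) (x ∘ suc)) ⟨
            x zero K.* m K.+ ΣK.sum (λ k → (φ (reduced (row k) j) K.+ m K.* φ (scale (row k))) K.* x (suc k))
              KR.≈⟨ K.+-congˡ (ΣK.sum-cong-≋ λ k → K.trans (K.*-comm _ (x (suc k))) (K.*-congˡ {x (suc k)}
                     (K.sym (K.trans (φ.⟦⟧-cong (restore (row k) j)) (K.trans (φ.+-homo _ _) (K.+-congˡ {φ (reduced (row k) j)}
                       (K.trans (φ.*-homo _ _) (K.*-comm (φ (scale (row k))) m)))))))) ⟩
            x zero K.* m K.+ ΣK.sum (λ k → x (suc k) K.* φ (M (row k) j))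
              KR.≈⟨ p j ⟩
            K.0# KR.∎
            where
            module KR = SetoidReasoning K.setoid
            module KS = NaturalCoefficientsSolver K.commutativeSemiring
            m : K.Carrier
            m = φ (M i₀ j)

          head≈0 : z K.≈ K.0#
          head≈0 = KR.begin
            z
              KR.≈⟨ K.*-identityʳ z ⟨
            z K.* K.1#
              KR.≈⟨ K.*-congˡ (K.trans (K.sym (φ.*-homo _ _)) (K.trans (φ.⟦⟧-cong unit) φ.1#-homo)) ⟨
            z K.* (φ (M i₀ j₀) K.* φ y)
              KR.≈⟨ K.*-assoc z _ _ ⟨
            z K.* φ (M i₀ j₀) K.* φ y
              KR.≈⟨ K.*-congʳ (K.trans (K.sym (K.trans (K.+-congˡ (S.sum-zero λ k → K.trans (K.*-congˡ
                     (K.trans (φ.⟦⟧-cong (reduced-column (row k))) φ.0#-homo)) (K.zeroʳ (x (suc k))))) (K.+-identityʳ _)))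
                     (relation j₀)) ⟩
            K.0# K.* φ y
              KR.≈⟨ K.zeroˡ _ ⟩
            K.0# KR.∎
            where module KR = SetoidReasoning K.setoid

          tail≈0 : ∀ k → x (suc k) K.≈ K.0#
          tail≈0 = independent (x ∘ suc) λ j → K.trans (K.sym (K.trans
            (K.+-congʳ (K.trans (K.*-congʳ head≈0) (K.zeroˡ _))) (K.+-identityˡ _))) (relation j)

        extend : Basis M (suc N)
        extend = record
          { rank        = suc rank
          ; rank≤       = s≤s rank≤
          ; row         = rows
          ; coordinate  = coordinates
          ; spanning    = spans
          ; independent = independence
          }

    -- The recursion is on the inner dimension: each pivot of `M` uses up one unit in the column
    -- `j₀` of `Q`, so there are at most `N` pivots.
    eliminate : ∀ {a b N} (M : Fin a → Fin b → F.Carrier)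
      (P : Fin a → Fin N → F.Carrier) (Q : Fin N → Fin b → F.Carrier) →
      (∀ i j → M i j F.≈ ΣF.sum λ n → P i n F.* Q n j) → Basis M N
    eliminate {N = zero}  M P Q factors = zeroBasis factors
    eliminate {N = suc N} M P Q factors with findPivot M
    ... | inj₁ M≈0 = zeroBasis M≈0
    ... | inj₂ (i₀ , j₀ , y , unit) with findUnit (λ n → Q n j₀)
    ...   | inj₂ (n₀ , z , unit′) =
      let P′ , Q′ , factors′ = Pivot.shrink M i₀ j₀ y unit P Q factors n₀ z unit′
      in Pivot.extend M i₀ j₀ y unit (eliminate (Pivot.reduced M i₀ j₀ y unit) P′ Q′ factors′)
    -- A zero column of `Q` makes the pivot zero as well as a unit. The ring is then trivial and
    -- every matrix is zero.
    ...   | inj₁ Q≈0 = zeroBasis λ i j → F.trans (F.sym (F.*-identityʳ _)) (F.trans (F.*-congˡ 1≈0) (F.zeroʳ _))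
      where
      1≈0 : F.1# F.≈ F.0#
      1≈0 = F.trans (F.sym unit) (F.trans (F.*-congʳ (F.trans (factors i₀ j₀)
        (Sums.sum-zero F λ n → F.trans (F.*-congˡ (Q≈0 n)) (F.zeroʳ (P i₀ n))))) (F.zeroˡ y))

-- Base change of series, determinants and derivatives.

module BaseChange {c₁ ℓ₁ c₂ ℓ₂} (F : CommutativeRing c₁ ℓ₁) (K : CommutativeRing c₂ ℓ₂)
  (φ : CommutativeRing.Carrier F → CommutativeRing.Carrier K)
  (φ-homo : IsRingHomomorphism (CommutativeRing.rawRing F) (CommutativeRing.rawRing K) φ) where

  private
    module F = CommutativeRing F
    module Q = Polynomials F
    module φ = IsRingHomomorphism φ-homo
  open CommutativeRing K hiding (zero)
  open Polynomials K
  open Mult +-monoid using (×-congʳ) renaming (_×_ to _·_)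

  infix 4 _↦_

  _↦_ : ∀ {m} → Q.Series m → Series m → Set _
  f ↦ g = ∀ α → g α ≈ φ (f α)

  monomial-↦ : ∀ {m} (β : Vec ℕ m) → Q.monomial β ↦ monomial β
  monomial-↦ β α with does (Vecₚ.≡-dec ℕₚ._≟_ α β)
  ... | true  = sym φ.1#-homo
  ... | false = sym φ.0#-homo

  sum-↦ : ∀ {n} (t : Fin n → F.Carrier) (t′ : Fin n → Carrier) → (∀ i → t′ i ≈ φ (t i)) →
    RawMonoidDefinitions.sum +-rawMonoid t′ ≈ φ (RawMonoidDefinitions.sum F.+-rawMonoid t)
  sum-↦ {zero}  t t′ p = sym φ.0#-homo
  sum-↦ {suc n} t t′ p = trans (+-cong (p zero) (sum-↦ (t ∘ suc) (t′ ∘ suc) (p ∘ suc))) (sym (φ.+-homo _ _))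

  ⊛-↦ : ∀ {m} {f g : Q.Series m} {f′ g′ : Series m} → f ↦ f′ → g ↦ g′ → f Q.⊛ g ↦ f′ ⊛ g′
  ⊛-↦ p q []      = trans (*-cong (p []) (q [])) (sym (φ.*-homo _ _))
  ⊛-↦ p q (n ∷ α) = sum-↦ {suc n} _ _ λ k →
    ⊛-↦ (λ β → p (toℕ k ∷ β)) (λ β → q (n ∸ toℕ k ∷ β)) α

  sign-↦ : ∀ {m} k {f : Q.Series m} {f′} → f ↦ f′ → Q.sign k f ↦ sign k f′
  sign-↦ zero    p = p
  sign-↦ (suc k) p α = trans (-‿cong (sign-↦ k p α)) (sym (φ.-‿homo _))

  seriesSum-↦ : ∀ {m n} (t : Fin n → Q.Series m) (t′ : Fin n → Series m) → (∀ i → t i ↦ t′ i) →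
    RawMonoidDefinitions.sum (RawRing.+-rawMonoid (Q.series-rawRing m)) t ↦
    RawMonoidDefinitions.sum (RawRing.+-rawMonoid (series-rawRing m)) t′
  seriesSum-↦ {n = zero}  t t′ p α = sym φ.0#-homo
  seriesSum-↦ {n = suc n} t t′ p α = trans
    (+-cong (p zero α) (seriesSum-↦ (t ∘ suc) (t′ ∘ suc) (p ∘ suc) α)) (sym (φ.+-homo _ _))

  det-↦ : ∀ {m n} (A : Fin n → Fin n → Q.Series m) (A′ : Fin n → Fin n → Series m) →
    (∀ i j → A i j ↦ A′ i j) → Q.det A ↦ det A′
  det-↦ {m} {zero}  A A′ p = monomial-↦ (Vec.replicate m 0)
  det-↦ {m} {suc n} A A′ p = seriesSum-↦ _ _ λ j → sign-↦ (toℕ j) (⊛-↦ (p zero j)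
    (det-↦ (λ i k → A (suc i) (punchIn j k)) (λ i k → A′ (suc i) (punchIn j k)) (λ i k → p (suc i) (punchIn j k))))

  -- The coefficients of h_d are obtained from 0 and 1 by ring operations, which any ring
  -- homomorphism respects.
  h-↦ : ∀ d → Q.coeff (Q.h d) ↦ coeff (h d)
  h-↦ d = det-↦ (Q.hankel d) (hankel d) λ i j → monomial-↦ _

  ·-homo : ∀ n x → n · φ x ≈ φ (Mult._×_ F.+-monoid n x)
  ·-homo zero    x = sym φ.0#-homo
  ·-homo (suc n) x = trans (+-congˡ (·-homo n x)) (sym (φ.+-homo _ _))

  ∂-↦ : ∀ {m} (i : Fin m) {f : Q.Series m} {f′} → f ↦ f′ → Q.∂ i f ↦ ∂ i f′
  ∂-↦ i p α = trans (×-congʳ (suc (lookup α i)) (p (updateAt α i suc))) (·-homo (suc (lookup α i)) _)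

  fold-∂-↦ : ∀ {m} (i : Fin m) {f : Q.Series m} {f′} → f ↦ f′ → ∀ k → fold f (Q.∂ i) k ↦ fold f′ (∂ i) k
  fold-∂-↦ i p zero    = p
  fold-∂-↦ i p (suc k) = ∂-↦ i (fold-∂-↦ i p k)

  ∂^-↦ : ∀ {m} (α : Vec ℕ m) {f : Q.Series m} {f′} → f ↦ f′ → Q.∂^ α f ↦ ∂^ α f′
  ∂^-↦ {m} α {f} {f′} p = go (λ i → i)
    where
    go : ∀ {n} (is : Fin n → Fin m) →
      Vector.foldr (λ i g → fold g (Q.∂ i) (lookup α i)) f is ↦
      Vector.foldr (λ i g → fold g (∂ i) (lookup α i)) f′ is
    go {zero}  is = p
    go {suc n} is = fold-∂-↦ (is zero) (go (is ∘ suc)) (lookup α (is zero))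

-- Sums over all monomials of a given degree.

module Exponents {c ℓ} (K : CommutativeRing c ℓ) where

  open CommutativeRing K hiding (zero)
  open Polynomials K
  open Sums K using (sum-zero)
  open SemiringSum semiring using (sum)
  open CommutativeMonoidSum +-commutativeMonoid using (sum-remove)

  listSum : ∀ {a} {A : Set a} → (A → Carrier) → List A → Carrier
  listSum t = List.foldr (λ x acc → t x + acc) 0#

  listSum-lookup : ∀ {a} {A : Set a} (t : A → Carrier) xs → listSum t xs ≈ sum λ i → t (List.lookup xs i)
  listSum-lookup t []       = refl
  listSum-lookup t (x ∷ xs) = +-congˡ (listSum-lookup t xs)

  listSum-++ : ∀ {a} {A : Set a} (t : A → Carrier) xs ys → listSum t (xs List.++ ys) ≈ listSum t xs + listSum t ys
  listSum-++ t []       ys = sym (+-identityˡ _)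
  listSum-++ t (x ∷ xs) ys = trans (+-congˡ (listSum-++ t xs ys)) (sym (+-assoc _ _ _))

  listSum-map : ∀ {a b} {A : Set a} {B : Set b} (t : B → Carrier) (f : A → B) xs →
    listSum t (List.map f xs) ≡ listSum (t ∘ f) xs
  listSum-map t f []       = ≡.refl
  listSum-map t f (x ∷ xs) = ≡.cong (t (f x) +_) (listSum-map t f xs)

  listSum-tabulate : ∀ {a b} {A : Set a} {B : Set b} {n} (t : B → Carrier) (f : A → List B) (g : Fin n → A) →
    listSum t (concatMap f (List.tabulate g)) ≈ sum λ i → listSum t (f (g i))
  listSum-tabulate {n = zero}  t f g = refl
  listSum-tabulate {n = suc n} t f g = trans (listSum-++ t (f (g zero)) _)
    (+-congˡ (listSum-tabulate t f (g ∘ suc)))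

  listSum-zero : ∀ {a} {A : Set a} (t : A → Carrier) → (∀ x → t x ≈ 0#) → ∀ xs → listSum t xs ≈ 0#
  listSum-zero t p []       = refl
  listSum-zero t p (x ∷ xs) = trans (+-cong (p x) (listSum-zero t p xs)) (+-identityˡ _)

  sum-single : ∀ {n} (k : Fin n) (t : Fin n → Carrier) → (∀ i → i ≢ k → t i ≈ 0#) → sum t ≈ t k
  sum-single {suc n} k t p = trans (sum-remove {i = k} t)
    (trans (+-congˡ (sum-zero λ i → p (punchIn k i) (Finₚ.punchInᵢ≢i k i))) (+-identityʳ _))

  -- This expresses that `exponents m j` lists `α` exactly once: only the branch with the right
  -- first exponent contributes, and the recursion continues inside it.
  listSum-exponents : ∀ {m j} (t : Vec ℕ m → Carrier) α → Vec.sum α ≡ j → (∀ β → β ≢ α → t β ≈ 0#) →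
    listSum t (exponents m j) ≈ t α
  listSum-exponents t []      ≡.refl p = +-identityʳ _
  listSum-exponents {suc m} {j} t (n ∷ α) ≡.refl p = trans (listSum-tabulate t branch (λ k → k))
    (trans (sum-single k (listSum t ∘ branch) (λ i i≢k → trans (reflexive (listSum-map t (toℕ i ∷_) (exponents m (j ∸ toℕ i))))
             (listSum-zero (t ∘ (toℕ i ∷_)) (λ β → p (toℕ i ∷ β) λ eq → i≢k (Finₚ.toℕ-injective
               (≡.trans (Vecₚ.∷-injectiveˡ eq) (≡.sym k≡n)))) (exponents m (j ∸ toℕ i)))))
    (trans (reflexive (listSum-map t (toℕ k ∷_) (exponents m (j ∸ toℕ k))))
    (trans (listSum-exponents (t ∘ (toℕ k ∷_)) α sum≡ (λ β β≢α → p (toℕ k ∷ β) (β≢α ∘ Vecₚ.∷-injectiveʳ)))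
      (reflexive (≡.cong (λ i → t (i ∷ α)) k≡n)))))
    where
    branch : Fin (suc j) → List (Vec ℕ (suc m))
    branch k = List.map (toℕ k ∷_) (exponents m (j ∸ toℕ k))
    n≤ : n ℕ.< suc (n ℕ.+ Vec.sum α)
    n≤ = s≤s (ℕₚ.m≤m+n n (Vec.sum α))
    k : Fin (suc j)
    k = fromℕ< n≤
    k≡n : toℕ k ≡ n
    k≡n = Finₚ.toℕ-fromℕ< n≤
    sum≡ : Vec.sum α ≡ j ∸ toℕ k
    sum≡ = ≡.sym (≡.trans (≡.cong (n ℕ.+ Vec.sum α ∸_) k≡n) (ℕₚ.m+n∸m≡n n (Vec.sum α)))

  ∈-exponents : ∀ {m j} (α : Vec ℕ m) → Vec.sum α ≡ j → α ∈ exponents m j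
  ∈-exponents []      ≡.refl = here ≡.refl
  ∈-exponents {suc m} {j} (n ∷ α) ≡.refl = ∈-concat⁺′
    (≡.subst (λ i → n ∷ α ∈ List.map (i ∷_) (exponents m (j ∸ i))) (≡.sym k≡n)
      (∈-map⁺ (n ∷_) (∈-exponents α (≡.sym (ℕₚ.m+n∸m≡n n (Vec.sum α))))))
    (∈-map⁺ (λ k → List.map (toℕ k ∷_) (exponents m (j ∸ toℕ k))) (∈-allFin (fromℕ< n≤)))
    where
    n≤ : n ℕ.< suc (n ℕ.+ Vec.sum α)
    n≤ = s≤s (ℕₚ.m≤m+n n (Vec.sum α))
    k≡n : toℕ (fromℕ< n≤) ≡ n
    k≡n = Finₚ.toℕ-fromℕ< n≤

  exponents-lookup : ∀ m j i → Vec.sum (List.lookup (exponents m j) i) ≡ j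
  exponents-lookup m j i = All.lookup (exponents-sum m j) (∈-lookup i)

-- The rank of the catalecticant over an extension.

module CatalecticantRank {c₁ ℓ₁ c₂ ℓ₂} (F : CommutativeRing c₁ ℓ₁) (K : CommutativeRing c₂ ℓ₂)
  (φ : CommutativeRing.Carrier F → CommutativeRing.Carrier K)
  (φ-homo : IsRingHomomorphism (CommutativeRing.rawRing F) (CommutativeRing.rawRing K) φ)
  (inverse? : ∀ x → CommutativeRing._≈_ F x (CommutativeRing.0# F) ⊎ Univariate.Unit F x)
  (natural-unit : ∀ n → Univariate.Unit F
    (Mult._×_ (CommutativeRing.+-monoid F) (suc n) (CommutativeRing.1# F))) where

  private
    module F = CommutativeRing F
    module Q = Polynomials F
    module φ = IsRingHomomorphism φ-homo
    module ΣF = SemiringSum F.semiring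
  open CommutativeRing K hiding (zero)
  open Polynomials K
  open LinearAlgebra K
  open SemiringSum semiring using (sum; sum-cong-≋; ∑-comm; *-distribˡ-sum; *-distribʳ-sum)
  open Exponents K
  open BaseChange F K φ φ-homo
  open Elimination F K φ φ-homo using (Basis; eliminate)
  open Catalecticant F natural-unit using (Factorization; factorization)

  coeff-linearCombination : ∀ {m j n} (a : Fin n → Carrier) (f : Fin n → 𝒮-Carrier m j) β →
    coeff (linearCombination (𝒮 m j) a f) β ≈ sum λ k → a k * coeff (f k) β
  coeff-linearCombination {n = zero}  a f β = refl
  coeff-linearCombination {n = suc n} a f β = +-congˡ (coeff-linearCombination (a ∘ suc) (f ∘ suc) β)

  monomial𝒮 : ∀ {m u} (α : Vec ℕ m) → Vec.sum α ≡ u → 𝒮-Carrier m u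
  monomial𝒮 α p = mk𝒮 (monomial α) (≡.subst (λ j → Homogeneous j (monomial α)) p (monomial-homogeneous α))

  Cat-monomial : ∀ {m u v d} (u+v≡d : u ℕ.+ v ≡ d) (g : 𝒮-Carrier m d) α p β →
    coeff (Cat {m} {u} {v} u+v≡d g (monomial𝒮 α p)) β ≈ ∂^ α (coeff g) β
  Cat-monomial u+v≡d g α p β = trans
    (listSum-exponents (λ α′ → monomial α α′ * ∂^ α′ (coeff g) β) α p
      (λ α′ α′≢α → trans (*-congʳ (reflexive (≡.cong (if_then 1# else 0#) (dec-false (Vecₚ.≡-dec ℕₚ._≟_ α′ α) α′≢α))))
        (zeroˡ _)))
    (trans (*-congʳ (reflexive (≡.cong (if_then 1# else 0#) (dec-true (Vecₚ.≡-dec ℕₚ._≟_ α α) ≡.refl)))) (*-identityˡ _))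

  module _ {u v d} (u+v≡d : u ℕ.+ v ≡ d) where

    private
      m : ℕ
      m = 2 ℕ.* d ∸ 1

      rows columns : List (Vec ℕ m)
      rows = exponents m u
      columns = exponents m v

      row : Fin (List.length rows) → Vec ℕ m
      row = List.lookup rows

      column : Fin (List.length columns) → Vec ℕ m
      column = List.lookup columns

      M : Fin (List.length rows) → Fin (List.length columns) → F.Carrier
      M i j = Q.∂^ (row i) (Q.coeff (Q.h d)) (column j)

      M-↦ : ∀ i j → ∂^ (row i) (coeff (h d)) (column j) ≈ φ (M i j)
      M-↦ i j = ∂^-↦ (row i) (h-↦ d) (column j)

      H : 𝒮-Carrier m u → 𝒮-Carrier m v
      H = Cat u+v≡d (h d)

      H-column : ∀ f j → coeff (H f) (column j) ≈ sum λ i → coeff f (row i) * φ (M i j)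
      H-column f j = trans (listSum-lookup (λ α → coeff f α * ∂^ α (coeff (h d)) (column j)) rows)
        (sum-cong-≋ λ i → *-congˡ (M-↦ i j))

    -- Row `i` of `M` holds the coefficients of the image of the `i`-th monomial, so the monomials
    -- of the pivot rows have images forming a basis of the image. Coordinates of other images
    -- follow linearly, with no test for zero in `K`.
    rowBasis⇒rank : ∀ {N} (B : Basis M N) → HasRank (𝒮 m u) (𝒮 m v) H (Basis.rank B)
    rowBasis⇒rank B = record
      { x           = x
      ; independent = λ a p → independent a λ j → trans
          (sum-cong-≋ λ k → *-congˡ (sym (Hx k j)))
          (trans (sym (coeff-linearCombination a (H ∘ x) (column j))) (p (column j)))
      ; spanning    = λ f → coordinates f , spans f
      }
      where
      open Basis B renaming (row to pivot)

      x : Fin rank → 𝒮-Carrier m u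
      x k = monomial𝒮 (row (pivot k)) (exponents-lookup m u (pivot k))

      Hx : ∀ k j → coeff (H (x k)) (column j) ≈ φ (M (pivot k) j)
      Hx k j = trans (Cat-monomial u+v≡d (h d) (row (pivot k)) (exponents-lookup m u (pivot k)) (column j)) (M-↦ (pivot k) j)

      coordinates : 𝒮-Carrier m u → Fin rank → Carrier
      coordinates f k = sum λ i → coeff f (row i) * φ (coordinate i k)

      spans-column : ∀ f j →
        coeff (H f) (column j) ≈ coeff (linearCombination (𝒮 m v) (coordinates f) (H ∘ x)) (column j)
      spans-column f j = begin
        coeff (H f) (column j)
          ≈⟨ H-column f j ⟩
        sum (λ i → coeff f (row i) * φ (M i j))
          ≈⟨ sum-cong-≋ (λ i → trans (*-congˡ (trans (φ.⟦⟧-cong (spanning i j))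
               (trans (sym (sum-↦ (λ k → coordinate i k F.* M (pivot k) j) _ λ k → refl)) (sum-cong-≋ λ k → φ.*-homo (coordinate i k) (M (pivot k) j)))))
               (*-distribˡ-sum (coeff f (row i)) (λ k → φ (coordinate i k) * φ (M (pivot k) j)))) ⟩
        sum (λ i → sum λ k → coeff f (row i) * (φ (coordinate i k) * φ (M (pivot k) j)))
          ≈⟨ ∑-comm (λ i k → coeff f (row i) * (φ (coordinate i k) * φ (M (pivot k) j))) ⟩
        sum (λ k → sum λ i → coeff f (row i) * (φ (coordinate i k) * φ (M (pivot k) j)))
          ≈⟨ sum-cong-≋ (λ k → trans
               (sum-cong-≋ λ i → sym (*-assoc (coeff f (row i)) (φ (coordinate i k)) (φ (M (pivot k) j))))
               (trans (sym (*-distribʳ-sum (φ (M (pivot k) j)) (λ i → coeff f (row i) * φ (coordinate i k))))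
                 (*-congˡ (sym (Hx k j))))) ⟩
        sum (λ k → coordinates f k * coeff (H (x k)) (column j))
          ≈⟨ coeff-linearCombination (coordinates f) (H ∘ x) (column j) ⟨
        coeff (linearCombination (𝒮 m v) (coordinates f) (H ∘ x)) (column j) ∎
        where open SetoidReasoning setoid

      spans : ∀ f β → coeff (H f) β ≈ coeff (linearCombination (𝒮 m v) (coordinates f) (H ∘ x)) β
      -- Outside degree `v` both sides vanish by homogeneity; in degree `v` every exponent vector is
      -- one of the columns.
      spans f β with Vec.sum β ℕₚ.≟ v
      ... | no β≢v = trans (homogeneous (H f) β β≢v)
        (sym (homogeneous (linearCombination (𝒮 m v) (coordinates f) (H ∘ x)) β β≢v))
      ... | yes β≡v = ≡.subst
        (λ γ → coeff (H f) γ ≈ coeff (linearCombination (𝒮 m v) (coordinates f) (H ∘ x)) γ)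
        (≡.sym (lookup-index β∈)) (spans-column f (Any.index β∈))
        where
        β∈ : β ∈ columns
        β∈ = ∈-exponents β β≡v

    catalecticant-rank : ∃ λ r → HasRank (𝒮 m u) (𝒮 m v) H r × r ℕ.≤ rankBound d
    catalecticant-rank with factorization {u} {v} u+v≡d
    ... | N , N≤ , fac = Basis.rank B , rowBasis⇒rank B , ℕₚ.≤-trans (Basis.rank≤ B) N≤
      where
      open Factorization fac
      B : Basis M N
      B = eliminate inverse? M
        (λ i → left (row i) (exponents-lookup m u i)) (λ n j → right (column j) (exponents-lookup m v j) n)
        (λ i j → factors (row i) (exponents-lookup m u i) (column j) (exponents-lookup m v j))

-- Specialization to ℚ inside ℂ, and the numerical bound.

open import Defs
open import Data.Integer.Base using (+_)
open import Data.Nat.Base using (_+_; _*_; _∸_; _^_; _≤_; _>_)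
open import Data.Rational.Base using (ℚ; 0ℚ; 1ℚ; _/_; _<_)

private
  module ℂ = Complexification ℝ-commutativeRing

fromℚ : ℚ → ℂ.Complex
fromℚ q = ι q ℂ.+i ι 0ℚ

fromℚ-homo : IsRingHomomorphism (CommutativeRing.rawRing ℚₚ.+-*-commutativeRing)
                                (CommutativeRing.rawRing ℂ-commutativeRing) fromℚ
fromℚ-homo = record
  { isSemiringHomomorphism = record
    { isNearSemiringHomomorphism = record
      { +-isMonoidHomomorphism = record
        { isMagmaHomomorphism = record
          { isRelHomomorphism = record { cong = λ { ≡.refl → ℂ.mk≈ᶜ ≈ℝ-refl ≈ℝ-refl } }
          ; homo = λ p q → ℂ.mk≈ᶜ (pointwise λ _ → ≡.refl) (pointwise λ _ → ≡.refl)
          }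
        ; ε-homo = ℂ.mk≈ᶜ ≈ℝ-refl ≈ℝ-refl
        }
      ; *-homo = λ p q → ℂ.mk≈ᶜ
          (pointwise λ _ → ≡.sym (ℚₚ.+-identityʳ (p ℚ.* q)))
          (pointwise λ _ → ≡.sym (≡.trans (≡.cong₂ ℚ._+_ (ℚₚ.*-zeroʳ p) (ℚₚ.*-zeroˡ q)) (ℚₚ.+-identityˡ 0ℚ)))
      }
    ; 1#-homo = ℂ.mk≈ᶜ ≈ℝ-refl ≈ℝ-refl
    }
  ; -‿homo = λ p → ℂ.mk≈ᶜ (pointwise λ _ → ≡.refl) (pointwise λ _ → ≡.refl)
  }

inverse? : ∀ x → x ≡ 0ℚ ⊎ Univariate.Unit ℚₚ.+-*-commutativeRing x
inverse? x with x ℚₚ.≟ 0ℚ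
... | yes x≡0 = inj₁ x≡0
... | no x≢0  = inj₂ (ℚ.1/ x , ℚₚ.*-inverseʳ x)
  where instance _ = ℚ.≢-nonZero x≢0

infixr 8 _·1

_·1 : ℕ → ℚ
n ·1 = Mult._×_ ℚₚ.+-0-monoid n 1ℚ

naturals-nonNegative : ∀ n → 0ℚ ℚ.≤ n ·1
naturals-nonNegative zero    = ℚₚ.≤-refl
naturals-nonNegative (suc n) = ℚₚ.+-mono-≤ (ℚₚ.<⇒≤ 0<1) (naturals-nonNegative n)

natural-unit : ∀ n → Univariate.Unit ℚₚ.+-*-commutativeRing (suc n ·1)
natural-unit n with inverse? (suc n ·1)
... | inj₂ unit  = unit
... | inj₁ n+1≡0 = contradiction n+1≡0 (ℚₚ.<⇒≢ (ℚₚ.+-mono-<-≤ 0<1 (naturals-nonNegative n)) ∘ ≡.sym)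

fromℕ : ℕ → ℚ
fromℕ n = + n / 1

toℚᵘ-fromℕ : ∀ n → ℚ.toℚᵘ (fromℕ n) ℚᵘ.≃ ℚᵘ.mkℚᵘ (+ n) 0
toℚᵘ-fromℕ n = ℚₚ.toℚᵘ-fromℚᵘ (ℚᵘ.mkℚᵘ (+ n) 0)

fromℕ-* : ∀ m n → fromℕ m ℚ.* fromℕ n ≡ fromℕ (m * n)
fromℕ-* m n = ℚₚ.toℚᵘ-injective (begin
  ℚ.toℚᵘ (fromℕ m ℚ.* fromℕ n)                ≈⟨ ℚₚ.toℚᵘ-homo-* (fromℕ m) (fromℕ n) ⟩
  ℚ.toℚᵘ (fromℕ m) ℚᵘ.* ℚ.toℚᵘ (fromℕ n)      ≈⟨ ℚᵘₚ.*-cong (toℚᵘ-fromℕ m) (toℚᵘ-fromℕ n) ⟩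
  ℚᵘ.mkℚᵘ (+ m) 0 ℚᵘ.* ℚᵘ.mkℚᵘ (+ n) 0        ≈⟨ ℚᵘ.*≡* (≡.cong (ℤ._* + 1) (≡.sym (ℤₚ.pos-* m n))) ⟩
  ℚᵘ.mkℚᵘ (+ (m * n)) 0                       ≈⟨ toℚᵘ-fromℕ (m * n) ⟨
  ℚ.toℚᵘ (fromℕ (m * n))                      ∎)
  where open SetoidReasoning ℚᵘₚ.≃-setoid

fromℕ-< : ∀ {m n} → m ℕ.< n → fromℕ m < fromℕ n
fromℕ-< {m} {n} m<n = ℚₚ.toℚᵘ-cancel-< (ℚᵘₚ.<-respˡ-≃ (ℚᵘₚ.≃-sym (toℚᵘ-fromℕ m))
  (ℚᵘₚ.<-respʳ-≃ (ℚᵘₚ.≃-sym (toℚᵘ-fromℕ n)) (ℚᵘ.*<* (ℤₚ.*-monoʳ-<-pos (+ 1) (ℤ.+<+ m<n)))))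

power-of-13/5 : ∀ d → (+ 13 / 5) ^ℚ d ℚ.* fromℕ (5 ^ d) ≡ fromℕ (13 ^ d)
power-of-13/5 zero    = ≡.refl
power-of-13/5 (suc d) = begin
  (+ 13 / 5) ℚ.* x ℚ.* fromℕ (5 * 5 ^ d)             ≡⟨ ≡.cong ((+ 13 / 5) ℚ.* x ℚ.*_) (fromℕ-* 5 (5 ^ d)) ⟨
  (+ 13 / 5) ℚ.* x ℚ.* (fromℕ 5 ℚ.* fromℕ (5 ^ d))   ≡⟨ interchange (+ 13 / 5) x (fromℕ 5) (fromℕ (5 ^ d)) ⟩
  fromℕ 13 ℚ.* (x ℚ.* fromℕ (5 ^ d))                 ≡⟨ ≡.cong (fromℕ 13 ℚ.*_) (power-of-13/5 d) ⟩
  fromℕ 13 ℚ.* fromℕ (13 ^ d)                        ≡⟨ fromℕ-* 13 (13 ^ d) ⟩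
  fromℕ (13 * 13 ^ d)                                ∎
  where
  open ≡.≡-Reasoning
  open CommutativeSemigroupProperties
    (CommutativeRing.*-commutativeSemigroup ℚₚ.+-*-commutativeRing) using (interchange)
  x : ℚ
  x = (+ 13 / 5) ^ℚ d

-- Multiplying by 5^d clears the denominator of 2.6 = 13/5 and leaves `power-bound`, an inequality
-- of natural numbers.
rankBound<2·6^ : ∀ d → d > 0 → fromℕ (rankBound d) < (+ 13 / 5) ^ℚ d
rankBound<2·6^ d 0<d = ℚₚ.*-cancelʳ-<-nonNeg (fromℕ (5 ^ d)) (begin-strict
  fromℕ (rankBound d) ℚ.* fromℕ (5 ^ d)  ≡⟨ fromℕ-* (rankBound d) (5 ^ d) ⟩
  fromℕ (rankBound d * 5 ^ d)            ≡⟨ ≡.cong fromℕ (ℕₚ.*-comm (rankBound d) (5 ^ d)) ⟩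
  fromℕ (5 ^ d * rankBound d)            <⟨ fromℕ-< (power-bound d 0<d) ⟩
  fromℕ (13 ^ d)                         ≡⟨ power-of-13/5 d ⟨
  (+ 13 / 5) ^ℚ d ℚ.* fromℕ (5 ^ d)      ∎)
  where
  open ℚₚ.≤-Reasoning
  instance
    nonNegative : ℚ.NonNegative (fromℕ (5 ^ d))
    nonNegative = ℚₚ.normalize-nonNeg (5 ^ d) 1

theorem43 : ∀ (d u v : ℕ) → d > 0 → u > 0 → v > 0 → (u+v≡d : u + v ≡ d) →
    (∃[ r ] HasRank (𝒮 (2 * d ∸ 1) u) (𝒮 (2 * d ∸ 1) v) (Cat u+v≡d (h d)) r
            × r ≤ ⌈ 3 * d /2⌉ C ⌊ d /2⌋)
    × (+ (⌈ 3 * d /2⌉ C ⌊ d /2⌋) / 1) < (+ 13 / 5) ^ℚ d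
theorem43 d u v d>0 u>0 v>0 u+v≡d = catalecticant-rank u+v≡d , rankBound<2·6^ d d>0
  where
  open CatalecticantRank ℚₚ.+-*-commutativeRing ℂ-commutativeRing fromℚ fromℚ-homo inverse? natural-unit
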